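{- Let $s,t\geq 1$ be integers and let $p,q,l$ be three distinct primes with $p,q$ odd, $p\equiv 3 \pmod 4$, $\mathrm{ord}_{p^s}(l)=\phi(p^s)/2$, $\mathrm{ord}_{q^t}(l)=\phi(q^t)$ and $\gcd(\phi(p^s),\phi(q^t))=2$. Let $0\leq i<i'\leq s-1$ and $0\leq j\leq t-1$. Then in the ring $\mathbb{F}_l[x]/\langle x^{p^sq^t}-1\rangle$: (i) If $q$ is a quadratic residue modulo $p$, then \[\chi_{ij}^*\chi_{i'j}=\frac{\phi(p^{s-i'})}{2}(q-2)q^{t-j-1}\chi_{ij}^*+\frac{\phi(p^{s-i'})}{2}\phi(q^{t-j})\sum_{j<m\leq t}\chi_{im}^*.\] (ii) If $q$ is a quadratic nonresidue modulo $p$, then \[ \chi_{ij}^*\chi_{i'j}=\frac{\phi(p^{s-i'})}{2}(q-2)q^{t-j-1}\chi_{ij}^*+\frac{\phi(p^{s-i'})}{2}\phi(q^{t-j})\Big(\sum_{\substack{j<m\leq t\\2\nmid m-j}}\chi_{im}+\sum_{\substack{j<m\leq t\\2\mid m-j}}\chi_{im}^*\Big). \]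
   Context: Here $\phi$ is Euler's phi function (with $\phi(1)=1$) and $\mathrm{ord}_m(k)$ is the multiplicative order of $k$ modulo $m$. Put $n=p^sq^t$. Fix an integer $g$ that is a primitive root both modulo $p^s$ and modulo $q^t$. For an integer $\gamma$, $C_\gamma=\{\gamma l^r \bmod n: r\geq 0\}\subseteq \mathbb{Z}_n$ is the $l$-cyclotomic coset modulo $n$ containing $\gamma$. For $0\leq i\leq s$, $0\leq j\leq t$ set $C_{ij}=C_{p^iq^j}$ and $C_{ij}^*=C_{p^iq^jg}$. Define elements of $\mathbb{F}_l[x]/\langle x^{n}-1\rangle$ by $\chi_{ij}=\sum_{\alpha\in C_{ij}}x^\alpha$ and $\chi_{ij}^*=\sum_{\alpha\in C_{ij}^*}x^\alpha$. Integer coefficients are read in $\mathbb{F}_l$, and empty sums are $0$. -}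

module Defs where

open import Level using (Level; 0ℓ; _⊔_)
open import Algebra.Bundles using (CommutativeRing)
open import Algebra.Structures using (IsCommutativeRing)
import Algebra.Properties.Ring as RingProperties
import Algebra.Properties.CommutativeSemigroup as CommutativeSemigroupProperties
open import Data.Nat.Base as ℕ using (ℕ; zero; suc; _∸_; s≤s; z≤n)
import Data.Nat.Properties as ℕ
import Data.Nat.Divisibility as ℕ
import Data.Nat.Coprimality as ℕ
open import Data.Nat.Induction using (<-wellFounded)
open import Data.Integer.Base as ℤ using (ℤ; +_)
import Data.Integer.Properties as ℤ
open import Data.Integer.Divisibility.Signed as ℤ using (divides; _∣_; _∣?_)
import Data.Integer.DivMod as ℤ
open import Data.Integer.Tactic.RingSolver using (solve-∀)
open import Data.Fin.Base as Fin using (Fin; toℕ; fromℕ<)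
import Data.Fin.Properties as Fin
open import Data.List.Base as List
  using (List; []; _∷_; _++_; filter; foldr; length; map; replicate; upTo; allFin)
open import Data.Product.Base using (∃; _×_; _,_; proj₁; proj₂)
open import Function.Base using (_∘_)
open import Induction.WellFounded using (Acc; acc)
open import Relation.Binary.Core using (Rel)
open import Relation.Binary.PropositionalEquality as ≡ using (_≡_; refl)
import Relation.Binary.Reasoning.Setoid as SetoidReasoning
open import Relation.Nullary using (¬_; yes; no)
open import Relation.Nullary.Decidable using (map′; ¬?)
open import Relation.Unary using (Pred; Decidable)

private
  variable
    c ℓ : Level

module PrincipalQuotient (R : CommutativeRing c ℓ) (m : CommutativeRing.Carrier R) where
  open CommutativeRing R hiding (refl)
  private module R = CommutativeRing R
  open RingProperties ring using (-‿distribˡ-*; -‿+-comm)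
  open CommutativeSemigroupProperties +-commutativeSemigroup using (interchange)
  open SetoidReasoning setoid

  -- x and y are identified when x ∈ y + ⟨m⟩.
  infix 4 _≈ₘ_
  _≈ₘ_ : Rel Carrier (c ⊔ ℓ)
  x ≈ₘ y = ∃ λ k → x ≈ y + k * m

  ≈⇒≈ₘ : ∀ {x y} → x ≈ y → x ≈ₘ y
  ≈⇒≈ₘ {x} {y} x≈y = 0# , (begin
    x            ≈⟨ x≈y ⟩
    y            ≈⟨ +-identityʳ y ⟨
    y + 0#       ≈⟨ +-congˡ (zeroˡ m) ⟨
    y + 0# * m   ∎)

  ≈ₘ-sym : ∀ {x y} → x ≈ₘ y → y ≈ₘ x
  ≈ₘ-sym {x} {y} (k , x≈) = - k , (begin
    y                        ≈⟨ +-identityʳ y ⟨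
    y + 0#                   ≈⟨ +-congˡ (-‿inverseʳ (k * m)) ⟨
    y + (k * m - k * m)      ≈⟨ +-assoc _ _ _ ⟨
    y + k * m - k * m        ≈⟨ +-cong (R.sym x≈) (-‿distribˡ-* k m) ⟩
    x + - k * m              ∎)

  ≈ₘ-trans : ∀ {x y z} → x ≈ₘ y → y ≈ₘ z → x ≈ₘ z
  ≈ₘ-trans {x} {y} {z} (k , x≈) (k′ , y≈) = k′ + k , (begin
    x                        ≈⟨ x≈ ⟩
    y + k * m                ≈⟨ +-congʳ y≈ ⟩
    z + k′ * m + k * m       ≈⟨ +-assoc _ _ _ ⟩
    z + (k′ * m + k * m)     ≈⟨ +-congˡ (distribʳ m k′ k) ⟨
    z + (k′ + k) * m         ∎)

  +-congₘ : ∀ {x y u v} → x ≈ₘ y → u ≈ₘ v → x + u ≈ₘ y + v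
  +-congₘ {x} {y} {u} {v} (k , x≈) (k′ , u≈) = k + k′ , (begin
    x + u                        ≈⟨ +-cong x≈ u≈ ⟩
    y + k * m + (v + k′ * m)     ≈⟨ interchange _ _ _ _ ⟩
    y + v + (k * m + k′ * m)     ≈⟨ +-congˡ (distribʳ m k k′) ⟨
    y + v + (k + k′) * m         ∎)

  *-congˡₘ : ∀ {x y} z → x ≈ₘ y → z * x ≈ₘ z * y
  *-congˡₘ {x} {y} z (k , x≈) = z * k , (begin
    z * x                  ≈⟨ *-congˡ x≈ ⟩
    z * (y + k * m)        ≈⟨ distribˡ z y _ ⟩
    z * y + z * (k * m)    ≈⟨ +-congˡ (*-assoc z k m) ⟨
    z * y + z * k * m      ∎)

  *-congₘ : ∀ {x y u v} → x ≈ₘ y → u ≈ₘ v → x * u ≈ₘ y * v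
  *-congₘ {x} {y} {u} {v} x≈y u≈v =
    ≈ₘ-trans (*-congˡₘ x u≈v)
      (≈ₘ-trans (≈⇒≈ₘ (*-comm x v))
        (≈ₘ-trans (*-congˡₘ v x≈y) (≈⇒≈ₘ (*-comm v y))))

  -‿congₘ : ∀ {x y} → x ≈ₘ y → - x ≈ₘ - y
  -‿congₘ {x} {y} (k , x≈) = - k , (begin
    - x                  ≈⟨ -‿cong x≈ ⟩
    - (y + k * m)        ≈⟨ -‿+-comm y (k * m) ⟨
    - y - k * m          ≈⟨ +-congˡ (-‿distribˡ-* k m) ⟩
    - y + - k * m        ∎)

  isCommutativeRingₘ : IsCommutativeRing _≈ₘ_ _+_ _*_ -_ 0# 1#
  isCommutativeRingₘ = record
    { isRing = record
      { +-isAbelianGroup = record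
        { isGroup = record
          { isMonoid = record
            { isSemigroup = record
              { isMagma = record
                { isEquivalence = record
                  { refl = ≈⇒≈ₘ R.refl ; sym = ≈ₘ-sym ; trans = ≈ₘ-trans }
                ; ∙-cong = +-congₘ
                }
              ; assoc = λ x y z → ≈⇒≈ₘ (+-assoc x y z)
              }
            ; identity = (≈⇒≈ₘ ∘ +-identityˡ) , (≈⇒≈ₘ ∘ +-identityʳ)
            }
          ; inverse = (≈⇒≈ₘ ∘ -‿inverseˡ) , (≈⇒≈ₘ ∘ -‿inverseʳ)
          ; ⁻¹-cong = -‿congₘ
          }
        ; comm = λ x y → ≈⇒≈ₘ (+-comm x y)
        }
      ; *-cong = *-congₘ
      ; *-assoc = λ x y z → ≈⇒≈ₘ (*-assoc x y z)
      ; *-identity = (≈⇒≈ₘ ∘ *-identityˡ) , (≈⇒≈ₘ ∘ *-identityʳ)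
      ; distrib = (λ x y z → ≈⇒≈ₘ (distribˡ x y z)) , (λ x y z → ≈⇒≈ₘ (distribʳ x y z))
      }
    ; *-comm = λ x y → ≈⇒≈ₘ (*-comm x y)
    }

infix 8 _/⟨_⟩
_/⟨_⟩ : (R : CommutativeRing c ℓ) → CommutativeRing.Carrier R → CommutativeRing c (c ⊔ ℓ)
R /⟨ m ⟩ = record { isCommutativeRing = PrincipalQuotient.isCommutativeRingₘ R m }

-- Polynomials are coefficient lists, constant coefficient first;
-- trailing zeros are irrelevant for equality.
module Polynomial (R : CommutativeRing c ℓ) where
  open CommutativeRing R hiding (refl)
  private module R = CommutativeRing R
  open RingProperties ring using (-0#≈0#)

  Poly : Set c
  Poly = List Carrier

  coeff : Poly → ℕ → Carrier
  coeff []      _       = 0#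
  coeff (a ∷ f) zero    = a
  coeff (a ∷ f) (suc k) = coeff f k

  -- A record, so that the polynomials can be inferred from the equality.
  infix 4 _≈ₚ_
  record _≈ₚ_ (f g : Poly) : Set ℓ where
    constructor mk≈ₚ
    field coeff-≈ : ∀ k → coeff f k ≈ coeff g k
  open _≈ₚ_ public

  infixl 6 _+ₚ_
  infixl 7 _*ₚ_ _·ₚ_

  _+ₚ_ : Poly → Poly → Poly
  []      +ₚ g       = g
  (a ∷ f) +ₚ []      = a ∷ f
  (a ∷ f) +ₚ (b ∷ g) = a + b ∷ f +ₚ g

  _·ₚ_ : Carrier → Poly → Poly
  a ·ₚ f = map (a *_) f

  _*ₚ_ : Poly → Poly → Poly
  []      *ₚ g = []
  (a ∷ f) *ₚ g = a ·ₚ g +ₚ (0# ∷ f *ₚ g)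

  -ₚ_ : Poly → Poly
  -ₚ f = map -_ f

  const : Carrier → Poly
  const a = a ∷ []

  X^_ : ℕ → Poly
  X^ k = replicate k 0# ++ (1# ∷ [])

  coeff-+ : ∀ f g k → coeff (f +ₚ g) k ≈ coeff f k + coeff g k
  coeff-+ []      g       k       = R.sym (+-identityˡ _)
  coeff-+ (a ∷ f) []      k       = R.sym (+-identityʳ _)
  coeff-+ (a ∷ f) (b ∷ g) zero    = R.refl
  coeff-+ (a ∷ f) (b ∷ g) (suc k) = coeff-+ f g k

  coeff-· : ∀ a f k → coeff (a ·ₚ f) k ≈ a * coeff f k
  coeff-· a []      k       = R.sym (zeroʳ a)
  coeff-· a (b ∷ f) zero    = R.refl
  coeff-· a (b ∷ f) (suc k) = coeff-· a f k

  coeff-neg : ∀ f k → coeff (-ₚ f) k ≈ - coeff f k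
  coeff-neg []      k       = R.sym -0#≈0#
  coeff-neg (a ∷ f) zero    = R.refl
  coeff-neg (a ∷ f) (suc k) = coeff-neg f k

  ≈ₚ-refl : ∀ {f} → f ≈ₚ f
  ≈ₚ-refl = mk≈ₚ λ k → R.refl

  ≈ₚ-sym : ∀ {f g} → f ≈ₚ g → g ≈ₚ f
  ≈ₚ-sym e = mk≈ₚ λ k → R.sym (coeff-≈ e k)

  ≈ₚ-trans : ∀ {f g h} → f ≈ₚ g → g ≈ₚ h → f ≈ₚ h
  ≈ₚ-trans e e′ = mk≈ₚ λ k → R.trans (coeff-≈ e k) (coeff-≈ e′ k)

  private
    infixr 2 _⟫_
    _⟫_ : ∀ {f g h} → f ≈ₚ g → g ≈ₚ h → f ≈ₚ h
    _⟫_ = ≈ₚ-trans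

  ∷-cong : ∀ {a b f g} → a ≈ b → f ≈ₚ g → a ∷ f ≈ₚ b ∷ g
  ∷-cong a≈b f≈g = mk≈ₚ λ { zero → a≈b ; (suc k) → coeff-≈ f≈g k }

  0∷[] : 0# ∷ [] ≈ₚ []
  0∷[] = mk≈ₚ λ { zero → R.refl ; (suc k) → R.refl }

  +ₚ-cong : ∀ {f f′ g g′} → f ≈ₚ f′ → g ≈ₚ g′ → f +ₚ g ≈ₚ f′ +ₚ g′
  +ₚ-cong {f} {f′} {g} {g′} e e′ = mk≈ₚ λ k →
    R.trans (coeff-+ f g k)
      (R.trans (+-cong (coeff-≈ e k) (coeff-≈ e′ k)) (R.sym (coeff-+ f′ g′ k)))

  +ₚ-assoc : ∀ f g h → (f +ₚ g) +ₚ h ≈ₚ f +ₚ (g +ₚ h)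
  +ₚ-assoc []      g       h       = ≈ₚ-refl
  +ₚ-assoc (a ∷ f) []      h       = ≈ₚ-refl
  +ₚ-assoc (a ∷ f) (b ∷ g) []      = ≈ₚ-refl
  +ₚ-assoc (a ∷ f) (b ∷ g) (c ∷ h) = ∷-cong (+-assoc a b c) (+ₚ-assoc f g h)

  +ₚ-comm : ∀ f g → f +ₚ g ≈ₚ g +ₚ f
  +ₚ-comm []      []      = ≈ₚ-refl
  +ₚ-comm []      (b ∷ g) = ≈ₚ-refl
  +ₚ-comm (a ∷ f) []      = ≈ₚ-refl
  +ₚ-comm (a ∷ f) (b ∷ g) = ∷-cong (+-comm a b) (+ₚ-comm f g)

  +ₚ-identityʳ : ∀ f → f +ₚ [] ≈ₚ f
  +ₚ-identityʳ f = +ₚ-comm f []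

  +ₚ-interchange : ∀ f g h k → (f +ₚ g) +ₚ (h +ₚ k) ≈ₚ (f +ₚ h) +ₚ (g +ₚ k)
  +ₚ-interchange f g h k =
    +ₚ-assoc f g (h +ₚ k)
    ⟫ +ₚ-cong (≈ₚ-refl {f})
        (≈ₚ-sym (+ₚ-assoc g h k)
        ⟫ +ₚ-cong (+ₚ-comm g h) (≈ₚ-refl {k})
        ⟫ +ₚ-assoc h g k)
    ⟫ ≈ₚ-sym (+ₚ-assoc f h (g +ₚ k))

  -ₚ‿cong : ∀ {f g} → f ≈ₚ g → -ₚ f ≈ₚ -ₚ g
  -ₚ‿cong {f} {g} e = mk≈ₚ λ k →
    R.trans (coeff-neg f k) (R.trans (-‿cong (coeff-≈ e k)) (R.sym (coeff-neg g k)))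

  -ₚ‿inverseˡ : ∀ f → -ₚ f +ₚ f ≈ₚ []
  -ₚ‿inverseˡ []      = ≈ₚ-refl
  -ₚ‿inverseˡ (a ∷ f) = ∷-cong (-‿inverseˡ a) (-ₚ‿inverseˡ f) ⟫ 0∷[]

  ·ₚ-cong : ∀ {a b f g} → a ≈ b → f ≈ₚ g → a ·ₚ f ≈ₚ b ·ₚ g
  ·ₚ-cong {a} {b} {f} {g} a≈b e = mk≈ₚ λ k →
    R.trans (coeff-· a f k) (R.trans (*-cong a≈b (coeff-≈ e k)) (R.sym (coeff-· b g k)))

  ·ₚ-distribˡ : ∀ a f g → a ·ₚ (f +ₚ g) ≈ₚ a ·ₚ f +ₚ a ·ₚ g
  ·ₚ-distribˡ a []      g       = ≈ₚ-refl
  ·ₚ-distribˡ a (b ∷ f) []      = ≈ₚ-refl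
  ·ₚ-distribˡ a (b ∷ f) (c ∷ g) = ∷-cong (distribˡ a b c) (·ₚ-distribˡ a f g)

  ·ₚ-distribʳ : ∀ a b f → (a + b) ·ₚ f ≈ₚ a ·ₚ f +ₚ b ·ₚ f
  ·ₚ-distribʳ a b []      = ≈ₚ-refl
  ·ₚ-distribʳ a b (c ∷ f) = ∷-cong (distribʳ c a b) (·ₚ-distribʳ a b f)

  ·ₚ-assoc : ∀ a b f → a ·ₚ (b ·ₚ f) ≈ₚ (a * b) ·ₚ f
  ·ₚ-assoc a b []      = ≈ₚ-refl
  ·ₚ-assoc a b (c ∷ f) = ∷-cong (R.sym (*-assoc a b c)) (·ₚ-assoc a b f)

  ·ₚ-zero : ∀ f → 0# ·ₚ f ≈ₚ []
  ·ₚ-zero f = mk≈ₚ λ k → R.trans (coeff-· 0# f k) (zeroˡ _)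

  ·ₚ-identity : ∀ f → 1# ·ₚ f ≈ₚ f
  ·ₚ-identity f = mk≈ₚ λ k → R.trans (coeff-· 1# f k) (*-identityˡ _)

  0∷-+ : ∀ f g → 0# ∷ (f +ₚ g) ≈ₚ (0# ∷ f) +ₚ (0# ∷ g)
  0∷-+ f g = ∷-cong (R.sym (+-identityˡ 0#)) ≈ₚ-refl

  *ₚ-congˡ : ∀ f {g h} → g ≈ₚ h → f *ₚ g ≈ₚ f *ₚ h
  *ₚ-congˡ []      e = ≈ₚ-refl
  *ₚ-congˡ (a ∷ f) e = +ₚ-cong (·ₚ-cong R.refl e) (∷-cong R.refl (*ₚ-congˡ f e))

  *ₚ-zeroʳ : ∀ f → f *ₚ [] ≈ₚ []
  *ₚ-zeroʳ []      = ≈ₚ-refl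
  *ₚ-zeroʳ (a ∷ f) = ∷-cong R.refl (*ₚ-zeroʳ f) ⟫ 0∷[]

  *ₚ-∷ʳ : ∀ f b g → f *ₚ (b ∷ g) ≈ₚ b ·ₚ f +ₚ (0# ∷ f *ₚ g)
  *ₚ-∷ʳ []      b g = ≈ₚ-sym 0∷[]
  *ₚ-∷ʳ (a ∷ f) b g = ∷-cong (+-congʳ (*-comm a b))
    (+ₚ-cong (≈ₚ-refl {a ·ₚ g}) (*ₚ-∷ʳ f b g)
    ⟫ ≈ₚ-sym (+ₚ-assoc (a ·ₚ g) (b ·ₚ f) _)
    ⟫ +ₚ-cong (+ₚ-comm (a ·ₚ g) (b ·ₚ f)) ≈ₚ-refl
    ⟫ +ₚ-assoc (b ·ₚ f) (a ·ₚ g) _)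

  *ₚ-comm : ∀ f g → f *ₚ g ≈ₚ g *ₚ f
  *ₚ-comm []      g = ≈ₚ-sym (*ₚ-zeroʳ g)
  *ₚ-comm (a ∷ f) g =
    +ₚ-cong (≈ₚ-refl {a ·ₚ g}) (∷-cong R.refl (*ₚ-comm f g)) ⟫ ≈ₚ-sym (*ₚ-∷ʳ g a f)

  *ₚ-cong : ∀ {f f′ g g′} → f ≈ₚ f′ → g ≈ₚ g′ → f *ₚ g ≈ₚ f′ *ₚ g′
  *ₚ-cong {f} {f′} {g} {g′} e e′ =
    *ₚ-congˡ f e′ ⟫ *ₚ-comm f g′ ⟫ *ₚ-congˡ g′ e ⟫ *ₚ-comm g′ f′

  *ₚ-distribˡ : ∀ f g h → f *ₚ (g +ₚ h) ≈ₚ f *ₚ g +ₚ f *ₚ h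
  *ₚ-distribˡ []      g h = ≈ₚ-refl
  *ₚ-distribˡ (a ∷ f) g h =
    +ₚ-cong (·ₚ-distribˡ a g h) (∷-cong R.refl (*ₚ-distribˡ f g h) ⟫ 0∷-+ (f *ₚ g) (f *ₚ h))
    ⟫ +ₚ-interchange (a ·ₚ g) (a ·ₚ h) _ _

  *ₚ-distribʳ : ∀ f g h → (g +ₚ h) *ₚ f ≈ₚ g *ₚ f +ₚ h *ₚ f
  *ₚ-distribʳ f g h =
    *ₚ-comm (g +ₚ h) f ⟫ *ₚ-distribˡ f g h ⟫ +ₚ-cong (*ₚ-comm f g) (*ₚ-comm f h)

  ·ₚ-*ₚ : ∀ a f g → (a ·ₚ f) *ₚ g ≈ₚ a ·ₚ (f *ₚ g)
  ·ₚ-*ₚ a []      g = ≈ₚ-refl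
  ·ₚ-*ₚ a (b ∷ f) g =
    +ₚ-cong (≈ₚ-sym (·ₚ-assoc a b g)) (∷-cong (R.sym (zeroʳ a)) (·ₚ-*ₚ a f g))
    ⟫ ≈ₚ-sym (·ₚ-distribˡ a (b ·ₚ g) _)

  0∷-*ₚ : ∀ f g → (0# ∷ f) *ₚ g ≈ₚ 0# ∷ (f *ₚ g)
  0∷-*ₚ f g = +ₚ-cong (·ₚ-zero g) ≈ₚ-refl

  *ₚ-assoc : ∀ f g h → (f *ₚ g) *ₚ h ≈ₚ f *ₚ (g *ₚ h)
  *ₚ-assoc []      g h = ≈ₚ-refl
  *ₚ-assoc (a ∷ f) g h =
    *ₚ-distribʳ h (a ·ₚ g) (0# ∷ f *ₚ g)
    ⟫ +ₚ-cong (·ₚ-*ₚ a g h) (0∷-*ₚ (f *ₚ g) h ⟫ ∷-cong R.refl (*ₚ-assoc f g h))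

  *ₚ-identityˡ : ∀ f → const 1# *ₚ f ≈ₚ f
  *ₚ-identityˡ f = +ₚ-cong (·ₚ-identity f) 0∷[] ⟫ +ₚ-identityʳ f

  isCommutativeRingₚ : IsCommutativeRing _≈ₚ_ _+ₚ_ _*ₚ_ -ₚ_ [] (const 1#)
  isCommutativeRingₚ = record
    { isRing = record
      { +-isAbelianGroup = record
        { isGroup = record
          { isMonoid = record
            { isSemigroup = record
              { isMagma = record
                { isEquivalence = record { refl = ≈ₚ-refl ; sym = ≈ₚ-sym ; trans = ≈ₚ-trans }
                ; ∙-cong = +ₚ-cong
                }
              ; assoc = +ₚ-assoc
              }
            ; identity = (λ f → ≈ₚ-refl) , +ₚ-identityʳ
            }
          ; inverse = -ₚ‿inverseˡ , λ f → +ₚ-comm f (-ₚ f) ⟫ -ₚ‿inverseˡ f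
          ; ⁻¹-cong = -ₚ‿cong
          }
        ; comm = +ₚ-comm
        }
      ; *-cong = *ₚ-cong
      ; *-assoc = *ₚ-assoc
      ; *-identity = *ₚ-identityˡ , λ f → *ₚ-comm f (const 1#) ⟫ *ₚ-identityˡ f
      ; distrib = *ₚ-distribˡ , *ₚ-distribʳ
      }
    ; *-comm = *ₚ-comm
    }

infix 9 _[X]
_[X] : CommutativeRing c ℓ → CommutativeRing c ℓ
R [X] = record { isCommutativeRing = Polynomial.isCommutativeRingₚ R }

-- Meant for prime l.
𝔽 : ℕ → CommutativeRing 0ℓ 0ℓ
𝔽 l = ℤ.+-*-commutativeRing /⟨ + l ⟩

infix 4 _≡_[mod_]
_≡_[mod_] : ℤ → ℤ → ℕ → Set
x ≡ y [mod m ] = + m ∣ x ℤ.- y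

φ : ℕ → ℕ
φ n = length (filter (λ k → ℕ.coprime? k n) (map suc (upTo n)))

-- HasOrder m k d says ord_m(k) = d.
record HasOrder (m : ℕ) (k : ℤ) (d : ℕ) : Set where
  field
    positive : 0 ℕ.< d
    power    : k ℤ.^ d ≡ + 1 [mod m ]
    minimal  : ∀ e → 0 ℕ.< e → k ℤ.^ e ≡ + 1 [mod m ] → d ℕ.≤ e

PrimitiveRoot : ℕ → ℤ → Set
PrimitiveRoot m g = HasOrder m g (φ m)

-- For prime p; multiples of p count neither as residues nor as nonresidues.
QuadraticResidue QuadraticNonresidue : ℕ → ℕ → Set
QuadraticResidue    p a = ¬ (p ℕ.∣ a) ×   ∃ λ x → x ℤ.^ 2 ≡ + a [mod p ]
QuadraticNonresidue p a = ¬ (p ℕ.∣ a) × ¬ ∃ λ x → x ℤ.^ 2 ≡ + a [mod p ]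

-- The elements of Fin n stand for the residue classes modulo n.
Coset : (l n : ℕ) → ℤ → Pred (Fin n) 0ℓ
Coset l n γ α = ∃ λ r → + toℕ α ≡ γ ℤ.* (+ l) ℤ.^ r [mod n ]

-- Membership is decidable because some exponent below n already works:
-- by the pigeonhole principle the powers repeat.
module _ (l : ℕ) {n : ℕ} .{{_ : ℕ.NonZero n}} (γ : ℤ) where
  private
    term : ℕ → ℤ
    term r = γ ℤ.* (+ l) ℤ.^ r

    residue : Fin (suc n) → Fin n
    residue r = fromℕ< (ℤ.n%ℕd<d (term (toℕ r)) n)

    repeat : ∃ λ i → ∃ λ j → i ℕ.< j × j ℕ.≤ n × term j ≡ term i [mod n ]
    repeat with Fin.pigeonhole (ℕ.n<1+n n) residue
    ... | i , j , i<j , eq = toℕ i , toℕ j , i<j , ℕ.s≤s⁻¹ (Fin.toℕ<n j) ,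
      divides (a/ ℤ.- b/) (≡.trans
        (≡.cong₂ ℤ._-_ (ℤ.a≡a%ℕn+[a/ℕn]*n a n) (ℤ.a≡a%ℕn+[a/ℕn]*n b n))
        (≡.trans (≡.cong (λ z → + z ℤ.+ a/ ℤ.* + n ℤ.- (+ b% ℤ.+ b/ ℤ.* + n)) (≡.sym b%≡a%))
          (ident (+ b%) a/ b/ (+ n))))
      where
      a b a/ b/ : ℤ
      a  = term (toℕ j)
      b  = term (toℕ i)
      a/ = a ℤ./ℕ n
      b/ = b ℤ./ℕ n
      b% : ℕ
      b% = b ℤ.%ℕ n
      b%≡a% : b% ≡ a ℤ.%ℕ n
      b%≡a% = ≡.trans (≡.sym (Fin.toℕ-fromℕ< _)) (≡.trans (≡.cong toℕ eq) (Fin.toℕ-fromℕ< _))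
      ident : ∀ u v w m → u ℤ.+ v ℤ.* m ℤ.- (u ℤ.+ w ℤ.* m) ≡ (v ℤ.- w) ℤ.* m
      ident = solve-∀

    i₀ j₀ : ℕ
    i₀ = proj₁ repeat
    j₀ = proj₁ (proj₂ repeat)

    i₀<j₀ : i₀ ℕ.< j₀
    i₀<j₀ = proj₁ (proj₂ (proj₂ repeat))

    j₀≤n : j₀ ℕ.≤ n
    j₀≤n = proj₁ (proj₂ (proj₂ (proj₂ repeat)))

    shorten : ∀ x d → x ≡ term (d ℕ.+ j₀) [mod n ] → x ≡ term (d ℕ.+ i₀) [mod n ]
    shorten x d (divides k e) with proj₂ (proj₂ (proj₂ (proj₂ repeat)))
    ... | divides k′ e′ = divides (k ℤ.+ L ℤ.* k′) (begin
        x ℤ.- term (d ℕ.+ i₀)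
          ≡⟨ ≡.cong (λ z → x ℤ.- γ ℤ.* z) (ℤ.^-distribˡ-+-* (+ l) d i₀) ⟩
        x ℤ.- γ ℤ.* (L ℤ.* (+ l) ℤ.^ i₀)
          ≡⟨ ident x γ L ((+ l) ℤ.^ i₀) ((+ l) ℤ.^ j₀) ⟩
        (x ℤ.- γ ℤ.* (L ℤ.* (+ l) ℤ.^ j₀)) ℤ.+ L ℤ.* (term j₀ ℤ.- term i₀)
          ≡⟨ ≡.cong (λ z → (x ℤ.- γ ℤ.* z) ℤ.+ L ℤ.* (term j₀ ℤ.- term i₀))
               (ℤ.^-distribˡ-+-* (+ l) d j₀) ⟨
        (x ℤ.- term (d ℕ.+ j₀)) ℤ.+ L ℤ.* (term j₀ ℤ.- term i₀)
          ≡⟨ ≡.cong₂ (λ y z → y ℤ.+ L ℤ.* z) e e′ ⟩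
        k ℤ.* + n ℤ.+ L ℤ.* (k′ ℤ.* + n)
          ≡⟨ ident′ k L k′ (+ n) ⟩
        (k ℤ.+ L ℤ.* k′) ℤ.* + n ∎)
      where
      open ≡.≡-Reasoning
      L : ℤ
      L = (+ l) ℤ.^ d
      ident : ∀ x γ L u v → x ℤ.- γ ℤ.* (L ℤ.* u) ≡
              (x ℤ.- γ ℤ.* (L ℤ.* v)) ℤ.+ L ℤ.* (γ ℤ.* v ℤ.- γ ℤ.* u)
      ident = solve-∀
      ident′ : ∀ k L k′ m → k ℤ.* m ℤ.+ L ℤ.* (k′ ℤ.* m) ≡ (k ℤ.+ L ℤ.* k′) ℤ.* m
      ident′ = solve-∀

    bounded : ∀ x r → Acc ℕ._<_ r → x ≡ term r [mod n ] →
              ∃ λ (r′ : Fin n) → x ≡ term (toℕ r′) [mod n ]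
    bounded x r (acc rec) x≡ with r ℕ.<? n
    ... | yes r<n = fromℕ< r<n ,
      ≡.subst (λ z → x ≡ term z [mod n ]) (≡.sym (Fin.toℕ-fromℕ< r<n)) x≡
    ... | no  r≮n = bounded x (r ∸ j₀ ℕ.+ i₀)
        (rec (≡.subst (r ∸ j₀ ℕ.+ i₀ ℕ.<_) r≡ (ℕ.+-monoʳ-< (r ∸ j₀) i₀<j₀)))
        (shorten x (r ∸ j₀) (≡.subst (λ z → x ≡ term z [mod n ]) (≡.sym r≡) x≡))
      where
      r≡ : r ∸ j₀ ℕ.+ j₀ ≡ r
      r≡ = ℕ.m∸n+n≡m (ℕ.≤-trans j₀≤n (ℕ.≮⇒≥ r≮n))

  coset?-nonZero : Decidable (Coset l n γ)
  coset?-nonZero α =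
    map′ (λ (r , e) → toℕ r , e)
         (λ (r , e) → bounded (+ toℕ α) r (<-wellFounded r) e)
         (Fin.any? (λ r → + n ∣? (+ toℕ α ℤ.- term (toℕ r))))

coset? : ∀ l n γ → Decidable (Coset l n γ)
coset? l n@(suc _) γ = coset?-nonZero l γ

module Sum (R : CommutativeRing c ℓ) where
  open CommutativeRing R

  sumOver : ∀ {a} {A : Set a} → List A → (A → Carrier) → Carrier
  sumOver xs f = foldr _+_ 0# (map f xs)

  infix 5 sumOver
  syntax sumOver xs (λ x → e) = ∑[ x ∈ xs ] e

⦅_,_⟧ ⦅_,_⟧-odd ⦅_,_⟧-even : ℕ → ℕ → List ℕ
⦅ j , t ⟧      = filter (λ m → j ℕ.<? m) (upTo (suc t))
⦅ j , t ⟧-odd  = filter (λ m → ¬? (2 ℕ.∣? (m ∸ j))) ⦅ j , t ⟧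
⦅ j , t ⟧-even = filter (λ m → 2 ℕ.∣? (m ∸ j)) ⦅ j , t ⟧

module Cyclotomic (p q l s t : ℕ) (g : ℤ) where
  open Polynomial (𝔽 l) using (const; X^_)

  n : ℕ
  n = p ℕ.^ s ℕ.* q ℕ.^ t

  𝔸 : CommutativeRing 0ℓ 0ℓ
  𝔸 = 𝔽 l [X] /⟨ X^ n - 1# ⟩
    where open CommutativeRing (𝔽 l [X]) using (_-_; 1#)

  open CommutativeRing 𝔸 public
    using (Carrier) renaming (_≈_ to _≋_; _+_ to _⊕_; _*_ to _⊗_)
  open Sum 𝔸 public

  infix 8 ⌜_⌝
  ⌜_⌝ : ℕ → Carrier
  ⌜ k ⌝ = const (+ k)

  cosetSum : ℤ → Carrier
  cosetSum γ = ∑[ α ∈ filter (coset? l n γ) (allFin n) ] X^ (toℕ α)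

  χ χ* : ℕ → ℕ → Carrier
  χ  i j = cosetSum (+ (p ℕ.^ i ℕ.* q ℕ.^ j))
  χ* i j = cosetSum (+ (p ℕ.^ i ℕ.* q ℕ.^ j) ℤ.* g)

{-# OPTIONS --safe #-}
-- The coefficient of x^c in χ*_ij χ_i′j is the number of b in C_i′j with c - b in C*_ij.
-- By the Chinese remainder theorem for the exponents (the orders φ(p^s)/2 and φ(q^t) of l are coprime),
-- a class lies in a coset modulo p^s q^t iff it does so modulo p^s and modulo q^t, so this number is the
-- product of a count modulo p^s and one modulo q^t.
-- Modulo p^s, adding the multiple b of p^(i+1) does not affect membership in p^i u ⟨l⟩, so the count is the
-- size of p^i′ ⟨l⟩ or 0; that size is half of φ(p^(s-i′)) because -1 ∉ ⟨l⟩, the order of l being odd.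
-- Modulo q^t, where l is a primitive root, both cosets consist of the elements exactly divisible by q^j, and
-- the count follows by inclusion-exclusion. It depends on whether q^(j+1) divides c, and the indicator of the
-- latter is the sum over j < m ≤ t of those of the cosets of q^m.
-- The class of q^(m-j) modulo ⟨l⟩ decides whether χ_im or χ*_im occurs.
module Submission where

open import Defs
open import Algebra.Bundles using (CommutativeMonoid; CommutativeRing)
import Algebra.Properties.CommutativeMonoid.Sum as CommutativeMonoidSum
import Algebra.Properties.CommutativeSemigroup as CommutativeSemigroupProperties
import Algebra.Properties.Semiring.Mult as SemiringMult
import Algebra.Properties.Semiring.Sum as SemiringSum
open import Data.Fin.Base as Fin using (Fin; zero; suc; toℕ; fromℕ<)
open import Data.Fin.Permutation using (permutation)
import Data.Fin.Properties as Fin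
open import Data.Integer.Base as ℤ using (ℤ; +_; -[1+_])
import Data.Integer.DivMod as ℤ
open import Data.Integer.Divisibility.Signed as ℤ using (divides)
import Data.Integer.Properties as ℤ
open import Data.Integer.Tactic.RingSolver using (solve-∀)
open import Data.List.Base as List using (List; []; _∷_)
import Data.List.Properties as List
open import Data.List.Relation.Unary.All as All using (All; []; _∷_)
import Data.List.Relation.Unary.All.Properties as All
open import Data.Nat.Base as ℕ using (ℕ; zero; suc; _+_; _*_; _∸_; _^_; _/_; _%_; _≤_; _<_; z≤n; s≤s; NonZero)
import Data.Nat.Coprimality as ℕ
open import Data.Nat.Divisibility using (_∣_)
import Data.Nat.Divisibility as ℕ
import Data.Nat.DivMod as ℕ
import Data.Nat.Tactic.RingSolver as ℕSolver
open import Data.Nat.GCD using (gcd; gcd-greatest; module Bézout)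
import Data.Nat.ListAction as ListAction
import Data.Nat.ListAction.Properties as ListAction
open import Data.Nat.Primality using (Prime)
import Data.Nat.Primality as ℕ
import Data.Nat.Properties as ℕ
open import Data.Product.Base using (_×_; _,_; proj₁; proj₂; ∃)
open import Data.Sum.Base as Sum using (_⊎_; inj₁; inj₂)
open import Function.Base using (_∘_; id)
open import Level using (Level)
open import Relation.Binary.Bundles using (Setoid)
open import Relation.Binary.PropositionalEquality as ≡ using (_≡_; _≢_; refl)
open import Relation.Binary.Definitions using (tri<; tri≈; tri>)
import Relation.Binary.Reasoning.Setoid as SetoidReasoning
open import Relation.Nullary using (¬_; Dec; yes; no; contradiction)
open import Relation.Nullary.Decidable using (map′; ¬?; _×-dec_; _⊎-dec_)
open import Relation.Unary using (Pred; Decidable)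


-- All counting takes place in ℕ, with functions on ℤ that are periodic in the modulus. The counts
-- enter the field only at the end, so halving φ(p^(s-i′)) never asks for 2 to be invertible modulo
-- l (l = 2 is allowed). Modulo p^s the sign replaces the quadratic character. As p ≡ 3 mod 4,
-- φ(p^s)/2 is odd, so -l has order φ(p^s) and is a primitive root: every unit lies in exactly one
-- of ⟨l⟩ and -⟨l⟩. Residues lie in ⟨l⟩, while nonresidues and g lie in -⟨l⟩. This dictates the
-- right-hand side: a coset of p^i q^m w with the same component modulo p^s as p^i q^j g needs
-- q^(m-j) w in -⟨l⟩. Hence w = g if q^(m-j) is a residue and w = 1 otherwise, which is the
-- alternation in part (ii). Modulo q^t the choice of w is invisible. The dichotomy holds modulo p
-- as well as modulo p^s, so the class of a unit is already decided modulo p. For this reason p^i u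
-- ⟨l⟩ absorbs the multiples of p^(i+1).

private
  variable
    a b c ℓ : Level
    P Q R : Set a
    m N : ℕ
    x y z u v : ℤ

i-j+j≡i : ∀ i j → i ℤ.- j ℤ.+ j ≡ i
i-j+j≡i = solve-∀

-- Congruences

-- A record, so that both sides can be inferred from a proof.
infix 4 _≅_mod_
record _≅_mod_ (x y : ℤ) (m : ℕ) : Set where
  constructor congruent
  field congruence : x ≡ y [mod m ]
open _≅_mod_

≅-byMultiple : ∀ k → x ≡ y ℤ.+ k ℤ.* + m → x ≅ y mod m
≅-byMultiple {y = y} {m = m} k refl = congruent (divides k (identity y (k ℤ.* + m)))
  where
  identity : ∀ y z → y ℤ.+ z ℤ.- y ≡ z
  identity = solve-∀

≅-multiple : x ≅ y mod m → ∃ λ k → x ≡ y ℤ.+ k ℤ.* + m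
≅-multiple {x} {y} (congruent (divides k eq)) =
  k , ≡.trans (identity x y) (≡.cong (λ z → y ℤ.+ z) eq)
  where
  identity : ∀ x y → x ≡ y ℤ.+ (x ℤ.- y)
  identity = solve-∀

≅-reflexive : x ≡ y → x ≅ y mod m
≅-reflexive {x} refl = ≅-byMultiple (+ 0) (≡.sym (ℤ.+-identityʳ x))

≅-refl : x ≅ x mod m
≅-refl = ≅-reflexive refl

≅-sym : x ≅ y mod m → y ≅ x mod m
≅-sym {m = m} e with ≅-multiple e
... | k , refl = ≅-byMultiple (ℤ.- k) (identity _ k (+ m))
  where
  identity : ∀ y k m → y ≡ y ℤ.+ k ℤ.* m ℤ.+ ℤ.- k ℤ.* m
  identity = solve-∀

≅-trans : x ≅ y mod m → y ≅ z mod m → x ≅ z mod m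
≅-trans {m = m} {z = z} e e′ with ≅-multiple e | ≅-multiple e′
... | k , refl | k′ , refl = ≅-byMultiple (k ℤ.+ k′) (identity z k k′ (+ m))
  where
  identity : ∀ z k k′ m → z ℤ.+ k′ ℤ.* m ℤ.+ k ℤ.* m ≡ z ℤ.+ (k ℤ.+ k′) ℤ.* m
  identity = solve-∀

+-≅ : x ≅ y mod m → u ≅ v mod m → x ℤ.+ u ≅ y ℤ.+ v mod m
+-≅ {y = y} {m = m} {v = v} e e′ with ≅-multiple e | ≅-multiple e′
... | k , refl | k′ , refl = ≅-byMultiple (k ℤ.+ k′) (identity y v k k′ (+ m))
  where
  identity : ∀ y v k k′ m → y ℤ.+ k ℤ.* m ℤ.+ (v ℤ.+ k′ ℤ.* m) ≡ y ℤ.+ v ℤ.+ (k ℤ.+ k′) ℤ.* m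
  identity = solve-∀

*-≅ : x ≅ y mod m → u ≅ v mod m → x ℤ.* u ≅ y ℤ.* v mod m
*-≅ {y = y} {m = m} {v = v} e e′ with ≅-multiple e | ≅-multiple e′
... | k , refl | k′ , refl =
  ≅-byMultiple (k ℤ.* v ℤ.+ y ℤ.* k′ ℤ.+ k ℤ.* k′ ℤ.* + m) (identity y v k k′ (+ m))
  where
  identity : ∀ y v k k′ m → (y ℤ.+ k ℤ.* m) ℤ.* (v ℤ.+ k′ ℤ.* m) ≡
             y ℤ.* v ℤ.+ (k ℤ.* v ℤ.+ y ℤ.* k′ ℤ.+ k ℤ.* k′ ℤ.* m) ℤ.* m
  identity = solve-∀

neg-≅ : x ≅ y mod m → ℤ.- x ≅ ℤ.- y mod m
neg-≅ {y = y} {m = m} e with ≅-multiple e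
... | k , refl = ≅-byMultiple (ℤ.- k) (identity y k (+ m))
  where
  identity : ∀ y k m → ℤ.- (y ℤ.+ k ℤ.* m) ≡ ℤ.- y ℤ.+ ℤ.- k ℤ.* m
  identity = solve-∀

+-≅ˡ : ∀ u → x ≅ y mod m → u ℤ.+ x ≅ u ℤ.+ y mod m
+-≅ˡ u = +-≅ (≅-refl {u})

*-≅ˡ : ∀ u → x ≅ y mod m → u ℤ.* x ≅ u ℤ.* y mod m
*-≅ˡ u = *-≅ (≅-refl {u})

*-≅ʳ : ∀ u → x ≅ y mod m → x ℤ.* u ≅ y ℤ.* u mod m
*-≅ʳ u e = *-≅ e (≅-refl {u})

^-≅ : ∀ k → x ≅ y mod m → x ℤ.^ k ≅ y ℤ.^ k mod m
^-≅ zero    e = ≅-refl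
^-≅ (suc k) e = *-≅ e (^-≅ k e)

≅-setoid : ℕ → Setoid _ _
≅-setoid m = record
  { Carrier = ℤ
  ; _≈_ = λ x y → x ≅ y mod m
  ; isEquivalence = record { refl = ≅-refl ; sym = ≅-sym ; trans = ≅-trans }
  }

module ≅-Reasoning (m : ℕ) = SetoidReasoning (≅-setoid m)

≅-∣ : m ∣ N → x ≅ y mod N → x ≅ y mod m
≅-∣ {m} {y = y} (ℕ.divides c refl) e with ≅-multiple e
... | k , refl = ≅-byMultiple (k ℤ.* + c)
  (≡.cong (λ z → y ℤ.+ z) (≡.trans (≡.cong (k ℤ.*_) (ℤ.pos-* c m)) (≡.sym (ℤ.*-assoc k (+ c) (+ m)))))

∣-resp-≅ : x ≅ y mod m → + m ℤ.∣ x → + m ℤ.∣ y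
∣-resp-≅ {x} {y} e m∣x with ≅-sym e
... | congruent m∣y-x = ≡.subst (_ ℤ.∣_) (i-j+j≡i y x) (ℤ.∣m∣n⇒∣m+n m∣y-x m∣x)

∣⇒≅0 : + m ℤ.∣ x → x ≅ + 0 mod m
∣⇒≅0 (divides k refl) = ≅-byMultiple k (≡.sym (ℤ.+-identityˡ _))

≅-*-cancelˡ : ∀ c .{{_ : NonZero c}} → + c ℤ.* x ≅ + c ℤ.* y mod c * m → x ≅ y mod m
≅-*-cancelˡ {x} {y} {m} c@(suc _) (congruent d) =
  congruent (ℤ.*-cancelˡ-∣ (+ c)
    (≡.subst₂ ℤ._∣_ (ℤ.pos-* c m) (identity (+ c) x y) d))
  where
  identity : ∀ c x y → c ℤ.* x ℤ.- c ℤ.* y ≡ c ℤ.* (x ℤ.- y)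
  identity = solve-∀

-- Residues

residue : ∀ N .{{_ : NonZero N}} → ℤ → Fin N
residue N x = fromℕ< (ℤ.n%ℕd<d x N)

residue-≅ : ∀ N .{{_ : NonZero N}} x → + toℕ (residue N x) ≅ x mod N
residue-≅ N x = ≅-sym (≅-byMultiple (x ℤ./ℕ N)
  (≡.trans (ℤ.a≡a%ℕn+[a/ℕn]*n x N)
    (≡.cong (λ r → + r ℤ.+ (x ℤ./ℕ N) ℤ.* + N) (≡.sym (Fin.toℕ-fromℕ< _)))))

<⇒≇ : ∀ {i j} → i < j → j < N → ¬ (+ j ≅ + i mod N)
<⇒≇ {N} {i} {j} i<j j<N (congruent N∣j-i) =
  ℕ.>⇒∤ {{ℕ.>-nonZero (ℕ.m<n⇒0<n∸m i<j)}} (ℕ.≤-<-trans (ℕ.m∸n≤m j i) j<N)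
    (ℤ.∣⇒∣ᵤ (≡.subst (+ N ℤ.∣_) (≡.trans (ℤ.m-n≡m⊖n j i) (ℤ.⊖-≥ (ℕ.<⇒≤ i<j))) N∣j-i))

toℕ-≅-injective : {i j : Fin N} → + toℕ i ≅ + toℕ j mod N → i ≡ j
toℕ-≅-injective {i = i} {j = j} e with ℕ.<-cmp (toℕ i) (toℕ j)
... | tri< i<j _ _ = contradiction (≅-sym e) (<⇒≇ i<j (Fin.toℕ<n j))
... | tri≈ _ i≡j _ = Fin.toℕ-injective i≡j
... | tri> _ _ j<i = contradiction e (<⇒≇ j<i (Fin.toℕ<n i))

-- Indicators

⟦_⟧ : ∀ {a} {P : Set a} → Dec P → ℕ
⟦ yes _ ⟧ = 1
⟦ no  _ ⟧ = 0

⟦⟧-yes : (d : Dec P) → P → ⟦ d ⟧ ≡ 1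
⟦⟧-yes (yes _) _ = refl
⟦⟧-yes (no ¬p) p = contradiction p ¬p

⟦⟧-no : (d : Dec P) → ¬ P → ⟦ d ⟧ ≡ 0
⟦⟧-no (yes p) ¬p = contradiction p ¬p
⟦⟧-no (no _)  _  = refl

⟦⟧-¬ : (d : Dec P) → ⟦ ¬? d ⟧ + ⟦ d ⟧ ≡ 1
⟦⟧-¬ (yes _) = refl
⟦⟧-¬ (no _)  = refl

⟦⟧-cong : (d : Dec P) (e : Dec Q) → (P → Q) → (Q → P) → ⟦ d ⟧ ≡ ⟦ e ⟧
⟦⟧-cong (yes p) e P→Q Q→P = ≡.sym (⟦⟧-yes e (P→Q p))
⟦⟧-cong (no ¬p) e P→Q Q→P = ≡.sym (⟦⟧-no e (¬p ∘ Q→P))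

⟦⟧-× : (d : Dec P) (e : Dec Q) → ⟦ d ×-dec e ⟧ ≡ ⟦ d ⟧ * ⟦ e ⟧
⟦⟧-× (yes _) (yes _) = refl
⟦⟧-× (yes _) (no _)  = refl
⟦⟧-× (no _)  _       = refl

⟦⟧-⊎ : (r : Dec R) (d : Dec P) (e : Dec Q) →
       (R → P ⊎ Q) → (P → R) → (Q → R) → (P → ¬ Q) → ⟦ r ⟧ ≡ ⟦ d ⟧ + ⟦ e ⟧
⟦⟧-⊎ r (yes p) e       _   P→R _   P→¬Q rewrite ⟦⟧-no e (P→¬Q p) = ⟦⟧-yes r (P→R p)
⟦⟧-⊎ r (no ¬p) (yes q) _   _   Q→R _    = ⟦⟧-yes r (Q→R q)
⟦⟧-⊎ r (no ¬p) (no ¬q) R→⊎ _   _   _    = ⟦⟧-no r λ x → Sum.[ ¬p , ¬q ] (R→⊎ x)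

-- Sums of periodic functions over a complete residue system

module PeriodicSum (M : CommutativeMonoid c ℓ) where
  open CommutativeMonoid M using (Carrier; _≈_; setoid) renaming (_∙_ to _⊹_; refl to ≈-refl; sym to ≈-sym)
  open CommutativeMonoidSum M public
    using (sum; sum-cong-≋; sum-permute; ∑-comm; ∑-distrib-+; sum-replicate-zero)
  open SetoidReasoning setoid
  private module M = CommutativeMonoid M

  Periodic : ℕ → (ℤ → Carrier) → Set ℓ
  Periodic N f = ∀ {x y} → x ≅ y mod N → f x ≈ f y

  sumᵣ : ℕ → (ℤ → Carrier) → Carrier
  sumᵣ N f = sum {N} (λ k → f (+ toℕ k))

  sumᵣ-cong : ∀ N {f h : ℤ → Carrier} → (∀ x → f x ≈ h x) → sumᵣ N f ≈ sumᵣ N h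
  sumᵣ-cong N f≈h = sum-cong-≋ {N} λ k → f≈h (+ toℕ k)

  -- `σ` and `τ` are inverse only modulo `N`, so both are pushed through `residue` to give a
  -- permutation of `Fin N`; periodicity of `f` then removes the residues again.
  sumᵣ-reindex : ∀ N .{{_ : NonZero N}} {f : ℤ → Carrier} (σ τ : ℤ → ℤ) → Periodic N f →
                 (∀ {x y} → x ≅ y mod N → σ x ≅ σ y mod N) →
                 (∀ {x y} → x ≅ y mod N → τ x ≅ τ y mod N) →
                 (∀ x → σ (τ x) ≅ x mod N) → (∀ x → τ (σ x) ≅ x mod N) →
                 sumᵣ N f ≈ sumᵣ N (f ∘ σ)
  sumᵣ-reindex N {f} σ τ f-periodic σ-cong τ-cong στ τσ = begin
    sumᵣ N f
      ≈⟨ sum-permute (λ k → f (+ toℕ k)) (permutation (lift σ) (lift τ) (inverse σ-cong στ) (inverse τ-cong τσ)) ⟩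
    sum {N} (λ k → f (+ toℕ (lift σ k)))
      ≈⟨ sum-cong-≋ {N} (λ k → f-periodic (residue-≅ N (σ (+ toℕ k)))) ⟩
    sumᵣ N (f ∘ σ)
      ∎
    where
    lift : (ℤ → ℤ) → Fin N → Fin N
    lift ρ k = residue N (ρ (+ toℕ k))
    inverse : ∀ {ρ ρ′} → (∀ {x y} → x ≅ y mod N → ρ x ≅ ρ y mod N) →
              (∀ x → ρ (ρ′ x) ≅ x mod N) → ∀ k → lift ρ (lift ρ′ k) ≡ k
    inverse {ρ} {ρ′} ρ-cong ρρ′ k = toℕ-≅-injective
      (≅-trans (residue-≅ N _) (≅-trans (ρ-cong (residue-≅ N _)) (ρρ′ (+ toℕ k))))

  sumᵣ-shift : ∀ N .{{_ : NonZero N}} {f : ℤ → Carrier} d → Periodic N f →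
               sumᵣ N f ≈ sumᵣ N (λ x → f (x ℤ.- d))
  sumᵣ-shift N d f-periodic = sumᵣ-reindex N (λ x → x ℤ.- d) (λ x → x ℤ.+ d) f-periodic
    (λ e → +-≅ e ≅-refl) (λ e → +-≅ e ≅-refl)
    (λ x → ≅-reflexive (cancel x d)) (λ x → ≅-reflexive (i-j+j≡i x d))
    where
    cancel : ∀ x d → x ℤ.+ d ℤ.- d ≡ x
    cancel = solve-∀

  sumᵣ-reflect : ∀ N .{{_ : NonZero N}} {f : ℤ → Carrier} d → Periodic N f →
                 sumᵣ N f ≈ sumᵣ N (λ x → f (d ℤ.- x))
  sumᵣ-reflect N d f-periodic = sumᵣ-reindex N (λ x → d ℤ.- x) (λ x → d ℤ.- x) f-periodic
    (λ e → +-≅ˡ d (neg-≅ e)) (λ e → +-≅ˡ d (neg-≅ e))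
    (λ x → ≅-reflexive (cancel x d)) (λ x → ≅-reflexive (cancel x d))
    where
    cancel : ∀ x d → d ℤ.- (d ℤ.- x) ≡ x
    cancel = solve-∀

  sum-↑ : ∀ i j (f : Fin (i + j) → Carrier) →
          sum f ≈ sum {i} (λ k → f (k Fin.↑ˡ j)) ⊹ sum {j} (λ k → f (i Fin.↑ʳ k))
  sum-↑ zero    j f = ≈-sym (M.identityˡ _)
  sum-↑ (suc i) j f = begin
    f zero ⊹ sum {i + j} (λ k → f (suc k))   ≈⟨ M.∙-congˡ (sum-↑ i j (f ∘ suc)) ⟩
    f zero ⊹ (_ ⊹ _)                         ≈⟨ M.assoc _ _ _ ⟨
    (f zero ⊹ _) ⊹ _                         ∎

  sum-combine : ∀ i j (f : Fin (i * j) → Carrier) →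
                sum f ≈ sum {i} (λ k → sum {j} (λ k′ → f (Fin.combine k k′)))
  sum-combine zero    j f = ≈-refl
  sum-combine (suc i) j f = M.trans (sum-↑ j (i * j) f) (M.∙-congˡ (sum-combine i j (λ k → f (j Fin.↑ʳ k))))

  sumᵣ-* : ∀ i j (f : ℤ → Carrier) →
           sumᵣ (i * j) f ≈ sumᵣ i (λ x → sumᵣ j (λ y → f (y ℤ.+ + j ℤ.* x)))
  sumᵣ-* i j f = M.trans (sum-combine i j _)
    (sum-cong-≋ {i} λ x → sum-cong-≋ {j} λ y → M.reflexive (≡.cong f (toℕ-combine′ x y)))
    where
    toℕ-combine′ : ∀ (x : Fin i) (y : Fin j) → + toℕ (Fin.combine x y) ≡ + toℕ y ℤ.+ + j ℤ.* + toℕ x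
    toℕ-combine′ x y = ≡.trans (≡.cong +_ (≡.trans (Fin.toℕ-combine x y) (ℕ.+-comm (j * toℕ x) (toℕ y))))
      (≡.cong (λ z → + toℕ y ℤ.+ z) (ℤ.pos-* j (toℕ x)))

open PeriodicSum ℕ.+-0-commutativeMonoid
module ℕΣ = SemiringSum ℕ.+-*-semiring

-- Counting residues

sum-const : ∀ n c → sum {n} (λ _ → c) ≡ n * c
sum-const zero    c = refl
sum-const (suc n) c = ≡.cong (_+_ c) (sum-const n c)

sum-zero : ∀ {n} {f : Fin n → ℕ} → (∀ i → f i ≡ 0) → sum f ≡ 0
sum-zero {n} f≡0 = ≡.trans (sum-cong-≋ {n} f≡0) (sum-replicate-zero n)

sum-mono-≤ : ∀ {n} {f h : Fin n → ℕ} → (∀ i → f i ≤ h i) → sum f ≤ sum h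
sum-mono-≤ {zero}  f≤h = z≤n
sum-mono-≤ {suc n} f≤h = ℕ.+-mono-≤ (f≤h zero) (sum-mono-≤ (f≤h ∘ suc))

-- The pigeonhole step of `primitiveRoot-generates`: the number of exponents hitting a residue is at
-- most its unit indicator, and equal totals force every unit to be hit.
sum-≤-≡ : ∀ {n} {f h : Fin n → ℕ} → (∀ i → f i ≤ h i) → sum f ≡ sum h → ∀ i → f i ≡ h i
sum-≤-≡ {suc n} {f} {h} f≤h eq = λ where
    zero    → f₀≡h₀
    (suc i) → sum-≤-≡ (f≤h ∘ suc) tails i
  where
  f₀≡h₀ : f zero ≡ h zero
  f₀≡h₀ = ℕ.≤-antisym (f≤h zero) (ℕ.+-cancelʳ-≤ (sum (f ∘ suc)) (h zero) (f zero)
    (ℕ.≤-trans (ℕ.+-monoʳ-≤ (h zero) (sum-mono-≤ (f≤h ∘ suc))) (ℕ.≤-reflexive (≡.sym eq))))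
  tails : sum (f ∘ suc) ≡ sum (h ∘ suc)
  tails = ℕ.+-cancelˡ-≡ (f zero) _ _ (≡.trans eq (≡.cong (_+ sum (h ∘ suc)) (≡.sym f₀≡h₀)))

sum-⟦⟧≤1 : ∀ {n} {P : Fin n → Set a} (P? : ∀ i → Dec (P i)) →
           (∀ {i j} → P i → P j → i ≡ j) → sum (λ i → ⟦ P? i ⟧) ≤ 1
sum-⟦⟧≤1 {n = zero}  P? unique = z≤n
sum-⟦⟧≤1 {n = suc n} P? unique with P? zero
... | yes p₀ = ℕ.≤-reflexive (≡.cong suc (sum-zero λ i → ⟦⟧-no (P? (suc i)) λ p → Fin.0≢1+n (unique p₀ p)))
... | no  _  = sum-⟦⟧≤1 (P? ∘ suc) λ p p′ → Fin.suc-injective (unique p p′)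

length-filter-applyUpTo : ∀ {P : Pred ℕ a} (P? : Decidable P) (f : ℕ → ℕ) n →
  List.length (List.filter P? (List.applyUpTo f n)) ≡ sum {n} (λ k → ⟦ P? (f (toℕ k)) ⟧)
length-filter-applyUpTo P? f zero = refl
length-filter-applyUpTo P? f (suc n) with P? (f 0)
... | yes _ = ≡.cong suc (length-filter-applyUpTo P? (f ∘ suc) n)
... | no  _ = length-filter-applyUpTo P? (f ∘ suc) n

infix 4 _≅?_mod_
_≅?_mod_ : ∀ x y m → Dec (x ≅ y mod m)
x ≅? y mod m = map′ congruent congruence (+ m ℤ.∣? x ℤ.- y)

∣?-periodic : ∀ m → m ∣ N → Periodic N (λ x → ⟦ + m ℤ.∣? x ⟧)
∣?-periodic m m∣N {x} {y} e = ⟦⟧-cong (+ m ℤ.∣? x) (+ m ℤ.∣? y)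
  (∣-resp-≅ (≅-∣ m∣N e)) (∣-resp-≅ (≅-∣ m∣N (≅-sym e)))

sumᵣ-∣-self : ∀ m .{{_ : NonZero m}} → sumᵣ m (λ x → ⟦ + m ℤ.∣? x ⟧) ≡ 1
sumᵣ-∣-self m@(suc m-1) = ≡.cong₂ _+_ (⟦⟧-yes (+ m ℤ.∣? + 0) (divides (+ 0) refl))
  (sum-zero {m-1} λ i → ⟦⟧-no (+ m ℤ.∣? + suc (toℕ i)) λ m∣1+i →
    ℕ.>⇒∤ (s≤s (Fin.toℕ<n i)) (ℤ.∣⇒∣ᵤ m∣1+i))

sumᵣ-∣ : ∀ k m .{{_ : NonZero m}} → sumᵣ (k * m) (λ x → ⟦ + m ℤ.∣? x ⟧) ≡ k
sumᵣ-∣ k m = begin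
  sumᵣ (k * m) (λ x → ⟦ + m ℤ.∣? x ⟧)
    ≡⟨ sumᵣ-* k m (λ x → ⟦ + m ℤ.∣? x ⟧) ⟩
  sumᵣ k (λ x → sumᵣ m (λ y → ⟦ + m ℤ.∣? (y ℤ.+ + m ℤ.* x) ⟧))
    ≡⟨ sumᵣ-cong k (λ x → ≡.trans
         (sumᵣ-cong m λ y → ∣?-periodic m ℕ.∣-refl (≅-byMultiple {y = y} x (≡.cong (λ z → y ℤ.+ z) (ℤ.*-comm (+ m) x))))
         (sumᵣ-∣-self m)) ⟩
  sumᵣ k (λ _ → 1)
    ≡⟨ ≡.trans (sum-const k 1) (ℕ.*-identityʳ k) ⟩
  k ∎
  where open ≡.≡-Reasoning

sumᵣ-≅ : ∀ m .{{_ : NonZero m}} c → sumᵣ m (λ x → ⟦ x ≅? c mod m ⟧) ≡ 1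
sumᵣ-≅ m c = begin
  sumᵣ m (λ x → ⟦ x ≅? c mod m ⟧)
    ≡⟨ sumᵣ-cong m (λ x → ⟦⟧-cong (x ≅? c mod m) (+ m ℤ.∣? x ℤ.- c) congruence congruent) ⟩
  sumᵣ m (λ x → ⟦ + m ℤ.∣? x ℤ.- c ⟧)
    ≡⟨ sumᵣ-shift m c (∣?-periodic m ℕ.∣-refl) ⟨
  sumᵣ m (λ x → ⟦ + m ℤ.∣? x ⟧)
    ≡⟨ sumᵣ-∣-self m ⟩
  1 ∎
  where open ≡.≡-Reasoning

-- Meant for a deeper coset `B`: where the first factor is nonzero, moving `c` by `b` does not
-- change membership in `A`, so the second factor is constant and can be pulled out.
sumᵣ-absorb : ∀ N {A B : ℤ → Set} (A? : ∀ x → Dec (A x)) (B? : ∀ x → Dec (B x)) c →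
              (∀ {b} → B b → A (c ℤ.- b) → A c) → (∀ {b} → B b → A c → A (c ℤ.- b)) →
              ∀ {S} → sumᵣ N (λ b → ⟦ B? b ⟧) ≡ S →
              sumᵣ N (λ b → ⟦ B? b ⟧ * ⟦ A? (c ℤ.- b) ⟧) ≡ S * ⟦ A? c ⟧
sumᵣ-absorb N {A} {B} A? B? c absorb absorb⁻¹ refl = ≡.trans
  (sumᵣ-cong N (λ b → pointwise b (B? b)))
  (≡.sym (ℕΣ.*-distribʳ-sum {N} ⟦ A? c ⟧ (λ b → ⟦ B? (+ toℕ b) ⟧)))
  where
  pointwise : ∀ b (d : Dec (B b)) → ⟦ d ⟧ * ⟦ A? (c ℤ.- b) ⟧ ≡ ⟦ d ⟧ * ⟦ A? c ⟧
  pointwise b (no _)   = refl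
  pointwise b (yes b∈) = ≡.cong (_+ 0) (⟦⟧-cong (A? (c ℤ.- b)) (A? c) (absorb b∈) (absorb⁻¹ b∈))

-- Reflection permutes the residues, so both summands of `h` have the same total. It yields the size
-- of a coset from that of its union with its negative.
sumᵣ-symmetrize : ∀ N .{{_ : NonZero N}} {f h : ℤ → ℕ} → Periodic N f → (∀ x → h x ≡ f x + f (ℤ.- x)) →
                  sumᵣ N h ≡ sumᵣ N f * 2
sumᵣ-symmetrize N {f} {h} f-periodic h≡ = begin
  sumᵣ N h                                        ≡⟨ sumᵣ-cong N h≡ ⟩
  sumᵣ N (λ x → f x + f (ℤ.- x))                  ≡⟨ ∑-distrib-+ {N} (λ x → f (+ toℕ x)) (λ x → f (ℤ.- + toℕ x)) ⟩
  sumᵣ N f + sumᵣ N (λ x → f (ℤ.- x))             ≡⟨ ≡.cong (_+_ (sumᵣ N f)) reflected ⟨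
  sumᵣ N f + sumᵣ N f                             ≡⟨ ≡.cong (_+_ (sumᵣ N f)) (ℕ.+-identityʳ (sumᵣ N f)) ⟨
  2 * sumᵣ N f                                    ≡⟨ ℕ.*-comm 2 (sumᵣ N f) ⟩
  sumᵣ N f * 2                                    ∎
  where
  open ≡.≡-Reasoning
  reflected : sumᵣ N f ≡ sumᵣ N (λ x → f (ℤ.- x))
  reflected = ≡.trans (sumᵣ-reflect N (+ 0) f-periodic) (sumᵣ-cong N λ x → ≡.cong f (ℤ.+-identityˡ (ℤ.- x)))

inverse-mod : ℕ.Coprime m N → ∃ λ d → + m ℤ.* d ≅ + 1 mod N
inverse-mod {m} {N} m⊥N with ℕ.coprime-Bézout m⊥N
... | Bézout.+- x y eq = + x , ≅-byMultiple (+ y)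
  (≡.trans (≡.sym (ℤ.pos-* m x)) (≡.trans (≡.cong +_ (≡.trans (ℕ.*-comm m x) (≡.sym eq)))
    (≡.cong (λ z → + 1 ℤ.+ z) (ℤ.pos-* y N))))
... | Bézout.-+ x y eq = ℤ.- + x , ≅-byMultiple (ℤ.- + y)
  (≡.trans (identity (+ m) (+ x)) (≡.trans (≡.cong (λ z → + 1 ℤ.- z) lifted) (identity′ (+ y) (+ N))))
  where
  lifted : + 1 ℤ.+ + x ℤ.* + m ≡ + y ℤ.* + N
  lifted = ≡.trans (≡.cong (λ z → + 1 ℤ.+ z) (≡.sym (ℤ.pos-* x m))) (≡.trans (≡.cong +_ eq) (ℤ.pos-* y N))
  identity : ∀ m x → m ℤ.* ℤ.- x ≡ + 1 ℤ.- (+ 1 ℤ.+ x ℤ.* m)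
  identity = solve-∀
  identity′ : ∀ y N → + 1 ℤ.- y ℤ.* N ≡ + 1 ℤ.+ ℤ.- y ℤ.* N
  identity′ = solve-∀

-- A residue modulo j i is x + i y with x modulo i and y modulo j. The factor `f` sees only x; as i
-- is invertible modulo j, y ↦ x + i y permutes the residues modulo j for each fixed x, so the inner
-- sum does not depend on x.
sumᵣ-coprime : ∀ i j .{{_ : NonZero j}} {f h : ℤ → ℕ} → ℕ.Coprime i j → Periodic i f → Periodic j h →
               sumᵣ (j * i) (λ x → f x * h x) ≡ sumᵣ i f * sumᵣ j h
sumᵣ-coprime i j {f} {h} i⊥j f-periodic h-periodic = begin
  sumᵣ (j * i) (λ x → f x * h x)
    ≡⟨ sumᵣ-* j i (λ x → f x * h x) ⟩
  sumᵣ j (λ y → sumᵣ i (λ x → f (x ℤ.+ + i ℤ.* y) * h (x ℤ.+ + i ℤ.* y)))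
    ≡⟨ ∑-comm {j} {i} _ ⟩
  sumᵣ i (λ x → sumᵣ j (λ y → f (x ℤ.+ + i ℤ.* y) * h (x ℤ.+ + i ℤ.* y)))
    ≡⟨ sumᵣ-cong i (λ x → ≡.trans
         (sumᵣ-cong j λ y → ≡.cong (_* h (x ℤ.+ + i ℤ.* y))
           (f-periodic (≅-byMultiple {y = x} y (≡.cong (λ z → x ℤ.+ z) (ℤ.*-comm (+ i) y)))))
         (≡.sym (ℕΣ.*-distribˡ-sum {j} (f x) _))) ⟩
  sumᵣ i (λ x → f x * sumᵣ j (λ y → h (x ℤ.+ + i ℤ.* y)))
    ≡⟨ sumᵣ-cong i (λ x → ≡.cong (f x *_) (≡.sym (affine x))) ⟩
  sumᵣ i (λ x → f x * sumᵣ j h)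
    ≡⟨ ℕΣ.*-distribʳ-sum {i} (sumᵣ j h) _ ⟨
  sumᵣ i f * sumᵣ j h ∎
  where
  open ≡.≡-Reasoning
  i⁻¹ : ℤ
  i⁻¹ = proj₁ (inverse-mod i⊥j)
  ii⁻¹≅1 : + i ℤ.* i⁻¹ ≅ + 1 mod j
  ii⁻¹≅1 = proj₂ (inverse-mod i⊥j)
  affine : ∀ x → sumᵣ j h ≡ sumᵣ j (λ y → h (x ℤ.+ + i ℤ.* y))
  affine x = sumᵣ-reindex j (λ y → x ℤ.+ + i ℤ.* y) (λ z → i⁻¹ ℤ.* (z ℤ.- x)) h-periodic
    (λ e → +-≅ˡ x (*-≅ˡ (+ i) e)) (λ e → *-≅ˡ i⁻¹ (+-≅ e ≅-refl))
    (λ z → ≅-trans (≅-reflexive (identity x (+ i) i⁻¹ z)) (≅-trans (+-≅ˡ x (*-≅ʳ (z ℤ.- x) ii⁻¹≅1)) (≅-reflexive (identity′ x z))))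
    (λ y → ≅-trans (≅-reflexive (identity″ x (+ i) i⁻¹ y)) (≅-trans (*-≅ʳ y ii⁻¹≅1) (≅-reflexive (ℤ.*-identityˡ y))))
    where
    identity : ∀ x i i′ z → x ℤ.+ i ℤ.* (i′ ℤ.* (z ℤ.- x)) ≡ x ℤ.+ i ℤ.* i′ ℤ.* (z ℤ.- x)
    identity = solve-∀
    identity′ : ∀ x z → x ℤ.+ + 1 ℤ.* (z ℤ.- x) ≡ z
    identity′ = solve-∀
    identity″ : ∀ x i i′ y → i′ ℤ.* (x ℤ.+ i ℤ.* y ℤ.- x) ≡ i ℤ.* i′ ℤ.* y
    identity″ = solve-∀

-- Primes, Euler's function and primitive roots

∣-cast : ∀ {i j} → i ∣ j → + i ℤ.∣ + j
∣-cast = ℤ.∣ᵤ⇒∣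

^-order : ∀ {h d} → HasOrder m h d → h ℤ.^ d ≅ + 1 mod m
^-order ord = congruent (HasOrder.power ord)

module _ {p} (prime : Prime p) where
  private instance
    p≢0 : NonZero p
    p≢0 = ℕ.prime⇒nonZero prime

  1<p : 1 < p
  1<p = ℕ.nonTrivial⇒n>1 p {{ℕ.prime⇒nonTrivial prime}}

  p∤1 : ¬ (+ p ℤ.∣ + 1)
  p∤1 p∣1 = ℕ.>⇒∤ 1<p (ℤ.∣⇒∣ᵤ p∣1)

  ∣*⇒∣⊎∣ : ∀ x y → + p ℤ.∣ x ℤ.* y → (+ p ℤ.∣ x) ⊎ (+ p ℤ.∣ y)
  ∣*⇒∣⊎∣ x y p∣xy = Sum.map ℤ.∣ᵤ⇒∣ ℤ.∣ᵤ⇒∣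
    (ℕ.euclidsLemma ℤ.∣ x ∣ ℤ.∣ y ∣ prime (≡.subst (p ∣_) (ℤ.abs-* x y) (ℤ.∣⇒∣ᵤ p∣xy)))

  ∤-* : ¬ (+ p ℤ.∣ x) → ¬ (+ p ℤ.∣ y) → ¬ (+ p ℤ.∣ x ℤ.* y)
  ∤-* p∤x p∤y p∣xy = Sum.[ p∤x , p∤y ] (∣*⇒∣⊎∣ _ _ p∣xy)

  ∤-^ : ∀ k → ¬ (+ p ℤ.∣ x) → ¬ (+ p ℤ.∣ x ℤ.^ k)
  ∤-^ zero    p∤x = p∤1
  ∤-^ (suc k) p∤x = ∤-* p∤x (∤-^ k p∤x)

  ∤-resp-≅ : ∀ k → x ≅ y mod p ^ suc k → ¬ (+ p ℤ.∣ x) → ¬ (+ p ℤ.∣ y)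
  ∤-resp-≅ k x≅y p∤x p∣y = p∤x (∣-resp-≅ (≅-∣ (ℕ.m∣m*n (p ^ k)) (≅-sym x≅y)) p∣y)

  cancelˡ : ¬ (+ p ℤ.∣ u) → u ℤ.* x ≅ u ℤ.* y mod p → x ≅ y mod p
  cancelˡ {u} {x} {y} p∤u (congruent p∣ux-uy) with ∣*⇒∣⊎∣ u (x ℤ.- y) (≡.subst (+ p ℤ.∣_) (identity u x y) p∣ux-uy)
    where
    identity : ∀ u x y → u ℤ.* x ℤ.- u ℤ.* y ≡ u ℤ.* (x ℤ.- y)
    identity = solve-∀
  ... | inj₁ p∣u   = contradiction p∣u p∤u
  ... | inj₂ p∣x-y = congruent p∣x-y

  coprime-^ : ∀ k {i} → ¬ (p ∣ i) → ℕ.Coprime i (p ^ k)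
  coprime-^ k {i} p∤i {d} (d∣i , d∣p^k) = ℕ.∣1⇒≡1 (descend k d∣p^k)
    where
    d⊥p : ℕ.Coprime d p
    d⊥p {e} (e∣d , e∣p) with ℕ.prime⇒irreducible prime e∣p
    ... | inj₁ e≡1  = e≡1
    ... | inj₂ refl = contradiction (ℕ.∣-trans e∣d d∣i) p∤i
    descend : ∀ k → d ∣ p ^ k → d ∣ 1
    descend zero    d∣1 = d∣1
    descend (suc k) d∣p^k = descend k (ℕ.coprime-divisor d⊥p d∣p^k)

  unit? : ∀ x → Dec (¬ (+ p ℤ.∣ x))
  unit? x = ¬? (+ p ℤ.∣? x)

  unit?-periodic : ∀ k → Periodic (p ^ suc k) (λ x → ⟦ unit? x ⟧)
  unit?-periodic k {x} {y} e = ⟦⟧-cong (unit? x) (unit? y) (∤-resp-≅ k e) (∤-resp-≅ k (≅-sym e))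

  -- `φ` runs over 1, ..., p^(k+1) and `sumᵣ` over 0, ..., p^(k+1) - 1. The shift by one is written
  -- x - (-1) because `sumᵣ-shift` subtracts.
  φ-sum : ∀ k → φ (p ^ suc k) ≡ sumᵣ (p ^ suc k) (λ x → ⟦ unit? x ⟧)
  φ-sum k = begin
    φ (p ^ suc k)
      ≡⟨ ≡.cong (List.length ∘ List.filter (λ i → ℕ.coprime? i (p ^ suc k))) (List.map-upTo suc (p ^ suc k)) ⟩
    List.length (List.filter (λ i → ℕ.coprime? i (p ^ suc k)) (List.applyUpTo suc (p ^ suc k)))
      ≡⟨ length-filter-applyUpTo (λ i → ℕ.coprime? i (p ^ suc k)) suc (p ^ suc k) ⟩
    sum {p ^ suc k} (λ i → ⟦ ℕ.coprime? (suc (toℕ i)) (p ^ suc k) ⟧)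
      ≡⟨ sum-cong-≋ {p ^ suc k} (λ i → ⟦⟧-cong (ℕ.coprime? (suc (toℕ i)) (p ^ suc k)) (unit? (+ toℕ i ℤ.- -[1+ 0 ]))
           (λ coprime p∣1+i → ℕ.<⇒≢ 1<p (≡.sym (coprime (≡.subst (p ∣_) (ℕ.+-comm (toℕ i) 1) (ℤ.∣⇒∣ᵤ p∣1+i) , ℕ.m∣m*n (p ^ k)))))
           (λ p∤1+i → coprime-^ (suc k) (λ p∣1+i → p∤1+i (∣-cast (≡.subst (p ∣_) (ℕ.+-comm 1 (toℕ i)) p∣1+i))))) ⟩
    sumᵣ (p ^ suc k) (λ x → ⟦ unit? (x ℤ.- -[1+ 0 ]) ⟧)
      ≡⟨ sumᵣ-shift (p ^ suc k) {{ℕ.m^n≢0 p (suc k)}} -[1+ 0 ] (unit?-periodic k) ⟨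
    sumᵣ (p ^ suc k) (λ x → ⟦ unit? x ⟧) ∎
    where open ≡.≡-Reasoning

  -- The nonunits are the p^k multiples of p. The additive form keeps truncated subtraction out of
  -- the later cancellations.
  φ+p^k≡p^[1+k] : ∀ k → φ (p ^ suc k) + p ^ k ≡ p ^ suc k
  φ+p^k≡p^[1+k] k = begin
    φ (p ^ suc k) + p ^ k
      ≡⟨ ≡.cong₂ _+_ (φ-sum k) (≡.sym (≡.trans (≡.cong (λ N → sumᵣ N (λ x → ⟦ + p ℤ.∣? x ⟧)) (ℕ.*-comm p (p ^ k))) (sumᵣ-∣ (p ^ k) p))) ⟩
    sumᵣ (p ^ suc k) (λ x → ⟦ unit? x ⟧) + sumᵣ (p ^ suc k) (λ x → ⟦ + p ℤ.∣? x ⟧)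
      ≡⟨ ∑-distrib-+ {p ^ suc k} _ _ ⟨
    sumᵣ (p ^ suc k) (λ x → ⟦ unit? x ⟧ + ⟦ + p ℤ.∣? x ⟧)
      ≡⟨ sumᵣ-cong (p ^ suc k) (λ x → ⟦⟧-¬ (+ p ℤ.∣? x)) ⟩
    sumᵣ (p ^ suc k) (λ _ → 1)
      ≡⟨ ≡.trans (sum-const (p ^ suc k) 1) (ℕ.*-identityʳ _) ⟩
    p ^ suc k ∎
    where open ≡.≡-Reasoning

  φ-formula : ∀ k → φ (p ^ suc k) ≡ (p ∸ 1) * p ^ k
  φ-formula k = ℕ.+-cancelʳ-≡ (p ^ k) _ _ (≡.trans (φ+p^k≡p^[1+k] k)
    (≡.trans (≡.cong (_* p ^ k) (≡.sym (ℕ.m∸n+n≡m (ℕ.<⇒≤ 1<p))))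
      (≡.trans (ℕ.*-distribʳ-+ (p ^ k) (p ∸ 1) 1) (≡.cong (λ z → (p ∸ 1) * p ^ k + z) (ℕ.*-identityˡ (p ^ k))))))

  hasOrder⇒∤ : ∀ k {h d} → HasOrder (p ^ suc k) h d → ¬ (+ p ℤ.∣ h)
  hasOrder⇒∤ k {h} {suc d} ord p∣h =
    p∤1 (∣-resp-≅ (≅-∣ (ℕ.m∣m*n (p ^ k)) (^-order ord)) (ℤ.∣m⇒∣m*n (h ℤ.^ d) p∣h))
  hasOrder⇒∤ k {h} {zero} ord = λ _ → contradiction (HasOrder.positive ord) λ ()

  -- The powers of h are distinct units, as many as there are units.
  primitiveRoot-generates : ∀ k {h} → PrimitiveRoot (p ^ suc k) h →
                            ¬ (+ p ℤ.∣ x) → ∃ λ r → x ≅ h ℤ.^ r mod p ^ suc k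
  primitiveRoot-generates {x} k {h} root p∤x = hit (Fin.any? (isPower? x₀))
    where
    N′ d : ℕ
    N′ = p ^ suc k
    d  = φ N′
    instance
      N′≢0 : NonZero N′
      N′≢0 = ℕ.m^n≢0 p (suc k)
    p∤h : ¬ (+ p ℤ.∣ h)
    p∤h = hasOrder⇒∤ k root
    isPower? : ∀ x (r : Fin d) → Dec (x ≅ h ℤ.^ toℕ r mod N′)
    isPower? x r = x ≅? h ℤ.^ toℕ r mod N′
    powers : ℤ → ℕ
    powers x = sum {d} (λ r → ⟦ isPower? x r ⟧)
    x₀ : ℤ
    x₀ = + toℕ (residue N′ x)

    -- Multiplying by h^(d-i), which completes h^i to a full period, replaces division by h^i: the
    -- left side becomes 1 and the right side h^(j-i), against the minimality of d.
    distinct-< : ∀ {i j} → i < j → j < d → ¬ (h ℤ.^ i ≅ h ℤ.^ j mod N′)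
    distinct-< {i} {j} i<j j<d hⁱ≅hʲ = ℕ.<⇒≱ (ℕ.≤-<-trans (ℕ.m∸n≤m j i) j<d)
      (HasOrder.minimal root (j ∸ i) (ℕ.m<n⇒0<n∸m i<j) (congruence (≅-sym 1≅)))
      where
      i′ = d ∸ i
      i+i′ : i′ + i ≡ d
      i+i′ = ℕ.m∸n+n≡m (ℕ.<⇒≤ (ℕ.<-trans i<j j<d))
      open ≅-Reasoning N′
      1≅ : + 1 ≅ h ℤ.^ (j ∸ i) mod N′
      1≅ = begin
        + 1                                    ≈⟨ ^-order root ⟨
        h ℤ.^ d                                ≡⟨ ≡.cong (h ℤ.^_) i+i′ ⟨
        h ℤ.^ (i′ + i)                         ≡⟨ ℤ.^-distribˡ-+-* h i′ i ⟩
        h ℤ.^ i′ ℤ.* h ℤ.^ i                   ≈⟨ *-≅ˡ (h ℤ.^ i′) hⁱ≅hʲ ⟩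
        h ℤ.^ i′ ℤ.* h ℤ.^ j                   ≡⟨ ℤ.^-distribˡ-+-* h i′ j ⟨
        h ℤ.^ (i′ + j)                         ≡⟨ ≡.cong (λ e → h ℤ.^ (i′ + e)) (ℕ.m+[n∸m]≡n (ℕ.<⇒≤ i<j)) ⟨
        h ℤ.^ (i′ + (i + (j ∸ i)))             ≡⟨ ≡.cong (h ℤ.^_) (≡.trans (≡.sym (ℕ.+-assoc i′ i (j ∸ i))) (≡.cong (_+ (j ∸ i)) i+i′)) ⟩
        h ℤ.^ (d + (j ∸ i))                    ≡⟨ ℤ.^-distribˡ-+-* h d (j ∸ i) ⟩
        h ℤ.^ d ℤ.* h ℤ.^ (j ∸ i)              ≈⟨ *-≅ʳ (h ℤ.^ (j ∸ i)) (^-order root) ⟩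
        + 1 ℤ.* h ℤ.^ (j ∸ i)                  ≡⟨ ℤ.*-identityˡ _ ⟩
        h ℤ.^ (j ∸ i)                          ∎

    distinct : ∀ {x} {i j : Fin d} → x ≅ h ℤ.^ toℕ i mod N′ → x ≅ h ℤ.^ toℕ j mod N′ → i ≡ j
    distinct {i = i} {j} e e′ with ℕ.<-cmp (toℕ i) (toℕ j)
    ... | tri< i<j _ _ = contradiction (≅-trans (≅-sym e) e′) (distinct-< i<j (Fin.toℕ<n j))
    ... | tri≈ _ i≡j _ = Fin.toℕ-injective i≡j
    ... | tri> _ _ j<i = contradiction (≅-trans (≅-sym e′) e) (distinct-< j<i (Fin.toℕ<n i))

    powers≤unit : ∀ x → powers x ≤ ⟦ unit? x ⟧
    powers≤unit x = by-cases (unit? x)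
      where
      by-cases : ∀ (e : Dec (¬ (+ p ℤ.∣ x))) → powers x ≤ ⟦ e ⟧
      by-cases (yes _)    = sum-⟦⟧≤1 (isPower? x) distinct
      by-cases (no ¬unit) = ℕ.≤-reflexive (sum-zero {d} λ r →
        ⟦⟧-no (isPower? x r) λ x≅hʳ → ¬unit (∤-resp-≅ k (≅-sym x≅hʳ) (∤-^ (toℕ r) p∤h)))

    -- Double counting: summed over the residues first, each of the φ exponents contributes exactly
    -- one.
    total : sumᵣ N′ powers ≡ sumᵣ N′ (λ x → ⟦ unit? x ⟧)
    total = begin
      sumᵣ N′ powers
        ≡⟨ ∑-comm {N′} {d} _ ⟩
      sum {d} (λ r → sumᵣ N′ (λ x → ⟦ isPower? x r ⟧))
        ≡⟨ sum-cong-≋ {d} (λ r → sumᵣ-≅ N′ (h ℤ.^ toℕ r)) ⟩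
      sum {d} (λ _ → 1)
        ≡⟨ ≡.trans (sum-const d 1) (ℕ.*-identityʳ d) ⟩
      d
        ≡⟨ φ-sum k ⟩
      sumᵣ N′ (λ x → ⟦ unit? x ⟧) ∎
      where open ≡.≡-Reasoning

    hit : Dec (∃ λ (r : Fin d) → x₀ ≅ h ℤ.^ toℕ r mod N′) → ∃ λ r → x ≅ h ℤ.^ r mod N′
    hit (yes (r , e)) = toℕ r , ≅-trans (≅-sym (residue-≅ N′ x)) e
    hit (no none) = contradiction
      (≡.trans (≡.sym (⟦⟧-yes (unit? x₀) (∤-resp-≅ k (≅-sym (residue-≅ N′ x)) p∤x)))
        (≡.trans (≡.sym (sum-≤-≡ (λ i → powers≤unit (+ toℕ i)) total (residue N′ x)))
          (sum-zero {d} λ r → ⟦⟧-no (isPower? x₀ r) λ e → none (r , e))))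
      λ ()

-- Cyclotomic cosets inside ℤ

-- Membership of an arbitrary integer rather than of an element of `Fin n`, so that differences c -
-- b, negatives and passage to a divisor of the modulus need no reduction.
record InCoset (l N : ℕ) (γ x : ℤ) : Set where
  constructor inCoset
  field
    exponent : ℕ
    ≅-power  : x ≅ γ ℤ.* (+ l) ℤ.^ exponent mod N

inCoset? : ∀ l N .{{_ : NonZero N}} γ x → Dec (InCoset l N γ x)
inCoset? l N γ x = map′
  (λ (r , e) → inCoset r (≅-trans (≅-sym (residue-≅ N x)) (congruent e)))
  (λ (inCoset r e) → r , congruence (≅-trans (residue-≅ N x) e))
  (coset?-nonZero l γ (residue N x))

cosetIndicator : ∀ l N .{{_ : NonZero N}} → ℤ → ℤ → ℕ
cosetIndicator l N γ x = ⟦ inCoset? l N γ x ⟧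

module _ {l N : ℕ} where
  inCoset-resp-≅ : ∀ {γ} → x ≅ y mod N → InCoset l N γ x → InCoset l N γ y
  inCoset-resp-≅ x≅y (inCoset r e) = inCoset r (≅-trans (≅-sym x≅y) e)

  inCoset-∣ : ∀ {γ} → m ∣ N → InCoset l N γ x → InCoset l m γ x
  inCoset-∣ m∣N (inCoset r e) = inCoset r (≅-∣ m∣N e)

  inCoset?-periodic : .{{_ : NonZero N}} → ∀ γ → Periodic N (λ x → cosetIndicator l N γ x)
  inCoset?-periodic γ {x} {y} e = ⟦⟧-cong (inCoset? l N γ x) (inCoset? l N γ y)
    (inCoset-resp-≅ e) (inCoset-resp-≅ (≅-sym e))

  inCoset-refl : ∀ γ → InCoset l N γ γ
  inCoset-refl γ = inCoset 0 (≅-reflexive (≡.sym (ℤ.*-identityʳ γ)))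

  inCoset-trans : ∀ {γ} → InCoset l N x y → InCoset l N γ x → InCoset l N γ y
  inCoset-trans {x = x} {y = y} {γ = γ} (inCoset r y≅) (inCoset r′ x≅) = inCoset (r′ + r) (begin
    y                                             ≈⟨ y≅ ⟩
    x ℤ.* (+ l) ℤ.^ r                             ≈⟨ *-≅ʳ ((+ l) ℤ.^ r) x≅ ⟩
    γ ℤ.* (+ l) ℤ.^ r′ ℤ.* (+ l) ℤ.^ r            ≡⟨ ℤ.*-assoc γ _ _ ⟩
    γ ℤ.* ((+ l) ℤ.^ r′ ℤ.* (+ l) ℤ.^ r)          ≡⟨ ≡.cong (γ ℤ.*_) (ℤ.^-distribˡ-+-* (+ l) r′ r) ⟨
    γ ℤ.* (+ l) ℤ.^ (r′ + r)                      ∎)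
    where open ≅-Reasoning N

  inCoset-*ˡ : ∀ {γ} u → InCoset l N γ x → InCoset l N (u ℤ.* γ) (u ℤ.* x)
  inCoset-*ˡ {γ = γ} u (inCoset r e) = inCoset r (≅-trans (*-≅ˡ u e) (≅-reflexive (≡.sym (ℤ.*-assoc u γ _))))

  inCoset-neg : ∀ {γ} → InCoset l N γ x → InCoset l N (ℤ.- γ) (ℤ.- x)
  inCoset-neg {γ = γ} (inCoset r e) = inCoset r (≅-trans (neg-≅ e) (≅-reflexive (ℤ.neg-distribˡ-* γ ((+ l) ℤ.^ r))))

  inCoset1-* : InCoset l N (+ 1) x → InCoset l N (+ 1) y → InCoset l N (+ 1) (x ℤ.* y)
  inCoset1-* {x} {y} x∈ y∈ = inCoset-trans
    (≡.subst (λ γ → InCoset l N γ (x ℤ.* y)) (ℤ.*-identityʳ x) (inCoset-*ˡ x y∈)) x∈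

  inCoset1-^ : InCoset l N (+ 1) x → ∀ e → InCoset l N (+ 1) (x ℤ.^ e)
  inCoset1-^ x∈ zero    = inCoset-refl (+ 1)
  inCoset1-^ x∈ (suc e) = inCoset1-* x∈ (inCoset1-^ x∈ e)

sumᵣ-inCoset-absorb : ∀ l N .{{_ : NonZero N}} γ δ c →
  (∀ {b} → InCoset l N δ b → InCoset l N γ (c ℤ.- b) → InCoset l N γ c) →
  (∀ {b} → InCoset l N δ b → InCoset l N γ c → InCoset l N γ (c ℤ.- b)) →
  ∀ {S} → sumᵣ N (cosetIndicator l N δ) ≡ S →
  sumᵣ N (λ b → cosetIndicator l N δ b * cosetIndicator l N γ (c ℤ.- b)) ≡ S * cosetIndicator l N γ c
sumᵣ-inCoset-absorb l N γ δ = sumᵣ-absorb N (inCoset? l N γ) (inCoset? l N δ)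

power-≅1 : ∀ k → x ≅ + 1 mod N → x ℤ.^ k ≅ + 1 mod N
power-≅1 k e = ≅-trans (^-≅ k e) (≅-reflexive (ℤ.^-zeroˡ k))

^-multiple-≅1 : ∀ {h d} k → h ℤ.^ d ≅ + 1 mod N → h ℤ.^ (d * k) ≅ + 1 mod N
^-multiple-≅1 {h = h} {d} k e = ≅-trans (≅-reflexive (≡.sym (ℤ.^-*-assoc h d k))) (power-≅1 k e)

-- If e is the order of l, then l^((e-1) r) inverts l^r. Together with `inCoset-trans` this makes
-- the cosets equivalence classes.
inCoset-sym : ∀ {l N d γ} → HasOrder N (+ l) d → InCoset l N γ x → InCoset l N x γ
inCoset-sym {d = zero}  ord _ = contradiction (HasOrder.positive ord) λ ()
inCoset-sym {x} {l} {N} {suc d} {γ} ord (inCoset r x≅) = inCoset (d * r) (begin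
  γ                                              ≡⟨ ℤ.*-identityʳ γ ⟨
  γ ℤ.* + 1                                      ≈⟨ *-≅ˡ γ (^-multiple-≅1 {d = suc d} r (^-order ord)) ⟨
  γ ℤ.* (+ l) ℤ.^ (r + d * r)                    ≡⟨ ≡.cong (γ ℤ.*_) (ℤ.^-distribˡ-+-* (+ l) r (d * r)) ⟩
  γ ℤ.* ((+ l) ℤ.^ r ℤ.* (+ l) ℤ.^ (d * r))      ≡⟨ ℤ.*-assoc γ _ _ ⟨
  γ ℤ.* (+ l) ℤ.^ r ℤ.* (+ l) ℤ.^ (d * r)        ≈⟨ *-≅ʳ ((+ l) ℤ.^ (d * r)) x≅ ⟨
  x ℤ.* (+ l) ℤ.^ (d * r)                        ∎)
  where open ≅-Reasoning N

power-cong : ∀ {h e i j} .{{_ : NonZero e}} → h ℤ.^ e ≅ + 1 mod N → + i ≅ + j mod e → h ℤ.^ i ≅ h ℤ.^ j mod N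
power-cong {N} {h} {e} {i} {j} hᵉ≅1 i≅j = begin
  h ℤ.^ i          ≈⟨ reduce i ⟩
  h ℤ.^ (i % e)    ≡⟨ ≡.cong (h ℤ.^_) i%e≡j%e ⟩
  h ℤ.^ (j % e)    ≈⟨ reduce j ⟨
  h ℤ.^ j          ∎
  where
  open ≅-Reasoning N
  reduce : ∀ i → h ℤ.^ i ≅ h ℤ.^ (i % e) mod N
  reduce i = begin
    h ℤ.^ i                                      ≡⟨ ≡.cong (h ℤ.^_) (ℕ.m≡m%n+[m/n]*n i e) ⟩
    h ℤ.^ (i % e + i / e * e)                    ≡⟨ ℤ.^-distribˡ-+-* h (i % e) (i / e * e) ⟩
    h ℤ.^ (i % e) ℤ.* h ℤ.^ (i / e * e)          ≡⟨ ≡.cong (λ k → h ℤ.^ (i % e) ℤ.* h ℤ.^ k) (ℕ.*-comm (i / e) e) ⟩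
    h ℤ.^ (i % e) ℤ.* h ℤ.^ (e * (i / e))        ≈⟨ *-≅ˡ (h ℤ.^ (i % e)) (^-multiple-≅1 {d = e} (i / e) hᵉ≅1) ⟩
    h ℤ.^ (i % e) ℤ.* + 1                        ≡⟨ ℤ.*-identityʳ _ ⟩
    h ℤ.^ (i % e)                                ∎
  i%e≡j%e : i % e ≡ j % e
  i%e≡j%e = ≡.trans (≡.sym (Fin.toℕ-fromℕ< _))
    (≡.trans (≡.cong toℕ (toℕ-≅-injective (≅-trans (residue-≅ e (+ i)) (≅-trans i≅j (≅-sym (residue-≅ e (+ j)))))))
      (Fin.toℕ-fromℕ< _))

∣-coprime-* : ∀ {M N} → ℕ.Coprime M N → + M ℤ.∣ x → + N ℤ.∣ x → + (M * N) ℤ.∣ x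
∣-coprime-* {x} {M} {N} M⊥N M∣x N∣x with ℤ.∣⇒∣ᵤ N∣x
... | ℕ.divides q eq = ℤ.∣ᵤ⇒∣ (≡.subst (M * N ∣_) (≡.sym eq) (ℕ.*-monoˡ-∣ N (ℕ.coprime-divisor M⊥N
  (≡.subst (M ∣_) (≡.trans eq (ℕ.*-comm q N)) (ℤ.∣⇒∣ᵤ M∣x)))))

-- The Chinese remainder theorem for the exponents: a + d k with k = d⁻¹ (b - a) is b modulo e.
inCoset-coprime : ∀ {l M N d e γ} → HasOrder M (+ l) d → HasOrder N (+ l) e → ℕ.Coprime d e → ℕ.Coprime M N →
                  InCoset l M γ x → InCoset l N γ x → InCoset l (M * N) γ x
inCoset-coprime {e = zero} _ ordN _ _ _ _ = contradiction (HasOrder.positive ordN) λ ()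
inCoset-coprime {x} {l} {M} {N} {d} {e@(suc _)} {γ} ordM ordN d⊥e M⊥N (inCoset a x≅a) (inCoset b x≅b) =
  inCoset (a + d * k) (congruent (∣-coprime-* M⊥N
    (congruence (≅-trans x≅a (≅-sym (*-≅ˡ γ modM))))
    (congruence (≅-trans x≅b (≅-sym (*-≅ˡ γ (power-cong (^-order ordN) a+dk≅b)))))))
  where
  d⁻¹ : ℤ
  d⁻¹ = proj₁ (inverse-mod d⊥e)
  k : ℕ
  k = toℕ (residue e (d⁻¹ ℤ.* (+ b ℤ.- + a)))
  L : ℕ → ℤ
  L r = (+ l) ℤ.^ r
  modM : L (a + d * k) ≅ L a mod M
  modM = begin
    L (a + d * k)            ≡⟨ ℤ.^-distribˡ-+-* (+ l) a (d * k) ⟩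
    L a ℤ.* L (d * k)        ≈⟨ *-≅ˡ (L a) (^-multiple-≅1 {d = d} k (^-order ordM)) ⟩
    L a ℤ.* + 1              ≡⟨ ℤ.*-identityʳ (L a) ⟩
    L a                      ∎
    where open ≅-Reasoning M
  a+dk≅b : + (a + d * k) ≅ + b mod e
  a+dk≅b = begin
    + a ℤ.+ + (d * k)                                   ≡⟨ ≡.cong (λ z → + a ℤ.+ z) (ℤ.pos-* d k) ⟩
    + a ℤ.+ + d ℤ.* + k                                 ≈⟨ +-≅ˡ (+ a) (*-≅ˡ (+ d) (residue-≅ e _)) ⟩
    + a ℤ.+ + d ℤ.* (d⁻¹ ℤ.* (+ b ℤ.- + a))             ≡⟨ ≡.cong (λ z → + a ℤ.+ z) (ℤ.*-assoc (+ d) d⁻¹ _) ⟨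
    + a ℤ.+ + d ℤ.* d⁻¹ ℤ.* (+ b ℤ.- + a)               ≈⟨ +-≅ˡ (+ a) (*-≅ʳ (+ b ℤ.- + a) (proj₂ (inverse-mod d⊥e))) ⟩
    + a ℤ.+ + 1 ℤ.* (+ b ℤ.- + a)                       ≡⟨ cancel (+ a) (+ b) ⟩
    + b                                                 ∎
    where
    open ≅-Reasoning e
    cancel : ∀ a b → a ℤ.+ + 1 ℤ.* (b ℤ.- a) ≡ b
    cancel = solve-∀

inCoset-*⇔ : ∀ {l M N d e} γ → HasOrder M (+ l) d → HasOrder N (+ l) e → ℕ.Coprime d e → ℕ.Coprime M N → ∀ x →
             .{{_ : NonZero M}} .{{_ : NonZero N}} .{{_ : NonZero (M * N)}} →
             cosetIndicator l (M * N) γ x ≡ cosetIndicator l M γ x * cosetIndicator l N γ x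
inCoset-*⇔ {l} {M} {N} γ ordM ordN d⊥e M⊥N x = ≡.trans
  (⟦⟧-cong (inCoset? l (M * N) γ x) (inCoset? l M γ x ×-dec inCoset? l N γ x)
    (λ x∈ → inCoset-∣ (ℕ.m∣m*n N) x∈ , inCoset-∣ (ℕ.n∣m*n M) x∈)
    (λ (x∈M , x∈N) → inCoset-coprime ordM ordN d⊥e M⊥N x∈M x∈N))
  (⟦⟧-× (inCoset? l M γ x) (inCoset? l N γ x))

-- Convolution of indicators modulo M N

inCoset?-cong : ∀ {l N d γ γ′} .{{_ : NonZero N}} → HasOrder N (+ l) d → InCoset l N γ γ′ →
                ∀ x → cosetIndicator l N γ x ≡ cosetIndicator l N γ′ x
inCoset?-cong {l} {N} {γ = γ} {γ′} ord γ′∈ x = ⟦⟧-cong (inCoset? l N γ x) (inCoset? l N γ′ x)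
  (λ x∈ → inCoset-trans x∈ (inCoset-sym ord γ′∈)) (λ x∈ → inCoset-trans x∈ γ′∈)

convolution-term : ∀ l N .{{_ : NonZero N}} → ℤ → ℤ → ℤ → ℤ → ℕ
convolution-term l N γ δ c b = cosetIndicator l N δ b * cosetIndicator l N γ (c ℤ.- b)

-- The coefficient of x^c in the product of the coset sums of `γ` and `δ`, before reduction modulo
-- l.
convolution : ∀ l N .{{_ : NonZero N}} → ℤ → ℤ → ℤ → ℕ
convolution l N γ δ c = sumᵣ N (convolution-term l N γ δ c)

convolution-term-periodic : ∀ l N .{{_ : NonZero N}} γ δ c → Periodic N (convolution-term l N γ δ c)
convolution-term-periodic l N γ δ c e = ≡.cong₂ _*_ (inCoset?-periodic δ e) (inCoset?-periodic γ (+-≅ˡ c (neg-≅ e)))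

-- Both indicators split by the Chinese remainder theorem, so each summand is a function modulo `M`
-- times one modulo `N`. As `sumᵣ-coprime` takes a modulus j * i with the i-periodic factor first,
-- the factor modulo `N` is put in front.
convolution-* : ∀ {l M N d e} .{{_ : NonZero M}} .{{_ : NonZero N}} .{{_ : NonZero (M * N)}} →
  HasOrder M (+ l) d → HasOrder N (+ l) e → ℕ.Coprime d e → ℕ.Coprime M N →
  ∀ γ δ c → convolution l (M * N) γ δ c ≡ convolution l M γ δ c * convolution l N γ δ c
convolution-* {l} {M} {N} ordM ordN d⊥e M⊥N γ δ c = ≡.trans split-sum (≡.trans factor-sum (ℕ.*-comm (convolution l N γ δ c) (convolution l M γ δ c)))
  where
  interchange : ∀ w x y z → w * x * (y * z) ≡ x * z * (w * y)
  interchange = ℕSolver.solve-∀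
  split : ∀ b → convolution-term l (M * N) γ δ c b ≡ convolution-term l N γ δ c b * convolution-term l M γ δ c b
  split b = ≡.trans
    (≡.cong₂ _*_ (inCoset-*⇔ δ ordM ordN d⊥e M⊥N b) (inCoset-*⇔ γ ordM ordN d⊥e M⊥N (c ℤ.- b)))
    (interchange (cosetIndicator l M δ b) (cosetIndicator l N δ b) (cosetIndicator l M γ (c ℤ.- b)) (cosetIndicator l N γ (c ℤ.- b)))
  split-sum : convolution l (M * N) γ δ c ≡ sumᵣ (M * N) (λ b → convolution-term l N γ δ c b * convolution-term l M γ δ c b)
  split-sum = sumᵣ-cong (M * N) split
  factor-sum : sumᵣ (M * N) (λ b → convolution-term l N γ δ c b * convolution-term l M γ δ c b) ≡ convolution l N γ δ c * convolution l M γ δ c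
  factor-sum = sumᵣ-coprime N M (ℕ.sym M⊥N) (convolution-term-periodic l N γ δ c) (convolution-term-periodic l M γ δ c)

-- Exact divisibility by prime powers

exact? : ∀ p i x → Dec ((+ (p ^ i) ℤ.∣ x) × ¬ (+ (p ^ suc i) ℤ.∣ x))
exact? p i x = (+ (p ^ i) ℤ.∣? x) ×-dec ¬? (+ (p ^ suc i) ℤ.∣? x)

∣-^-pred : ∀ p i → + (p ^ suc i) ℤ.∣ x → + (p ^ i) ℤ.∣ x
∣-^-pred p i = ℤ.∣-trans (∣-cast (ℕ.n∣m*n p))

-- Serves twice: summed over the residues it counts the exact multiples of p^i, and iterated over
-- `i` it telescopes the sum over the cosets of the powers of q.
exact-split : ∀ p i x → ⟦ + (p ^ i) ℤ.∣? x ⟧ ≡ ⟦ exact? p i x ⟧ + ⟦ + (p ^ suc i) ℤ.∣? x ⟧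
exact-split p i x = ⟦⟧-⊎ (+ (p ^ i) ℤ.∣? x) (exact? p i x) (+ (p ^ suc i) ℤ.∣? x)
  split proj₁ (∣-^-pred p i) proj₂
  where
  split : + (p ^ i) ℤ.∣ x → ((+ (p ^ i) ℤ.∣ x) × ¬ (+ (p ^ suc i) ℤ.∣ x)) ⊎ (+ (p ^ suc i) ℤ.∣ x)
  split pⁱ∣x with + (p ^ suc i) ℤ.∣? x
  ... | yes pⁱ⁺¹∣x = inj₂ pⁱ⁺¹∣x
  ... | no  pⁱ⁺¹∤x = inj₁ (pⁱ∣x , pⁱ⁺¹∤x)

module _ (p : ℕ) .{{_ : NonZero p}} where
  ∣-^⇒multiple : ∀ i → + (p ^ i) ℤ.∣ x → ∃ λ y → x ≡ + (p ^ i) ℤ.* y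
  ∣-^⇒multiple i (divides y x≡) = y , ≡.trans x≡ (ℤ.*-comm y (+ (p ^ i)))

  multiple⇒∣-^ : ∀ i y → + (p ^ i) ℤ.∣ + (p ^ i) ℤ.* y
  multiple⇒∣-^ i y = ℤ.∣m⇒∣m*n y ℤ.∣-refl

  p^[1+i]≡ : ∀ i → + (p ^ suc i) ≡ + (p ^ i) ℤ.* + p
  p^[1+i]≡ i = ≡.trans (≡.cong +_ (ℕ.*-comm p (p ^ i))) (ℤ.pos-* (p ^ i) p)

  ∣-^-cancel : ∀ i → + (p ^ suc i) ℤ.∣ + (p ^ i) ℤ.* y → + p ℤ.∣ y
  ∣-^-cancel {y} i d = ℤ.*-cancelˡ-∣ (+ (p ^ i)) {{ℕ.m^n≢0 p i}}
    (≡.subst (ℤ._∣ + (p ^ i) ℤ.* y) (p^[1+i]≡ i) d)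

  p^[j-i]*p^i≡p^j : ∀ {i j} → i ≤ j → p ^ (j ∸ i) * p ^ i ≡ p ^ j
  p^[j-i]*p^i≡p^j {i} {j} i≤j =
    ≡.trans (≡.sym (ℕ.^-distribˡ-+-* p (j ∸ i) i)) (≡.cong (p ^_) (ℕ.m∸n+n≡m i≤j))

  ^-∣-^ : ∀ {i j} → i ≤ j → p ^ i ∣ p ^ j
  ^-∣-^ {i} {j} i≤j = ℕ.divides (p ^ (j ∸ i)) (≡.sym (p^[j-i]*p^i≡p^j i≤j))

  sumᵣ-∣-^ : ∀ {i s} → i ≤ s → sumᵣ (p ^ s) (λ x → ⟦ + (p ^ i) ℤ.∣? x ⟧) ≡ p ^ (s ∸ i)
  sumᵣ-∣-^ {i} {s} i≤s = ≡.trans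
    (≡.cong (λ N → sumᵣ N (λ x → ⟦ + (p ^ i) ℤ.∣? x ⟧)) (≡.sym (p^[j-i]*p^i≡p^j i≤s)))
    (sumᵣ-∣ (p ^ (s ∸ i)) (p ^ i) {{ℕ.m^n≢0 p i}})

  sumᵣ-exact : ∀ {i s} → i < s → sumᵣ (p ^ s) (λ x → ⟦ exact? p i x ⟧) + p ^ (s ∸ suc i) ≡ p ^ (s ∸ i)
  sumᵣ-exact {i} {s} i<s = begin
    sumᵣ (p ^ s) (λ x → ⟦ exact? p i x ⟧) + p ^ (s ∸ suc i)
      ≡⟨ ≡.cong (_+_ (sumᵣ (p ^ s) (λ x → ⟦ exact? p i x ⟧))) (sumᵣ-∣-^ i<s) ⟨
    sumᵣ (p ^ s) (λ x → ⟦ exact? p i x ⟧) + sumᵣ (p ^ s) (λ x → ⟦ + (p ^ suc i) ℤ.∣? x ⟧)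
      ≡⟨ ∑-distrib-+ {p ^ s} (λ x → ⟦ exact? p i (+ toℕ x) ⟧) (λ x → ⟦ + (p ^ suc i) ℤ.∣? + toℕ x ⟧) ⟨
    sumᵣ (p ^ s) (λ x → ⟦ exact? p i x ⟧ + ⟦ + (p ^ suc i) ℤ.∣? x ⟧)
      ≡⟨ sumᵣ-cong (p ^ s) (λ x → ≡.sym (exact-split p i x)) ⟩
    sumᵣ (p ^ s) (λ x → ⟦ + (p ^ i) ℤ.∣? x ⟧)
      ≡⟨ sumᵣ-∣-^ (ℕ.<⇒≤ i<s) ⟩
    p ^ (s ∸ i) ∎
    where open ≡.≡-Reasoning

-- The prime p: ⟨l⟩ has index 2 modulo p^s and does not contain -1

parity : ∀ e → (∃ λ k → e ≡ 2 * k) ⊎ (∃ λ k → e ≡ suc (2 * k))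
parity zero = inj₁ (0 , refl)
parity (suc e) with parity e
... | inj₁ (k , refl) = inj₂ (k , refl)
... | inj₂ (k , refl) = inj₁ (suc k , ≡.cong suc (≡.sym (ℕ.+-suc k (k + 0))))

neg-^-even : ∀ x k → (ℤ.- x) ℤ.^ (2 * k) ≡ x ℤ.^ (2 * k)
neg-^-even x k = begin
  (ℤ.- x) ℤ.^ (2 * k)      ≡⟨ ℤ.^-*-assoc (ℤ.- x) 2 k ⟨
  ((ℤ.- x) ℤ.^ 2) ℤ.^ k    ≡⟨ ≡.cong (ℤ._^ k) (square x) ⟩
  (x ℤ.^ 2) ℤ.^ k          ≡⟨ ℤ.^-*-assoc x 2 k ⟩
  x ℤ.^ (2 * k)            ∎
  where
  open ≡.≡-Reasoning
  square : ∀ x → ℤ.- x ℤ.* (ℤ.- x ℤ.* + 1) ≡ x ℤ.* (x ℤ.* + 1)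
  square = solve-∀

neg-^-odd : ∀ x k → (ℤ.- x) ℤ.^ suc (2 * k) ≡ ℤ.- (x ℤ.^ suc (2 * k))
neg-^-odd x k = ≡.trans (≡.cong (ℤ.- x ℤ.*_) (neg-^-even x k)) (≡.sym (ℤ.neg-distribˡ-* x _))

Odd : ℕ → Set
Odd n = ∃ λ k → n ≡ suc (2 * k)

odd-* : ∀ {i j} → Odd i → Odd j → Odd (i * j)
odd-* (a , refl) (b , refl) = a + b + 2 * (a * b) , identity a b
  where
  identity : ∀ a b → suc (2 * a) * suc (2 * b) ≡ suc (2 * (a + b + 2 * (a * b)))
  identity = ℕSolver.solve-∀

odd-^ : ∀ {i} → Odd i → ∀ k → Odd (i ^ k)
odd-^ odd zero    = 0 , refl
odd-^ odd (suc k) = odd-* odd (odd-^ odd k)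

odd⇒2∤ : ∀ {i} → Odd i → ¬ (2 ∣ i)
odd⇒2∤ (k , refl) 2∣i = contradiction (ℕ.∣1⇒≡1 (ℕ.∣m+n∣m⇒∣n (≡.subst (2 ∣_) (ℕ.+-comm 1 (2 * k)) 2∣i) (ℕ.m∣m*n k))) λ ()

module _ {p} (prime : Prime p) (p%4≡3 : p % 4 ≡ 3) where
  private
    w : ℕ
    w = p / 4
    p≡ : p ≡ suc (2 * suc (2 * w))
    p≡ = ≡.trans (ℕ.m≡m%n+[m/n]*n p 4) (≡.trans (≡.cong (_+ w * 4) p%4≡3) (identity w))
      where
      identity : ∀ w → 3 + w * 4 ≡ suc (2 * suc (2 * w))
      identity = ℕSolver.solve-∀

  p-odd : Odd p
  p-odd = suc (2 * w) , p≡

  -- Here p ≡ 3 mod 4 enters: with w = p / 4 one has p - 1 = 2 (2 w + 1), so half of φ(p^(k+1)) is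
  -- (2 w + 1) p^k, a product of odd numbers.
  φ/2-odd : ∀ k → Odd (φ (p ^ suc k) / 2) × φ (p ^ suc k) ≡ 2 * (φ (p ^ suc k) / 2)
  φ/2-odd k = ≡.subst Odd (≡.sym φ/2≡) (odd-* (w , refl) (odd-^ p-odd k)) ,
    ≡.trans φ≡ (≡.cong (2 *_) (≡.sym φ/2≡))
    where
    φ≡ : φ (p ^ suc k) ≡ 2 * (suc (2 * w) * p ^ k)
    φ≡ = ≡.trans (φ-formula prime k) (≡.trans (≡.cong (λ z → (z ∸ 1) * p ^ k) p≡) (ℕ.*-assoc 2 (suc (2 * w)) (p ^ k)))
    φ/2≡ : φ (p ^ suc k) / 2 ≡ suc (2 * w) * p ^ k
    φ/2≡ = ≡.trans (≡.cong (_/ 2) (≡.trans φ≡ (ℕ.*-comm 2 (suc (2 * w) * p ^ k)))) (ℕ.m*n/n≡m (suc (2 * w) * p ^ k) 2)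

module OddOrder {p} (prime : Prime p) (odd-p : Odd p) {d} (odd-d : Odd d) (k l : ℕ)
                (order-l : HasOrder (p ^ suc k) (+ l) d) where
  private
    pˢ : ℕ
    pˢ = p ^ suc k
    L : ℕ → ℤ
    L r = (+ l) ℤ.^ r
    p∣pˢ : p ∣ pˢ
    p∣pˢ = ℕ.m∣m*n (p ^ k)
    Lᵈ≅1 : L d ≅ + 1 mod pˢ
    Lᵈ≅1 = ^-order order-l

  p∤2 : ¬ (+ p ℤ.∣ + 2)
  p∤2 p∣2 with ℕ.prime⇒irreducible ℕ.prime[2] (ℤ.∣⇒∣ᵤ p∣2)
  ... | inj₁ p≡1 = ℕ.<⇒≢ (1<p prime) (≡.sym p≡1)
  ... | inj₂ p≡2 = odd⇒2∤ odd-p (≡.subst (2 ∣_) (≡.sym p≡2) ℕ.∣-refl)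

  -- Raising to the odd power d would give 1 = -1.
  L≇-L : ∀ {a b} → ¬ (L a ≅ ℤ.- L b mod p)
  L≇-L {a} {b} e = p∤2 (congruence 1≅-1)
    where
    open ≅-Reasoning p
    power : ∀ a → L a ℤ.^ d ≅ + 1 mod p
    power a = ≅-∣ p∣pˢ (≅-trans (≅-reflexive (≡.trans (ℤ.^-*-assoc (+ l) a d) (≡.cong L (ℕ.*-comm a d))))
      (^-multiple-≅1 {d = d} a Lᵈ≅1))
    1≅-1 : + 1 ≅ ℤ.- (+ 1) mod p
    1≅-1 = begin
      + 1                      ≈⟨ power a ⟨
      L a ℤ.^ d                ≈⟨ ^-≅ d e ⟩
      (ℤ.- L b) ℤ.^ d          ≡⟨ neg-^ odd-d ⟩
      ℤ.- (L b ℤ.^ d)          ≈⟨ neg-≅ (power b) ⟩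
      ℤ.- (+ 1)                ∎
      where
      neg-^ : ∀ {d} → Odd d → (ℤ.- L b) ℤ.^ d ≡ ℤ.- (L b ℤ.^ d)
      neg-^ (c , refl) = neg-^-odd (L b) c

  inCoset-¬neg : ∀ {u} → ¬ (+ p ℤ.∣ u) → InCoset l p u x → ¬ InCoset l p u (ℤ.- x)
  inCoset-¬neg {u = u} p∤u (inCoset a x≅) (inCoset b -x≅) = L≇-L {b} {a} (cancelˡ prime p∤u
    (≅-trans (≅-sym -x≅) (≅-trans (neg-≅ x≅) (≅-reflexive (ℤ.neg-distribʳ-* u (L a))))))

  -- An odd exponent e would give 1 = -l^e, which is impossible even modulo p. An even exponent 2 c
  -- gives l^(2c) = 1, and oddness of d brings this down to l^c = 1, so that d ≤ c. If φ(p^(k+1)) =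
  -- 2 d, this makes -l a primitive root.
  negation-order : HasOrder pˢ (ℤ.- (+ l)) (2 * d)
  negation-order = record
    { positive = ℕ.≤-trans (HasOrder.positive order-l) (ℕ.m≤m+n d (d + 0))
    ; power    = congruence power
    ; minimal  = λ e 0<e e≅ → minimal e (parity e) 0<e (congruent e≅)
    }
    where
    open ≅-Reasoning pˢ
    power : (ℤ.- (+ l)) ℤ.^ (2 * d) ≅ + 1 mod pˢ
    power = begin
      (ℤ.- (+ l)) ℤ.^ (2 * d)      ≡⟨ neg-^-even (+ l) d ⟩
      L (2 * d)                    ≡⟨ ≡.cong L (ℕ.*-comm 2 d) ⟩
      L (d * 2)                    ≈⟨ ^-multiple-≅1 {d = d} 2 Lᵈ≅1 ⟩
      + 1                          ∎
    minimal : ∀ e → (∃ λ k → e ≡ 2 * k) ⊎ Odd e → 0 < e → (ℤ.- (+ l)) ℤ.^ e ≅ + 1 mod pˢ → 2 * d ≤ e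
    minimal e (inj₂ (c , e≡)) _ e≅ = contradiction 1≅-Lᵉ (L≇-L {0} {e})
      where
      neg-^ : (ℤ.- (+ l)) ℤ.^ e ≡ ℤ.- L e
      neg-^ = ≡.subst (λ e → (ℤ.- (+ l)) ℤ.^ e ≡ ℤ.- L e) (≡.sym e≡) (neg-^-odd (+ l) c)
      1≅-Lᵉ : + 1 ≅ ℤ.- L e mod p
      1≅-Lᵉ = ≅-trans (≅-sym (≅-∣ p∣pˢ e≅)) (≅-reflexive neg-^)
    minimal e (inj₁ (zero , refl)) ()
    minimal e (inj₁ (c@(suc _) , e≡)) _ e≅ =
      ≡.subst (2 * d ≤_) (≡.sym e≡) (ℕ.*-monoʳ-≤ 2 (HasOrder.minimal order-l c (s≤s z≤n) (congruence (Lᶜ≅1 odd-d))))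
      where
      L²ᶜ≅1 : L (2 * c) ≅ + 1 mod pˢ
      L²ᶜ≅1 = ≅-trans (≅-reflexive (≡.sym (neg-^-even (+ l) c)))
        (≡.subst (λ e → (ℤ.- (+ l)) ℤ.^ e ≅ + 1 mod pˢ) e≡ e≅)
      -- c ≡ c d modulo 2 c because d is odd.
      Lᶜ≅1 : Odd d → L c ≅ + 1 mod pˢ
      Lᶜ≅1 (f , d≡) = begin
        L c                              ≡⟨ ℤ.*-identityʳ (L c) ⟨
        L c ℤ.* + 1                      ≈⟨ *-≅ˡ (L c) (^-multiple-≅1 {d = 2 * c} f L²ᶜ≅1) ⟨
        L c ℤ.* L (2 * c * f)            ≡⟨ ℤ.^-distribˡ-+-* (+ l) c (2 * c * f) ⟨
        L (c + 2 * c * f)                ≡⟨ ≡.cong L (identity c f) ⟩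
        L (suc (2 * f) * c)              ≡⟨ ≡.cong (λ d → L (d * c)) d≡ ⟨
        L (d * c)                        ≈⟨ ^-multiple-≅1 {d = d} c Lᵈ≅1 ⟩
        + 1                              ∎
        where
        identity : ∀ c f → c + 2 * c * f ≡ suc (2 * f) * c
        identity = ℕSolver.solve-∀

  power-dichotomy : ∀ r → InCoset l pˢ (+ 1) ((ℤ.- (+ l)) ℤ.^ r) ⊎ InCoset l pˢ (+ 1) (ℤ.- ((ℤ.- (+ l)) ℤ.^ r))
  power-dichotomy r with parity r
  ... | inj₁ (c , r≡) = inj₁ (inCoset r (≅-reflexive (≡.trans even (≡.sym (ℤ.*-identityˡ (L r))))))
    where
    even : (ℤ.- (+ l)) ℤ.^ r ≡ L r
    even = ≡.subst (λ r → (ℤ.- (+ l)) ℤ.^ r ≡ L r) (≡.sym r≡) (neg-^-even (+ l) c)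
  ... | inj₂ (c , r≡) = inj₂ (inCoset r (≅-reflexive (≡.trans (≡.cong ℤ.-_ odd)
      (≡.trans (ℤ.neg-involutive (L r)) (≡.sym (ℤ.*-identityˡ (L r)))))))
    where
    odd : (ℤ.- (+ l)) ℤ.^ r ≡ ℤ.- L r
    odd = ≡.subst (λ r → (ℤ.- (+ l)) ℤ.^ r ≡ ℤ.- L r) (≡.sym r≡) (neg-^-odd (+ l) c)

  -- A unit is a power of the primitive root -l, and the parity of the exponent decides the sign.
  -- This is the statement that ⟨l⟩ has index 2, with -1 representing the other class.
  unit-dichotomy₁ : φ pˢ ≡ 2 * d → ¬ (+ p ℤ.∣ x) → InCoset l pˢ (+ 1) x ⊎ InCoset l pˢ (+ 1) (ℤ.- x)
  unit-dichotomy₁ {x} φ≡2d p∤x = from-power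
    (primitiveRoot-generates prime k (≡.subst (HasOrder pˢ (ℤ.- (+ l))) (≡.sym φ≡2d) negation-order) p∤x)
    where
    from-power : (∃ λ r → x ≅ (ℤ.- (+ l)) ℤ.^ r mod pˢ) → InCoset l pˢ (+ 1) x ⊎ InCoset l pˢ (+ 1) (ℤ.- x)
    from-power (r , x≅) = Sum.map (inCoset-resp-≅ (≅-sym x≅)) (inCoset-resp-≅ (neg-≅ (≅-sym x≅))) (power-dichotomy r)

φ-difference : ∀ {p} → Prime p → ∀ {i k} → i ≤ k → φ (p ^ (suc k ∸ i)) + p ^ (k ∸ i) ≡ p ^ (suc k ∸ i)
φ-difference {p} pr {i} {k} i≤k = ≡.subst (λ e → φ (p ^ e) + p ^ (k ∸ i) ≡ p ^ e)
  (≡.sym (ℕ.+-∸-assoc 1 i≤k)) (φ+p^k≡p^[1+k] pr (k ∸ i))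

-- The modulus is a variable with an equation, so that the results apply to `p ^ s` itself, where
-- `s` is not syntactically a successor. For the same reason the dichotomy, proved for `p ^ suc k`,
-- is received as a parameter already transported.
module Index2 {p} (prime : Prime p) (odd-p : Odd p) {d} (odd-d : Odd d) {N} .{{_ : NonZero N}} (k l : ℕ)
              (N≡p^[1+k] : N ≡ p ^ suc k) (order-l : HasOrder N (+ l) d)
              (unit-dichotomy₁ : ∀ {x} → ¬ (+ p ℤ.∣ x) → InCoset l N (+ 1) x ⊎ InCoset l N (+ 1) (ℤ.- x))
              where
  private
    order-l′ : HasOrder (p ^ suc k) (+ l) d
    order-l′ = ≡.subst (λ N → HasOrder N (+ l) d) N≡p^[1+k] order-l
  open OddOrder prime odd-p odd-d k l order-l′ using (inCoset-¬neg)
  private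
    L : ℕ → ℤ
    L r = (+ l) ℤ.^ r
    instance
      p≢0 : NonZero p
      p≢0 = ℕ.prime⇒nonZero prime
    ^-∣-N : ∀ {i} → i ≤ suc k → p ^ i ∣ N
    ^-∣-N {i} i≤1+k = ≡.subst (p ^ i ∣_) (≡.sym N≡p^[1+k]) (^-∣-^ p i≤1+k)
    p∣N : p ∣ N
    p∣N = ≡.subst (p ∣_) (≡.sym N≡p^[1+k]) (ℕ.m∣m*n (p ^ k))
    p∤l : ¬ (+ p ℤ.∣ + l)
    p∤l = hasOrder⇒∤ prime k order-l′

  inCoset-via1 : InCoset l N (+ 1) u → InCoset l N (+ 1) x → InCoset l N u x
  inCoset-via1 u∈ x∈ = inCoset-trans x∈ (inCoset-sym order-l u∈)

  inCoset-via-1 : InCoset l N (+ 1) (ℤ.- u) → InCoset l N (+ 1) (ℤ.- x) → InCoset l N u x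
  inCoset-via-1 {u} {x} u∈ x∈ = ≡.subst₂ (InCoset l N) (ℤ.neg-involutive u) (ℤ.neg-involutive x)
    (inCoset-neg (inCoset-via1 u∈ x∈))

  unit-dichotomy : ¬ (+ p ℤ.∣ u) → ¬ (+ p ℤ.∣ x) → InCoset l N u x ⊎ InCoset l N u (ℤ.- x)
  unit-dichotomy {u} {x} p∤u p∤x with unit-dichotomy₁ p∤u | unit-dichotomy₁ p∤x
  ... | inj₁ u∈  | inj₁ x∈  = inj₁ (inCoset-via1 u∈ x∈)
  ... | inj₁ u∈  | inj₂ -x∈ = inj₂ (inCoset-via1 u∈ -x∈)
  ... | inj₂ -u∈ | inj₁ x∈  = inj₂ (inCoset-via-1 -u∈ (≡.subst (InCoset l N (+ 1)) (≡.sym (ℤ.neg-involutive x)) x∈))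
  ... | inj₂ -u∈ | inj₂ -x∈ = inj₁ (inCoset-via-1 -u∈ -x∈)

  ∤-coset : ¬ (+ p ℤ.∣ u) → InCoset l p u x → ¬ (+ p ℤ.∣ x)
  ∤-coset p∤u (inCoset r x≅) p∣x = ∤-* prime p∤u (∤-^ prime r p∤l) (∣-resp-≅ x≅ p∣x)

  -- By the dichotomy modulo `N`, either x or -x is in the coset. The second would descend to p,
  -- where x is in the coset already, and `inCoset-¬neg` forbids both.
  inCoset-lift : ¬ (+ p ℤ.∣ u) → InCoset l p u x → InCoset l N u x
  inCoset-lift p∤u x∈ = Sum.[ id , (λ -x∈′ → contradiction (inCoset-∣ p∣N -x∈′) (inCoset-¬neg p∤u x∈)) ]
    (unit-dichotomy p∤u (∤-coset p∤u x∈))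

  module _ {i} (i≤k : i ≤ k) {u} (p∤u : ¬ (+ p ℤ.∣ u)) where
    private
      pⁱ : ℤ
      pⁱ = + (p ^ i)
      instance
        pⁱ≢0 : NonZero (p ^ i)
        pⁱ≢0 = ℕ.m^n≢0 p i

    -- Since i ≤ k, p^(i+1) divides `N`, and cancelling p^i from that modulus leaves p. Nothing
    -- essential is lost, because `inCoset-lift` recovers the coset modulo `N` from the one modulo
    -- p.
    scaledCoset⇒ : InCoset l N (pⁱ ℤ.* u) x → ∃ λ y → x ≡ pⁱ ℤ.* y × InCoset l p u y
    scaledCoset⇒ {x} (inCoset r x≅) = y₀ , x≡ , inCoset r (≅-*-cancelˡ (p ^ i) pⁱy≅)
      where
      pⁱ∣x : pⁱ ℤ.∣ x
      pⁱ∣x = ∣-resp-≅ (≅-∣ (^-∣-N (ℕ.m≤n⇒m≤1+n i≤k)) (≅-sym x≅)) (ℤ.∣m⇒∣m*n (L r) (multiple⇒∣-^ p i u))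
      y₀ : ℤ
      y₀ = proj₁ (∣-^⇒multiple p i pⁱ∣x)
      x≡ : x ≡ pⁱ ℤ.* y₀
      x≡ = proj₂ (∣-^⇒multiple p i pⁱ∣x)
      p^i*p∣N : p ^ i * p ∣ N
      p^i*p∣N = ≡.subst (_∣ N) (ℕ.*-comm p (p ^ i)) (^-∣-N (s≤s i≤k))
      pⁱy≅ : pⁱ ℤ.* y₀ ≅ pⁱ ℤ.* (u ℤ.* L r) mod p ^ i * p
      pⁱy≅ = ≅-trans (≅-reflexive (≡.sym x≡)) (≅-trans (≅-∣ p^i*p∣N x≅) (≅-reflexive (ℤ.*-assoc pⁱ u (L r))))

    scaledCoset⇐ : InCoset l p u y → InCoset l N (pⁱ ℤ.* u) (pⁱ ℤ.* y)
    scaledCoset⇐ y∈ = inCoset-*ˡ pⁱ (inCoset-lift p∤u y∈)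

    -- Writing x = p^i y and b = c p^(i+1), the sum is p^i (y + c p), and y + c p has the class of y
    -- modulo p.
    scaledCoset-+ : ∀ b → + (p ^ suc i) ℤ.∣ b → InCoset l N (pⁱ ℤ.* u) x → InCoset l N (pⁱ ℤ.* u) (x ℤ.+ b)
    scaledCoset-+ {x} b (divides c b≡) x∈ = from (scaledCoset⇒ x∈)
      where
      open ≡.≡-Reasoning
      from : (∃ λ y → x ≡ pⁱ ℤ.* y × InCoset l p u y) → InCoset l N (pⁱ ℤ.* u) (x ℤ.+ b)
      from (y , x≡ , y∈) = ≡.subst (InCoset l N (pⁱ ℤ.* u)) eq
        (scaledCoset⇐ (inCoset-resp-≅ (≅-sym (≅-byMultiple {y = y} c refl)) y∈))
        where
        identity : ∀ q y c p → q ℤ.* (y ℤ.+ c ℤ.* p) ≡ q ℤ.* y ℤ.+ c ℤ.* (q ℤ.* p)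
        identity = solve-∀
        eq : pⁱ ℤ.* (y ℤ.+ c ℤ.* + p) ≡ x ℤ.+ b
        eq = begin
          pⁱ ℤ.* (y ℤ.+ c ℤ.* + p)           ≡⟨ identity pⁱ y c (+ p) ⟩
          pⁱ ℤ.* y ℤ.+ c ℤ.* (pⁱ ℤ.* + p)    ≡⟨ ≡.cong₂ (λ x z → x ℤ.+ c ℤ.* z) x≡ (p^[1+i]≡ p i) ⟨
          x ℤ.+ c ℤ.* + (p ^ suc i)          ≡⟨ ≡.cong (λ z → x ℤ.+ z) b≡ ⟨
          x ℤ.+ b                            ∎

    scaledCoset⇒exact : InCoset l N (pⁱ ℤ.* u) x → (pⁱ ℤ.∣ x) × ¬ (+ (p ^ suc i) ℤ.∣ x)
    scaledCoset⇒exact {x} x∈ = from (scaledCoset⇒ x∈)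
      where
      from : (∃ λ y → x ≡ pⁱ ℤ.* y × InCoset l p u y) → (pⁱ ℤ.∣ x) × ¬ (+ (p ^ suc i) ℤ.∣ x)
      from (y , x≡ , y∈) = ≡.subst (pⁱ ℤ.∣_) (≡.sym x≡) (multiple⇒∣-^ p i y) ,
        λ d → ∤-coset p∤u y∈ (∣-^-cancel p i (≡.subst (+ (p ^ suc i) ℤ.∣_) x≡ d))

    exact≡coset+neg : ∀ x → ⟦ exact? p i x ⟧ ≡ cosetIndicator l N (pⁱ ℤ.* u) x + cosetIndicator l N (pⁱ ℤ.* u) (ℤ.- x)
    exact≡coset+neg x = ⟦⟧-⊎ (exact? p i x) (inCoset? l N (pⁱ ℤ.* u) x) (inCoset? l N (pⁱ ℤ.* u) (ℤ.- x)) split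
      scaledCoset⇒exact neg-exact disjoint
      where
      split : (pⁱ ℤ.∣ x) × ¬ (+ (p ^ suc i) ℤ.∣ x) →
              InCoset l N (pⁱ ℤ.* u) x ⊎ InCoset l N (pⁱ ℤ.* u) (ℤ.- x)
      split (pⁱ∣x , pⁱ⁺¹∤x) = from (∣-^⇒multiple p i pⁱ∣x)
        where
        from : (∃ λ y → x ≡ pⁱ ℤ.* y) → InCoset l N (pⁱ ℤ.* u) x ⊎ InCoset l N (pⁱ ℤ.* u) (ℤ.- x)
        from (y , x≡) = Sum.map
          (λ y∈ → ≡.subst (InCoset l N (pⁱ ℤ.* u)) (≡.sym x≡) (inCoset-*ˡ pⁱ y∈))
          (λ -y∈ → ≡.subst (InCoset l N (pⁱ ℤ.* u)) (≡.trans (≡.sym (ℤ.neg-distribʳ-* pⁱ y)) (≡.cong ℤ.-_ (≡.sym x≡))) (inCoset-*ˡ pⁱ -y∈))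
          (unit-dichotomy p∤u λ p∣y → pⁱ⁺¹∤x (≡.subst₂ ℤ._∣_ (≡.sym (p^[1+i]≡ p i)) (≡.sym x≡) (ℤ.*-monoʳ-∣ pⁱ p∣y)))
      neg-exact : InCoset l N (pⁱ ℤ.* u) (ℤ.- x) → (pⁱ ℤ.∣ x) × ¬ (+ (p ^ suc i) ℤ.∣ x)
      neg-exact -x∈ = ≡.subst (pⁱ ℤ.∣_) (ℤ.neg-involutive x) (ℤ.∣m⇒∣-m (proj₁ (scaledCoset⇒exact -x∈))) ,
        λ d → proj₂ (scaledCoset⇒exact -x∈) (ℤ.∣m⇒∣-m d)
      disjoint : InCoset l N (pⁱ ℤ.* u) x → ¬ InCoset l N (pⁱ ℤ.* u) (ℤ.- x)
      disjoint x∈ -x∈ = from (scaledCoset⇒ x∈) (scaledCoset⇒ -x∈)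
        where
        from : (∃ λ y → x ≡ pⁱ ℤ.* y × InCoset l p u y) → ¬ (∃ λ y → ℤ.- x ≡ pⁱ ℤ.* y × InCoset l p u y)
        from (y , x≡ , y∈) (y′ , -x≡ , y′∈) = inCoset-¬neg p∤u y∈ (≡.subst (InCoset l p u) y′≡-y y′∈)
          where
          y′≡-y : y′ ≡ ℤ.- y
          y′≡-y = ℤ.*-cancelˡ-≡ pⁱ y′ (ℤ.- y)
            (≡.trans (≡.sym -x≡) (≡.trans (≡.cong ℤ.-_ x≡) (ℤ.neg-distribʳ-* pⁱ y)))

    -- The coset and its negative partition the exact multiples of p^i and are equally large, so the
    -- division by 2 is exact. The power p^(k-i) in the count comes from the multiples of p^(i+1).
    sumᵣ-scaledCoset : sumᵣ N (λ x → cosetIndicator l N (pⁱ ℤ.* u) x) ≡ φ (p ^ (suc k ∸ i)) / 2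
    sumᵣ-scaledCoset = half S*2≡φ
      where
      half : ∀ {a b} → a * 2 ≡ b → a ≡ b / 2
      half {a} a*2≡b = ≡.trans (≡.sym (ℕ.m*n/n≡m a 2)) (≡.cong (_/ 2) a*2≡b)
      exact-count : sumᵣ N (λ x → ⟦ exact? p i x ⟧) + p ^ (k ∸ i) ≡ p ^ (suc k ∸ i)
      exact-count = ≡.subst (λ N → sumᵣ N (λ x → ⟦ exact? p i x ⟧) + p ^ (k ∸ i) ≡ p ^ (suc k ∸ i))
        (≡.sym N≡p^[1+k]) (sumᵣ-exact p (s≤s i≤k))
      S*2≡φ : sumᵣ N (λ x → cosetIndicator l N (pⁱ ℤ.* u) x) * 2 ≡ φ (p ^ (suc k ∸ i))
      S*2≡φ = ≡.trans (≡.sym (sumᵣ-symmetrize N (inCoset?-periodic (pⁱ ℤ.* u)) exact≡coset+neg))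
        (ℕ.+-cancelʳ-≡ (p ^ (k ∸ i)) _ _ (≡.trans exact-count (≡.sym (φ-difference prime i≤k))))

  -- An element of the deeper coset p^i′ v ⟨l⟩ is divisible by p^(i+1).
  module _ {i i′} (i<i′ : i < i′) (i′≤k : i′ ≤ k) {u v} (p∤u : ¬ (+ p ℤ.∣ u)) (p∤v : ¬ (+ p ℤ.∣ v)) where
    private
      i≤k : i ≤ k
      i≤k = ℕ.<⇒≤ (ℕ.<-≤-trans i<i′ i′≤k)

    deeper-∣ : InCoset l N (+ (p ^ i′) ℤ.* v) x → + (p ^ suc i) ℤ.∣ x
    deeper-∣ x∈ = ℤ.∣-trans (∣-cast (^-∣-^ p i<i′)) (proj₁ (scaledCoset⇒exact i′≤k p∤v x∈))

    deeper-absorb : ∀ c b → InCoset l N (+ (p ^ i′) ℤ.* v) b →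
                    InCoset l N (+ (p ^ i) ℤ.* u) (c ℤ.- b) → InCoset l N (+ (p ^ i) ℤ.* u) c
    deeper-absorb c b b∈ c-b∈ = ≡.subst (InCoset l N (+ (p ^ i) ℤ.* u)) (i-j+j≡i c b)
      (scaledCoset-+ i≤k p∤u b (deeper-∣ b∈) c-b∈)

    deeper-absorb⁻¹ : ∀ c b → InCoset l N (+ (p ^ i′) ℤ.* v) b →
                      InCoset l N (+ (p ^ i) ℤ.* u) c → InCoset l N (+ (p ^ i) ℤ.* u) (c ℤ.- b)
    deeper-absorb⁻¹ c b b∈ c∈ = scaledCoset-+ i≤k p∤u (ℤ.- b) (ℤ.∣m⇒∣-m (deeper-∣ b∈)) c∈

    sumᵣ-cosets : ∀ c →
      sumᵣ N (λ b → cosetIndicator l N (+ (p ^ i′) ℤ.* v) b * cosetIndicator l N (+ (p ^ i) ℤ.* u) (c ℤ.- b))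
      ≡ φ (p ^ (suc k ∸ i′)) / 2 * cosetIndicator l N (+ (p ^ i) ℤ.* u) c
    sumᵣ-cosets c = sumᵣ-inCoset-absorb l N (+ (p ^ i) ℤ.* u) (+ (p ^ i′) ℤ.* v) c
      (λ {b} → deeper-absorb c b) (λ {b} → deeper-absorb⁻¹ c b)
      {φ (p ^ (suc k ∸ i′)) / 2} (sumᵣ-scaledCoset {i′} i′≤k {v} p∤v)

  convolution-scaledCosets : ∀ {i i′ u v γ δ D} → i < i′ → i′ ≤ k → ¬ (+ p ℤ.∣ u) → ¬ (+ p ℤ.∣ v) →
    γ ≡ + (p ^ i) ℤ.* u → δ ≡ + (p ^ i′) ℤ.* v → φ (p ^ (suc k ∸ i′)) / 2 ≡ D →
    ∀ c → convolution l N γ δ c ≡ D * cosetIndicator l N γ c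
  convolution-scaledCosets {i} {i′} {u} {v} i<i′ i′≤k p∤u p∤v refl refl refl =
    sumᵣ-cosets {i} {i′} i<i′ i′≤k {u} {v} p∤u p∤v

-- The prime q: l is a primitive root modulo q^t

∣-reflect : ∀ {b c} → + m ℤ.∣ c → + m ℤ.∣ c ℤ.- b → + m ℤ.∣ b
∣-reflect {m} {b} {c} m∣c m∣c-b = ≡.subst (+ m ℤ.∣_) (identity b c) (ℤ.∣m∣n⇒∣m-n m∣c m∣c-b)
  where
  identity : ∀ b c → c ℤ.- (c ℤ.- b) ≡ b
  identity = solve-∀

∣-unreflect : ∀ {b c} → + m ℤ.∣ b → + m ℤ.∣ c ℤ.- b → + m ℤ.∣ c
∣-unreflect {m} {b} {c} m∣b m∣c-b = ≡.subst (+ m ℤ.∣_) (i-j+j≡i c b) (ℤ.∣m∣n⇒∣m+n m∣c-b m∣b)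

module ExactSum (q : ℕ) .{{_ : NonZero q}} (j : ℕ) where
  private
    Exact : ℤ → Set
    Exact x = (+ (q ^ j) ℤ.∣ x) × ¬ (+ (q ^ suc j) ℤ.∣ x)

  exact-sum-none : ∀ c → ¬ (+ (q ^ j) ℤ.∣ c) → ∀ b → ⟦ exact? q j b ⟧ * ⟦ exact? q j (c ℤ.- b) ⟧ ≡ 0
  exact-sum-none c qʲ∤c b = ≡.trans (≡.sym (⟦⟧-× (exact? q j b) (exact? q j (c ℤ.- b))))
    (⟦⟧-no (exact? q j b ×-dec exact? q j (c ℤ.- b)) λ ((qʲ∣b , _) , (qʲ∣c-b , _)) → qʲ∤c (∣-unreflect qʲ∣b qʲ∣c-b))

  exact-sum-all : ∀ c → + (q ^ suc j) ℤ.∣ c → ∀ b → ⟦ exact? q j b ⟧ * ⟦ exact? q j (c ℤ.- b) ⟧ ≡ ⟦ exact? q j b ⟧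
  exact-sum-all c qʲ⁺¹∣c b = ≡.trans (≡.sym (⟦⟧-× (exact? q j b) (exact? q j (c ℤ.- b))))
    (⟦⟧-cong (exact? q j b ×-dec exact? q j (c ℤ.- b)) (exact? q j b) proj₁
      λ (qʲ∣b , qʲ⁺¹∤b) → (qʲ∣b , qʲ⁺¹∤b) ,
        (ℤ.∣m∣n⇒∣m-n (∣-^-pred q j qʲ⁺¹∣c) qʲ∣b , λ qʲ⁺¹∣c-b → qʲ⁺¹∤b (∣-reflect qʲ⁺¹∣c qʲ⁺¹∣c-b)))

  -- Inclusion-exclusion among the multiples b of q^j: either b and c - b are both exact, or one of
  -- them is divisible by q^(j+1). They cannot both be so divisible, since q^(j+1) would then divide
  -- c; hence no correction term.
  exact-sum-exact : ∀ c → Exact c → ∀ b →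
    ⟦ + (q ^ j) ℤ.∣? b ⟧ ≡
    ⟦ exact? q j b ⟧ * ⟦ exact? q j (c ℤ.- b) ⟧ + (⟦ + (q ^ suc j) ℤ.∣? b ⟧ + ⟦ + (q ^ suc j) ℤ.∣? (c ℤ.- b) ⟧)
  exact-sum-exact c (qʲ∣c , qʲ⁺¹∤c) b = ≡.trans
    (⟦⟧-⊎ (+ (q ^ j) ℤ.∣? b) both? either? (λ qʲ∣b → split qʲ∣b F? F′?)
      (proj₁ ∘ proj₁) (Sum.[ ∣-^-pred q j , (λ d → ∣-reflect qʲ∣c (∣-^-pred q j d)) ])
      (λ ((_ , ¬d) , (_ , ¬d′)) → Sum.[ ¬d , ¬d′ ]))
    (≡.cong₂ _+_ (⟦⟧-× (exact? q j b) (exact? q j (c ℤ.- b)))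
      (⟦⟧-⊎ either? F? F′? id inj₁ inj₂ (λ d d′ → qʲ⁺¹∤c (∣-unreflect d d′))))
    where
    F? : Dec (+ (q ^ suc j) ℤ.∣ b)
    F? = + (q ^ suc j) ℤ.∣? b
    F′? : Dec (+ (q ^ suc j) ℤ.∣ c ℤ.- b)
    F′? = + (q ^ suc j) ℤ.∣? (c ℤ.- b)
    both? : Dec (Exact b × Exact (c ℤ.- b))
    both? = exact? q j b ×-dec exact? q j (c ℤ.- b)
    either? : Dec ((+ (q ^ suc j) ℤ.∣ b) ⊎ (+ (q ^ suc j) ℤ.∣ c ℤ.- b))
    either? = F? ⊎-dec F′?
    split : + (q ^ j) ℤ.∣ b → Dec (+ (q ^ suc j) ℤ.∣ b) → Dec (+ (q ^ suc j) ℤ.∣ c ℤ.- b) →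
            (Exact b × Exact (c ℤ.- b)) ⊎ ((+ (q ^ suc j) ℤ.∣ b) ⊎ (+ (q ^ suc j) ℤ.∣ c ℤ.- b))
    split qʲ∣b (yes d) _        = inj₂ (inj₁ d)
    split qʲ∣b (no _)  (yes d′) = inj₂ (inj₂ d′)
    split qʲ∣b (no ¬d) (no ¬d′) = inj₁ ((qʲ∣b , ¬d) , (ℤ.∣m∣n⇒∣m-n qʲ∣c qʲ∣b , ¬d′))

  private
    conv : ℕ → ℤ → ℕ
    conv t c = sumᵣ (q ^ t) (λ b → ⟦ exact? q j b ⟧ * ⟦ exact? q j (c ℤ.- b) ⟧)

  sumᵣ-exact-exact : ∀ {t} → j < t → ∀ c → Exact c → conv t c + (q ^ (t ∸ suc j) + q ^ (t ∸ suc j)) ≡ q ^ (t ∸ j)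
  sumᵣ-exact-exact {t} j<t c c-exact = begin
    conv t c + (q ^ (t ∸ suc j) + q ^ (t ∸ suc j))
      ≡⟨ ≡.cong₂ (λ x y → conv t c + (x + y)) (sumᵣ-∣-^ q j<t) reflected ⟨
    conv t c + (sumᵣ (q ^ t) F + sumᵣ (q ^ t) (λ b → F (c ℤ.- b)))
      ≡⟨ ≡.cong (_+_ (conv t c)) (∑-distrib-+ {q ^ t} (λ b → F (+ toℕ b)) (λ b → F (c ℤ.- + toℕ b))) ⟨
    conv t c + sumᵣ (q ^ t) (λ b → F b + F (c ℤ.- b))
      ≡⟨ ∑-distrib-+ {q ^ t} (λ b → ⟦ exact? q j (+ toℕ b) ⟧ * ⟦ exact? q j (c ℤ.- + toℕ b) ⟧) (λ b → F (+ toℕ b) + F (c ℤ.- + toℕ b)) ⟨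
    sumᵣ (q ^ t) (λ b → ⟦ exact? q j b ⟧ * ⟦ exact? q j (c ℤ.- b) ⟧ + (F b + F (c ℤ.- b)))
      ≡⟨ sumᵣ-cong (q ^ t) (λ b → ≡.sym (exact-sum-exact c c-exact b)) ⟩
    sumᵣ (q ^ t) (λ b → ⟦ + (q ^ j) ℤ.∣? b ⟧)
      ≡⟨ sumᵣ-∣-^ q (ℕ.<⇒≤ j<t) ⟩
    q ^ (t ∸ j) ∎
    where
    open ≡.≡-Reasoning
    F : ℤ → ℕ
    F b = ⟦ + (q ^ suc j) ℤ.∣? b ⟧
    reflected : sumᵣ (q ^ t) (λ b → F (c ℤ.- b)) ≡ q ^ (t ∸ suc j)
    reflected = ≡.trans (≡.sym (sumᵣ-reflect (q ^ t) {{ℕ.m^n≢0 q t}} c (∣?-periodic (q ^ suc j) (^-∣-^ q j<t))))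
      (sumᵣ-∣-^ q j<t)

-- The origin of the coefficient q - 2: with z = q^(t-j-1), there are q z multiples of q^j, from
-- which two disjoint families of size z drop out.
∸2-* : ∀ {q x z} → 2 ≤ q → x + (z + z) ≡ q * z → x ≡ (q ∸ 2) * z
∸2-* {q} {x} {z} 2≤q eq = ℕ.+-cancelʳ-≡ (z + z) x ((q ∸ 2) * z) (begin
  x + (z + z)                    ≡⟨ eq ⟩
  q * z                          ≡⟨ ≡.cong (_* z) (ℕ.m∸n+n≡m 2≤q) ⟨
  (q ∸ 2 + 2) * z                ≡⟨ ℕ.*-distribʳ-+ z (q ∸ 2) 2 ⟩
  (q ∸ 2) * z + 2 * z            ≡⟨ ≡.cong (λ w → (q ∸ 2) * z + (z + w)) (ℕ.+-identityʳ z) ⟩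
  (q ∸ 2) * z + (z + z)          ∎)
  where open ≡.≡-Reasoning

-- When q^(j+1) divides c, exactness passes from b to c - b, so every exact b counts and φ appears.
-- When c is itself exact, inclusion-exclusion gives the other coefficient; when q^j does not divide
-- c, no b fits.
sumᵣ-exact-convolution : ∀ {q} → Prime q → ∀ {j k} → j ≤ k → ∀ c →
  sumᵣ (q ^ suc k) (λ b → ⟦ exact? q j b ⟧ * ⟦ exact? q j (c ℤ.- b) ⟧)
  ≡ (q ∸ 2) * q ^ (k ∸ j) * ⟦ exact? q j c ⟧ + φ (q ^ (suc k ∸ j)) * ⟦ + (q ^ suc j) ℤ.∣? c ⟧
sumᵣ-exact-convolution {q} q-prime {j} {k} j≤k c = cases (+ (q ^ j) ℤ.∣? c) (+ (q ^ suc j) ℤ.∣? c)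
  where
  instance
    q≢0 : NonZero q
    q≢0 = ℕ.prime⇒nonZero q-prime
  open ExactSum q j
  open ≡.≡-Reasoning
  conv K₁ K₂ : ℕ
  conv = sumᵣ (q ^ suc k) (λ b → ⟦ exact? q j b ⟧ * ⟦ exact? q j (c ℤ.- b) ⟧)
  K₁ = (q ∸ 2) * q ^ (k ∸ j)
  K₂ = φ (q ^ (suc k ∸ j))
  indicators : ∀ {e f : ℕ} → ⟦ exact? q j c ⟧ ≡ e → ⟦ + (q ^ suc j) ℤ.∣? c ⟧ ≡ f →
               ∀ {S} → S ≡ K₁ * e + K₂ * f → S ≡ K₁ * ⟦ exact? q j c ⟧ + K₂ * ⟦ + (q ^ suc j) ℤ.∣? c ⟧
  indicators refl refl eq = eq
  cases : Dec (+ (q ^ j) ℤ.∣ c) → Dec (+ (q ^ suc j) ℤ.∣ c) → conv ≡ K₁ * ⟦ exact? q j c ⟧ + K₂ * ⟦ + (q ^ suc j) ℤ.∣? c ⟧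
  cases (no qʲ∤c) _ = indicators {0} {0} (⟦⟧-no (exact? q j c) (qʲ∤c ∘ proj₁))
    (⟦⟧-no (+ (q ^ suc j) ℤ.∣? c) (qʲ∤c ∘ ∣-^-pred q j)) (begin
    conv             ≡⟨ sum-zero {q ^ suc k} (λ b → exact-sum-none c qʲ∤c (+ toℕ b)) ⟩
    0                ≡⟨ ≡.cong₂ _+_ (ℕ.*-zeroʳ K₁) (ℕ.*-zeroʳ K₂) ⟨
    K₁ * 0 + K₂ * 0    ∎)
  cases (yes _) (yes qʲ⁺¹∣c) = indicators {0} {1} (⟦⟧-no (exact? q j c) (λ e → proj₂ e qʲ⁺¹∣c))
    (⟦⟧-yes (+ (q ^ suc j) ℤ.∣? c) qʲ⁺¹∣c) (begin
    conv                                             ≡⟨ sumᵣ-cong (q ^ suc k) (exact-sum-all c qʲ⁺¹∣c) ⟩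
    sumᵣ (q ^ suc k) (λ b → ⟦ exact? q j b ⟧)        ≡⟨ ℕ.+-cancelʳ-≡ (q ^ (k ∸ j)) _ K₂ (≡.trans (sumᵣ-exact q (s≤s j≤k)) (≡.sym (φ-difference q-prime j≤k))) ⟩
    K₂                                                ≡⟨ ℕ.*-identityʳ K₂ ⟨
    K₂ * 1                                            ≡⟨ ≡.cong (_+ K₂ * 1) (ℕ.*-zeroʳ K₁) ⟨
    K₁ * 0 + K₂ * 1                                    ∎)
  cases (yes qʲ∣c) (no qʲ⁺¹∤c) = indicators {1} {0} (⟦⟧-yes (exact? q j c) (qʲ∣c , qʲ⁺¹∤c))
    (⟦⟧-no (+ (q ^ suc j) ℤ.∣? c) qʲ⁺¹∤c) (begin
    conv             ≡⟨ ∸2-* (1<p q-prime) (≡.trans (sumᵣ-exact-exact (s≤s j≤k) c (qʲ∣c , qʲ⁺¹∤c)) (≡.cong (q ^_) (ℕ.+-∸-assoc 1 j≤k))) ⟩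
    K₁                ≡⟨ ℕ.*-identityʳ K₁ ⟨
    K₁ * 1            ≡⟨ ℕ.+-identityʳ (K₁ * 1) ⟨
    K₁ * 1 + 0        ≡⟨ ≡.cong (_+_ (K₁ * 1)) (ℕ.*-zeroʳ K₂) ⟨
    K₁ * 1 + K₂ * 0    ∎)

-- Sums over the range j < m ≤ t

range-empty : ∀ j → ⦅ j , j ⟧ ≡ []
range-empty j = List.filter-none (j ℕ.<?_) (All.applyUpTo⁺₁ id (suc j) (ℕ.≤⇒≯ ∘ ℕ.s≤s⁻¹))

range-suc : ∀ {j e} → j < suc e → ⦅ j , suc e ⟧ ≡ ⦅ j , e ⟧ List.++ List.[ suc e ]
range-suc {j} {e} j<1+e = begin
  ⦅ j , suc e ⟧
    ≡⟨ ≡.cong (List.filter (j ℕ.<?_)) (List.upTo-∷ʳ (suc e)) ⟨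
  List.filter (j ℕ.<?_) (List.upTo (suc e) List.∷ʳ suc e)
    ≡⟨ List.filter-++ (j ℕ.<?_) (List.upTo (suc e)) List.[ suc e ] ⟩
  ⦅ j , e ⟧ List.++ List.filter (j ℕ.<?_) List.[ suc e ]
    ≡⟨ ≡.cong (⦅ j , e ⟧ List.++_) (List.filter-accept (j ℕ.<?_) j<1+e) ⟩
  ⦅ j , e ⟧ List.++ List.[ suc e ] ∎
  where open ≡.≡-Reasoning

sum-range-suc : ∀ (f : ℕ → ℕ) {j e} → j < suc e →
                ListAction.sum (List.map f ⦅ j , suc e ⟧) ≡ ListAction.sum (List.map f ⦅ j , e ⟧) + f (suc e)
sum-range-suc f {j} {e} j<1+e = begin
  ListAction.sum (List.map f ⦅ j , suc e ⟧)
    ≡⟨ ≡.cong (ListAction.sum ∘ List.map f) (range-suc j<1+e) ⟩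
  ListAction.sum (List.map f (⦅ j , e ⟧ List.++ List.[ suc e ]))
    ≡⟨ ≡.cong ListAction.sum (List.map-++ f ⦅ j , e ⟧ List.[ suc e ]) ⟩
  ListAction.sum (List.map f ⦅ j , e ⟧ List.++ List.[ f (suc e) ])
    ≡⟨ ListAction.sum-++ (List.map f ⦅ j , e ⟧) List.[ f (suc e) ] ⟩
  ListAction.sum (List.map f ⦅ j , e ⟧) + (f (suc e) + 0)
    ≡⟨ ≡.cong (_+_ (ListAction.sum (List.map f ⦅ j , e ⟧))) (ℕ.+-identityʳ (f (suc e))) ⟩
  ListAction.sum (List.map f ⦅ j , e ⟧) + f (suc e) ∎
  where open ≡.≡-Reasoning

module Primitive {q} (prime : Prime q) {N} .{{_ : NonZero N}} (k l : ℕ)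
                 (N≡q^[1+k] : N ≡ q ^ suc k) (root : PrimitiveRoot N (+ l)) where
  private
    instance
      q≢0 : NonZero q
      q≢0 = ℕ.prime⇒nonZero prime
    root′ : PrimitiveRoot (q ^ suc k) (+ l)
    root′ = ≡.subst (λ N → PrimitiveRoot N (+ l)) N≡q^[1+k] root
    ^-∣-N : ∀ {j} → j ≤ suc k → q ^ j ∣ N
    ^-∣-N {j} j≤1+k = ≡.subst (q ^ j ∣_) (≡.sym N≡q^[1+k]) (^-∣-^ q j≤1+k)
    q∤l : ¬ (+ q ℤ.∣ + l)
    q∤l = hasOrder⇒∤ prime k root′

  unit-inCoset1 : ¬ (+ q ℤ.∣ x) → InCoset l N (+ 1) x
  unit-inCoset1 {x} q∤x = inCoset r (≅-trans x≅ (≅-reflexive (≡.sym (ℤ.*-identityˡ _))))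
    where
    power : ∃ λ r → x ≅ (+ l) ℤ.^ r mod q ^ suc k
    power = primitiveRoot-generates prime k root′ q∤x
    r : ℕ
    r = proj₁ power
    x≅ : x ≅ (+ l) ℤ.^ r mod N
    x≅ = ≡.subst (x ≅ (+ l) ℤ.^ r mod_) (≡.sym N≡q^[1+k]) (proj₂ power)

  -- All units are powers of l, hence form a single coset. This is why neither g nor a power of p
  -- affects a coset modulo q^t.
  unit-inCoset : ¬ (+ q ℤ.∣ u) → ¬ (+ q ℤ.∣ x) → InCoset l N u x
  unit-inCoset q∤u q∤x = inCoset-trans (unit-inCoset1 q∤x) (inCoset-sym root (unit-inCoset1 q∤u))

  scaledCoset⇒∣ : ∀ {j} → j ≤ suc k → InCoset l N (+ (q ^ j) ℤ.* u) x → + (q ^ j) ℤ.∣ x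
  scaledCoset⇒∣ {u = u} {j = j} j≤1+k (inCoset r x≅) =
    ∣-resp-≅ (≅-∣ (^-∣-N j≤1+k) (≅-sym x≅)) (ℤ.∣m⇒∣m*n ((+ l) ℤ.^ r) (multiple⇒∣-^ q j u))

  scaledCoset⇔exact : ∀ {j} → j ≤ k → ¬ (+ q ℤ.∣ u) → ∀ x → cosetIndicator l N (+ (q ^ j) ℤ.* u) x ≡ ⟦ exact? q j x ⟧
  scaledCoset⇔exact {u} {j} j≤k q∤u x = ⟦⟧-cong (inCoset? l N (+ (q ^ j) ℤ.* u) x) (exact? q j x)
    (λ x∈ → scaledCoset⇒∣ (ℕ.m≤n⇒m≤1+n j≤k) x∈ , next∤ x∈)
    (λ (qʲ∣x , qʲ⁺¹∤x) → from qʲ⁺¹∤x (∣-^⇒multiple q j qʲ∣x))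
    where
    next∤ : InCoset l N (+ (q ^ j) ℤ.* u) x → ¬ (+ (q ^ suc j) ℤ.∣ x)
    next∤ (inCoset r x≅) qʲ⁺¹∣x = ∤-* prime q∤u (∤-^ prime r q∤l) (∣-^-cancel q j
      (≡.subst (+ (q ^ suc j) ℤ.∣_) (ℤ.*-assoc (+ (q ^ j)) u ((+ l) ℤ.^ r)) (∣-resp-≅ (≅-∣ (^-∣-N (s≤s j≤k)) x≅) qʲ⁺¹∣x)))
    from : ¬ (+ (q ^ suc j) ℤ.∣ x) → (∃ λ y → x ≡ + (q ^ j) ℤ.* y) → InCoset l N (+ (q ^ j) ℤ.* u) x
    from qʲ⁺¹∤x (y , x≡) = ≡.subst (InCoset l N (+ (q ^ j) ℤ.* u)) (≡.sym x≡) (inCoset-*ˡ (+ (q ^ j))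
      (unit-inCoset q∤u λ q∣y → qʲ⁺¹∤x (≡.subst₂ ℤ._∣_ (≡.sym (p^[1+i]≡ q j)) (≡.sym x≡) (ℤ.*-monoʳ-∣ (+ (q ^ j)) q∣y))))

  -- The boundary case m = t: here the power of q is the modulus itself and the coset is the class
  -- of 0, so exactness gives way to plain divisibility.
  scaledCoset⇔∣ : ∀ u x → cosetIndicator l N (+ (q ^ suc k) ℤ.* u) x ≡ ⟦ + (q ^ suc k) ℤ.∣? x ⟧
  scaledCoset⇔∣ u x = ⟦⟧-cong (inCoset? l N (+ (q ^ suc k) ℤ.* u) x) (+ (q ^ suc k) ℤ.∣? x)
    (scaledCoset⇒∣ {u = u} {x = x} ℕ.≤-refl) (λ q^[1+k]∣x → inCoset 0 (x≅ q^[1+k]∣x))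
    where
    zero≅ : ∀ y → + (q ^ suc k) ℤ.∣ y → y ≅ + 0 mod N
    zero≅ y d = ≡.subst (y ≅ + 0 mod_) (≡.sym N≡q^[1+k]) (∣⇒≅0 d)
    x≅ : + (q ^ suc k) ℤ.∣ x → x ≅ + (q ^ suc k) ℤ.* u ℤ.* + 1 mod N
    x≅ q^[1+k]∣x = begin
      x                                ≈⟨ zero≅ x q^[1+k]∣x ⟩
      + 0                              ≈⟨ zero≅ (+ (q ^ suc k) ℤ.* u) (multiple⇒∣-^ q (suc k) u) ⟨
      + (q ^ suc k) ℤ.* u              ≡⟨ ℤ.*-identityʳ (+ (q ^ suc k) ℤ.* u) ⟨
      + (q ^ suc k) ℤ.* u ℤ.* + 1      ∎
      where open ≅-Reasoning N

  sumᵣ-scaledCosets : ∀ {j u v} → j ≤ k → ¬ (+ q ℤ.∣ u) → ¬ (+ q ℤ.∣ v) → ∀ c →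
    sumᵣ N (λ b → cosetIndicator l N (+ (q ^ j) ℤ.* v) b * cosetIndicator l N (+ (q ^ j) ℤ.* u) (c ℤ.- b))
    ≡ (q ∸ 2) * q ^ (k ∸ j) * cosetIndicator l N (+ (q ^ j) ℤ.* u) c + φ (q ^ (suc k ∸ j)) * ⟦ + (q ^ suc j) ℤ.∣? c ⟧
  sumᵣ-scaledCosets {j} {u} {v} j≤k q∤u q∤v c = replace
    (≡.sym (scaledCoset⇔exact j≤k q∤u c)) to-exact
    (≡.subst (λ N → sumᵣ N exact-terms ≡ K₁ * ⟦ exact? q j c ⟧ + K₂ * F) (≡.sym N≡q^[1+k])
      (sumᵣ-exact-convolution prime j≤k c))
    where
    K₁ K₂ F : ℕ
    K₁ = (q ∸ 2) * q ^ (k ∸ j)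
    K₂ = φ (q ^ (suc k ∸ j))
    F = ⟦ + (q ^ suc j) ℤ.∣? c ⟧
    coset-terms exact-terms : ℤ → ℕ
    coset-terms b = cosetIndicator l N (+ (q ^ j) ℤ.* v) b * cosetIndicator l N (+ (q ^ j) ℤ.* u) (c ℤ.- b)
    exact-terms b = ⟦ exact? q j b ⟧ * ⟦ exact? q j (c ℤ.- b) ⟧
    to-exact : sumᵣ N coset-terms ≡ sumᵣ N exact-terms
    to-exact = sumᵣ-cong N {coset-terms} {exact-terms} λ b →
      ≡.cong₂ _*_ (scaledCoset⇔exact j≤k q∤v b) (scaledCoset⇔exact j≤k q∤u (c ℤ.- b))
    replace : ∀ {e e′ S S′ : ℕ} → e ≡ e′ → S ≡ S′ → S′ ≡ K₁ * e + K₂ * F → S ≡ K₁ * e′ + K₂ * F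
    replace refl refl eq = eq

  -- The multiples of q^(j+1) are sorted by their exact power of q, with the class of 0 as the term
  -- m = k + 1. That term is split off first and the others telescope into it. The unit `u m` may
  -- vary with m, which later allows g for some m and 1 for others.
  sum-scaledCosets : ∀ (u : ℕ → ℤ) → (∀ m → ¬ (+ q ℤ.∣ u m)) → ∀ {j} → j ≤ k → ∀ x →
    ListAction.sum (List.map (λ m → cosetIndicator l N (+ (q ^ m) ℤ.* u m) x) ⦅ j , suc k ⟧) ≡ ⟦ + (q ^ suc j) ℤ.∣? x ⟧
  sum-scaledCosets u q∤u {j} j≤k x = begin
    ListAction.sum (List.map term ⦅ j , suc k ⟧)
      ≡⟨ sum-range-suc term (s≤s j≤k) ⟩
    ListAction.sum (List.map term ⦅ j , k ⟧) + term (suc k)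
      ≡⟨ ≡.cong (_+_ (ListAction.sum (List.map term ⦅ j , k ⟧))) (scaledCoset⇔∣ (u (suc k)) x) ⟩
    ListAction.sum (List.map term ⦅ j , k ⟧) + ⟦ + (q ^ suc k) ℤ.∣? x ⟧
      ≡⟨ ≡.subst (λ e → ListAction.sum (List.map term ⦅ j , e ⟧) + ⟦ + (q ^ suc e) ℤ.∣? x ⟧ ≡ ⟦ + (q ^ suc j) ℤ.∣? x ⟧) (ℕ.m∸n+n≡m j≤k)
           (telescope (k ∸ j) (ℕ.≤-reflexive (ℕ.m∸n+n≡m j≤k))) ⟩
    ⟦ + (q ^ suc j) ℤ.∣? x ⟧ ∎
    where
    open ≡.≡-Reasoning
    term : ℕ → ℕ
    term m = cosetIndicator l N (+ (q ^ m) ℤ.* u m) x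
    telescope : ∀ e → e + j ≤ k →
      ListAction.sum (List.map term ⦅ j , e + j ⟧) + ⟦ + (q ^ suc (e + j)) ℤ.∣? x ⟧ ≡ ⟦ + (q ^ suc j) ℤ.∣? x ⟧
    telescope zero    _ = ≡.cong (λ ms → ListAction.sum (List.map term ms) + ⟦ + (q ^ suc j) ℤ.∣? x ⟧) (range-empty j)
    telescope (suc e) 1+e+j≤k = begin
      ListAction.sum (List.map term ⦅ j , suc (e + j) ⟧) + E (suc (suc (e + j)))
        ≡⟨ ≡.cong (_+ E (suc (suc (e + j)))) (sum-range-suc term (s≤s (ℕ.m≤n+m j e))) ⟩
      ListAction.sum (List.map term ⦅ j , e + j ⟧) + term (suc (e + j)) + E (suc (suc (e + j)))
        ≡⟨ ℕ.+-assoc (ListAction.sum (List.map term ⦅ j , e + j ⟧)) _ _ ⟩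
      ListAction.sum (List.map term ⦅ j , e + j ⟧) + (term (suc (e + j)) + E (suc (suc (e + j))))
        ≡⟨ ≡.cong (λ z → ListAction.sum (List.map term ⦅ j , e + j ⟧) + (z + E (suc (suc (e + j))))) (scaledCoset⇔exact 1+e+j≤k (q∤u (suc (e + j))) x) ⟩
      ListAction.sum (List.map term ⦅ j , e + j ⟧) + (⟦ exact? q (suc (e + j)) x ⟧ + E (suc (suc (e + j))))
        ≡⟨ ≡.cong (_+_ (ListAction.sum (List.map term ⦅ j , e + j ⟧))) (exact-split q (suc (e + j)) x) ⟨
      ListAction.sum (List.map term ⦅ j , e + j ⟧) + E (suc (e + j))
        ≡⟨ telescope e (ℕ.<⇒≤ 1+e+j≤k) ⟩
      E (suc j) ∎
      where
      E : ℕ → ℕ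
      E m = ⟦ + (q ^ m) ℤ.∣? x ⟧

  convolution-scaledCosets : ∀ {j u v γ δ t K₁ K₂} {ε w : ℕ → ℤ} → j ≤ k →
    ¬ (+ q ℤ.∣ u) → ¬ (+ q ℤ.∣ v) → (∀ m → ¬ (+ q ℤ.∣ w m)) →
    γ ≡ + (q ^ j) ℤ.* u → δ ≡ + (q ^ j) ℤ.* v → (∀ m → ε m ≡ + (q ^ m) ℤ.* w m) →
    t ≡ suc k → q ^ (k ∸ j) ≡ K₁ → φ (q ^ (suc k ∸ j)) ≡ K₂ →
    ∀ c → convolution l N γ δ c ≡
      (q ∸ 2) * K₁ * cosetIndicator l N γ c + K₂ * ListAction.sum (List.map (λ m → cosetIndicator l N (ε m) c) ⦅ j , t ⟧)
  convolution-scaledCosets {j} {u} {v} {ε = ε} {w} j≤k q∤u q∤v q∤w refl refl ε≡ refl refl refl c =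
    replace (≡.trans (≡.cong ListAction.sum (List.map-cong (λ m → ≡.cong (λ ε → cosetIndicator l N ε c) (ε≡ m)) ⦅ j , suc k ⟧))
        (sum-scaledCosets w q∤w j≤k c))
      (sumᵣ-scaledCosets {j} {u} {v} j≤k q∤u q∤v c)
    where
    replace : ∀ {S A F Σ} → Σ ≡ F → S ≡ (q ∸ 2) * q ^ (k ∸ j) * A + φ (q ^ (suc k ∸ j)) * F →
              S ≡ (q ∸ 2) * q ^ (k ∸ j) * A + φ (q ^ (suc k ∸ j)) * Σ
    replace refl eq = eq

-- The classes of g and of the powers of q modulo p^s

module Classes {p} (prime : Prime p) (odd-p : Odd p) {d} (odd-d : Odd d) {N} .{{_ : NonZero N}} (k l : ℕ)
               (N≡p^[1+k] : N ≡ p ^ suc k) (order-l : HasOrder N (+ l) d)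
               (unit-dichotomy₁ : ∀ {x} → ¬ (+ p ℤ.∣ x) → InCoset l N (+ 1) x ⊎ InCoset l N (+ 1) (ℤ.- x))
               where
  open Index2 prime odd-p odd-d k l N≡p^[1+k] order-l unit-dichotomy₁ using (inCoset-via1; inCoset-via-1)
  private
    order-l′ : HasOrder (p ^ suc k) (+ l) d
    order-l′ = ≡.subst (λ N → HasOrder N (+ l) d) N≡p^[1+k] order-l
    p∣N : p ∣ N
    p∣N = ≡.subst (p ∣_) (≡.sym N≡p^[1+k]) (ℕ.m∣m*n (p ^ k))
    L : ℕ → ℤ
    L r = (+ l) ℤ.^ r
  open OddOrder prime odd-p odd-d k l order-l′ using (inCoset-¬neg)

  -- One of x and -x is in ⟨l⟩, and they have the same square.
  square-inCoset1 : ¬ (+ p ℤ.∣ x) → InCoset l N (+ 1) (x ℤ.^ 2)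
  square-inCoset1 {x} p∤x = Sum.[ (λ x∈ → inCoset1-^ x∈ 2)
    , (λ -x∈ → ≡.subst (InCoset l N (+ 1)) (neg-^-even x 1) (inCoset1-^ -x∈ 2)) ] (unit-dichotomy₁ p∤x)

  -- If -a were in ⟨l⟩, then modulo p so would be a, being a square there, against `inCoset-¬neg`.
  -- The contradiction is drawn modulo p because `QuadraticResidue` speaks of p only.
  residue⇒inCoset1 : ∀ {a} → QuadraticResidue p a → InCoset l N (+ 1) (+ a)
  residue⇒inCoset1 {a} (p∤a , x , x²≡a) = Sum.[ id , (λ -a∈ → contradiction (inCoset-∣ p∣N -a∈)
    (inCoset-¬neg (p∤1 prime) (inCoset-resp-≅ x²≅a (inCoset-∣ p∣N (square-inCoset1 p∤x))))) ]
    (unit-dichotomy₁ (λ p∣a → p∤a (ℤ.∣⇒∣ᵤ p∣a)))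
    where
    x²≅a : x ℤ.^ 2 ≅ + a mod p
    x²≅a = congruent x²≡a
    p∤x : ¬ (+ p ℤ.∣ x)
    p∤x p∣x = p∤a (ℤ.∣⇒∣ᵤ (∣-resp-≅ x²≅a (ℤ.∣m⇒∣m*n (x ℤ.* + 1) p∣x)))

  -- For odd r the exponent r + d is even, since d is odd, and adding d does not change the power.
  power-square : ∀ r → ∃ λ x → x ℤ.^ 2 ≅ L r mod N
  power-square r = Sum.[ even , odd ]′ (parity r)
    where
    square : ∀ c → L c ℤ.^ 2 ≅ L (2 * c) mod N
    square c = ≅-reflexive (≡.trans (ℤ.^-*-assoc (+ l) c 2) (≡.cong L (ℕ.*-comm c 2)))
    even : (∃ λ c → r ≡ 2 * c) → ∃ λ x → x ℤ.^ 2 ≅ L r mod N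
    even (c , r≡) = L c , ≅-trans (square c) (≅-reflexive (≡.cong L (≡.sym r≡)))
    odd : Odd r → ∃ λ x → x ℤ.^ 2 ≅ L r mod N
    odd (c , r≡) = L (suc (c + f)) , (begin
      L (suc (c + f)) ℤ.^ 2        ≈⟨ square (suc (c + f)) ⟩
      L (2 * suc (c + f))          ≡⟨ ≡.cong L (sum-of-odds c f) ⟩
      L (suc (2 * c) + suc (2 * f)) ≡⟨ ≡.cong₂ (λ r d → L (r + d)) r≡ d≡ ⟨
      L (r + d)                    ≡⟨ ℤ.^-distribˡ-+-* (+ l) r d ⟩
      L r ℤ.* L d                  ≈⟨ *-≅ˡ (L r) (^-order order-l) ⟩
      L r ℤ.* + 1                  ≡⟨ ℤ.*-identityʳ (L r) ⟩
      L r                          ∎)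
      where
      open ≅-Reasoning N
      f : ℕ
      f = proj₁ odd-d
      d≡ : d ≡ suc (2 * f)
      d≡ = proj₂ odd-d
      sum-of-odds : ∀ c f → 2 * suc (c + f) ≡ suc (2 * c) + suc (2 * f)
      sum-of-odds = ℕSolver.solve-∀

  nonresidue⇒neg-inCoset1 : ∀ {a} → QuadraticNonresidue p a → InCoset l N (+ 1) (ℤ.- (+ a))
  nonresidue⇒neg-inCoset1 {a} (p∤a , non-square) = Sum.[ (λ a∈ → contradiction (square a∈) non-square) , id ]
    (unit-dichotomy₁ (λ p∣a → p∤a (ℤ.∣⇒∣ᵤ p∣a)))
    where
    square : InCoset l N (+ 1) (+ a) → ∃ λ x → x ℤ.^ 2 ≡ + a [mod p ]
    square (inCoset r a≅) = proj₁ (power-square r) , congruence x²≅a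
      where
      x²≅a : proj₁ (power-square r) ℤ.^ 2 ≅ + a mod p
      x²≅a = ≅-∣ p∣N (≅-trans (proj₂ (power-square r))
        (≅-sym (≅-trans a≅ (≅-reflexive (ℤ.*-identityˡ (L r))))))

  -- Every element of ⟨l⟩ becomes 1 in the power d, so an order greater than d excludes g from ⟨l⟩
  -- and leaves only the other class.
  primitiveRoot⇒neg-inCoset1 : ∀ {g e} → HasOrder N g e → d < e → InCoset l N (+ 1) (ℤ.- g)
  primitiveRoot⇒neg-inCoset1 {g} {e} order-g d<e = Sum.[ (λ g∈ → contradiction d<e (ℕ.≤⇒≯ (e≤d g∈))) , id ] (unit-dichotomy₁ p∤g)
    where
    p∤g : ¬ (+ p ℤ.∣ g)
    p∤g = hasOrder⇒∤ prime k (≡.subst (λ N → HasOrder N g e) N≡p^[1+k] order-g)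
    e≤d : InCoset l N (+ 1) g → e ≤ d
    e≤d (inCoset r g≅) = HasOrder.minimal order-g d (HasOrder.positive order-l) (congruence gᵈ≅1)
      where
      open ≅-Reasoning N
      gᵈ≅1 : g ℤ.^ d ≅ + 1 mod N
      gᵈ≅1 = begin
        g ℤ.^ d                ≈⟨ ^-≅ d g≅ ⟩
        (+ 1 ℤ.* L r) ℤ.^ d    ≡⟨ ≡.cong (ℤ._^ d) (ℤ.*-identityˡ (L r)) ⟩
        L r ℤ.^ d              ≡⟨ ≡.trans (ℤ.^-*-assoc (+ l) r d) (≡.cong L (ℕ.*-comm r d)) ⟩
        L (d * r)              ≈⟨ ^-multiple-≅1 {d = d} r (^-order order-l) ⟩
        + 1                    ∎

  module _ {u g : ℤ} (-g∈ : InCoset l N (+ 1) (ℤ.- g)) where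
    residue-class : InCoset l N (+ 1) u → ∀ e → InCoset l N g (u ℤ.^ e ℤ.* g)
    residue-class u∈ e = inCoset-via-1 -g∈ (≡.subst (InCoset l N (+ 1)) (≡.sym (ℤ.neg-distribʳ-* (u ℤ.^ e) g))
      (inCoset1-* (inCoset1-^ u∈ e) -g∈))

    nonresidue-class-even : InCoset l N (+ 1) (ℤ.- u) → ∀ {e} → (∃ λ c → e ≡ 2 * c) → InCoset l N g (u ℤ.^ e ℤ.* g)
    nonresidue-class-even -u∈ {e} (c , e≡) = inCoset-via-1 -g∈ (≡.subst (InCoset l N (+ 1)) (≡.sym (ℤ.neg-distribʳ-* (u ℤ.^ e) g))
      (inCoset1-* (≡.subst (InCoset l N (+ 1)) [-u]^e≡u^e (inCoset1-^ -u∈ e)) -g∈))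
      where
      [-u]^e≡u^e : (ℤ.- u) ℤ.^ e ≡ u ℤ.^ e
      [-u]^e≡u^e = ≡.subst (λ e → (ℤ.- u) ℤ.^ e ≡ u ℤ.^ e) (≡.sym e≡) (neg-^-even u c)

    -- An odd power of an element of -⟨l⟩ is again in -⟨l⟩, the class of g, so no factor g is
    -- wanted. With u = q and e = m - j this produces χ_im instead of χ*_im.
    nonresidue-class-odd : InCoset l N (+ 1) (ℤ.- u) → ∀ {e} → Odd e → InCoset l N g (u ℤ.^ e)
    nonresidue-class-odd -u∈ {e} (c , e≡) = inCoset-via-1 -g∈
      (≡.subst (InCoset l N (+ 1)) [-u]^e≡-u^e (inCoset1-^ -u∈ e))
      where
      [-u]^e≡-u^e : (ℤ.- u) ℤ.^ e ≡ ℤ.- (u ℤ.^ e)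
      [-u]^e≡-u^e = ≡.subst (λ e → (ℤ.- u) ℤ.^ e ≡ ℤ.- (u ℤ.^ e)) (≡.sym e≡) (neg-^-odd u c)

-- Group rings of cyclic groups

-- `X` is indexed by all integers, so that exponents may be shifted by -b and reflected without
-- tracking reductions modulo n.
module CyclicGroupRing (A : CommutativeRing c ℓ) (n : ℕ) .{{_ : NonZero n}} (X : ℤ → CommutativeRing.Carrier A)
    (X-periodic : ∀ {x y} → x ≅ y mod n → CommutativeRing._≈_ A (X x) (X y))
    (X-+ : ∀ x y → CommutativeRing._≈_ A (CommutativeRing._*_ A (X x) (X y)) (X (x ℤ.+ y))) where
  private module A = CommutativeRing A
  open A using (Carrier; _≈_; 0#; 1#; setoid) renaming (_+_ to _⊹_; _*_ to _·_)
  open SemiringMult A.semiring using (×-homo-+; ×1-homo-*) renaming (_×_ to _×ₙ_)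
  private
    module S = PeriodicSum A.+-commutativeMonoid
    module SR = SemiringSum A.semiring
  open CommutativeSemigroupProperties A.*-commutativeSemigroup using (interchange)
  open SetoidReasoning setoid

  ⌈_⌉ : ℕ → Carrier
  ⌈ k ⌉ = k ×ₙ 1#

  ⌈⌉-* : ∀ i j → ⌈ i * j ⌉ ≈ ⌈ i ⌉ · ⌈ j ⌉
  ⌈⌉-* = ×1-homo-*

  ⌈⌉-sum : ∀ {k} (f : Fin k → ℕ) → ⌈ sum f ⌉ ≈ S.sum (λ i → ⌈ f i ⌉)
  ⌈⌉-sum {zero}  f = A.refl
  ⌈⌉-sum {suc k} f = A.trans (×-homo-+ 1# (f zero) (sum (f ∘ suc))) (A.+-congˡ (⌈⌉-sum (f ∘ suc)))

  element : (ℤ → ℕ) → Carrier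
  element f = S.sumᵣ n (λ x → ⌈ f x ⌉ · X x)

  element-cong : ∀ {f h} → (∀ x → f x ≡ h x) → element f ≈ element h
  element-cong f≡h = S.sumᵣ-cong n λ x → A.*-cong (A.reflexive (≡.cong ⌈_⌉ (f≡h x))) (A.refl {X x})

  element-+ : ∀ f h → element (λ x → f x + h x) ≈ element f ⊹ element h
  element-+ f h = A.trans
    (S.sumᵣ-cong n λ x → A.trans (A.*-congʳ (×-homo-+ 1# (f x) (h x))) (A.distribʳ (X x) ⌈ f x ⌉ ⌈ h x ⌉))
    (S.∑-distrib-+ {n} _ _)

  element-scale : ∀ k f → element (λ x → k * f x) ≈ ⌈ k ⌉ · element f
  element-scale k f = A.trans
    (S.sumᵣ-cong n λ x → A.trans (A.*-congʳ (⌈⌉-* k (f x))) (A.*-assoc ⌈ k ⌉ ⌈ f x ⌉ (X x)))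
    (A.sym (SR.*-distribˡ-sum {n} ⌈ k ⌉ _))

  element-zero : element (λ _ → 0) ≈ 0#
  element-zero = A.trans (S.sumᵣ-cong n λ x → A.zeroˡ (X x)) (S.sum-replicate-zero n)

  element-sum : ∀ {I : Set} (is : List I) (f : I → ℤ → ℕ) →
                element (λ x → ListAction.sum (List.map (λ i → f i x) is)) ≈ Sum.sumOver A is (λ i → element (f i))
  element-sum []       f = element-zero
  element-sum (i ∷ is) f = A.trans (element-+ (f i) (λ x → ListAction.sum (List.map (λ i → f i x) is))) (A.+-congˡ (element-sum is f))

  -- For each exponent b of the second factor, the sum over the exponents of the first is shifted by
  -- b. The summation index is then the exponent c of the product, and exchanging the sums collects
  -- the coefficient of X c.
  element-* : ∀ {f h} → Periodic n f →
              element f · element h ≈ element (λ c → sumᵣ n (λ b → h b * f (c ℤ.- b)))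
  element-* {f} {h} f-periodic = begin
    element f · element h
      ≈⟨ SR.*-distribˡ-sum {n} (element f) _ ⟩
    S.sumᵣ n (λ b → element f · (⌈ h b ⌉ · X b))
      ≈⟨ S.sumᵣ-cong n (λ b → A.*-cong (S.sumᵣ-shift n {term} b term-periodic) (A.refl {⌈ h b ⌉ · X b})) ⟩
    S.sumᵣ n (λ b → S.sumᵣ n (λ c → term (c ℤ.- b)) · (⌈ h b ⌉ · X b))
      ≈⟨ S.sumᵣ-cong n (λ b → SR.*-distribʳ-sum {n} (⌈ h b ⌉ · X b) (λ c → term (+ toℕ c ℤ.- b))) ⟩
    S.sumᵣ n (λ b → S.sumᵣ n (λ c → term (c ℤ.- b) · (⌈ h b ⌉ · X b)))
      ≈⟨ S.∑-comm {n} {n} _ ⟩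
    S.sumᵣ n (λ c → S.sumᵣ n (λ b → term (c ℤ.- b) · (⌈ h b ⌉ · X b)))
      ≈⟨ S.sumᵣ-cong n (λ c → A.trans (S.sumᵣ-cong n (collect c)) (A.sym (SR.*-distribʳ-sum {n} (X c) _))) ⟩
    S.sumᵣ n (λ c → S.sumᵣ n (λ b → ⌈ h b * f (c ℤ.- b) ⌉) · X c)
      ≈⟨ S.sumᵣ-cong n (λ c → A.*-cong (⌈⌉-sum {n} (λ b → h (+ toℕ b) * f (c ℤ.- + toℕ b))) (A.refl {X c})) ⟨
    element (λ c → sumᵣ n (λ b → h b * f (c ℤ.- b))) ∎
    where
    term : ℤ → Carrier
    term x = ⌈ f x ⌉ · X x
    term-periodic : S.Periodic n term
    term-periodic e = A.*-cong (A.reflexive (≡.cong ⌈_⌉ (f-periodic e))) (X-periodic e)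
    collect : ∀ c b → term (c ℤ.- b) · (⌈ h b ⌉ · X b) ≈ ⌈ h b * f (c ℤ.- b) ⌉ · X c
    collect c b = begin
      ⌈ f (c ℤ.- b) ⌉ · X (c ℤ.- b) · (⌈ h b ⌉ · X b)      ≈⟨ interchange ⌈ f (c ℤ.- b) ⌉ (X (c ℤ.- b)) ⌈ h b ⌉ (X b) ⟩
      ⌈ f (c ℤ.- b) ⌉ · ⌈ h b ⌉ · (X (c ℤ.- b) · X b)      ≈⟨ A.*-cong (A.trans (A.*-comm ⌈ f (c ℤ.- b) ⌉ ⌈ h b ⌉) (A.sym (⌈⌉-* (h b) (f (c ℤ.- b))))) (A.trans (X-+ (c ℤ.- b) b) (A.reflexive (≡.cong X (i-j+j≡i c b)))) ⟩
      ⌈ h b * f (c ℤ.- b) ⌉ · X c                          ∎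

  product-formula : ∀ {f h : ℤ → ℕ} {I : Set} {is : List I} {e : I → ℤ → ℕ} {K₁ K₂} → Periodic n f →
    (∀ c → sumᵣ n (λ b → h b * f (c ℤ.- b)) ≡ K₁ * f c + K₂ * ListAction.sum (List.map (λ i → e i c) is)) →
    ∀ {x y k₁ k₂ w} → x ≈ element f → y ≈ element h → k₁ ≈ ⌈ K₁ ⌉ → k₂ ≈ ⌈ K₂ ⌉ →
    w ≈ Sum.sumOver A is (λ i → element (e i)) → x · y ≈ k₁ · x ⊹ k₂ · w
  product-formula {f} {h} {is = is} {e} {K₁} {K₂} f-periodic count {x} {y} {k₁} {k₂} {w} x≈ y≈ k₁≈ k₂≈ w≈ = begin
    x · y
      ≈⟨ A.*-cong x≈ y≈ ⟩
    element f · element h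
      ≈⟨ element-* {f} {h} f-periodic ⟩
    element (λ c → sumᵣ n (λ b → h b * f (c ℤ.- b)))
      ≈⟨ element-cong count ⟩
    element (λ c → K₁ * f c + K₂ * total c)
      ≈⟨ element-+ (λ c → K₁ * f c) (λ c → K₂ * total c) ⟩
    element (λ c → K₁ * f c) ⊹ element (λ c → K₂ * total c)
      ≈⟨ A.+-cong (element-scale K₁ f) (A.trans (element-scale K₂ total) (A.*-cong (A.refl {⌈ K₂ ⌉}) (element-sum is e))) ⟩
    ⌈ K₁ ⌉ · element f ⊹ ⌈ K₂ ⌉ · Sum.sumOver A is (λ i → element (e i))
      ≈⟨ A.+-cong (A.*-cong k₁≈ x≈) (A.*-cong k₂≈ w≈) ⟨
    k₁ · x ⊹ k₂ · w ∎
    where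
    total : ℤ → ℕ
    total c = ListAction.sum (List.map (λ i → e i c) is)

  sumOver-filter-tabulate : ∀ {I : Set} {P : Pred I a} (P? : Decidable P) (f : I → Carrier) {k} (t : Fin k → I) →
    Sum.sumOver A (List.filter P? (List.tabulate t)) f ≈ S.sum (λ i → ⌈ ⟦ P? (t i) ⟧ ⌉ · f (t i))
  sumOver-filter-tabulate P? f {zero}  t = A.refl
  sumOver-filter-tabulate P? f {suc k} t with P? (t zero)
  ... | yes _ = A.+-cong (A.sym (A.trans (A.*-congʳ (A.+-identityʳ 1#)) (A.*-identityˡ _)))
                  (sumOver-filter-tabulate P? f (t ∘ suc))
  ... | no  _ = A.trans (sumOver-filter-tabulate P? f (t ∘ suc))
                  (A.sym (A.trans (A.+-congʳ (A.zeroˡ _)) (A.+-identityˡ _)))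

  -- Meant for the odd and even values of m - j: the two sums of part (ii) become one sum over the
  -- whole range, with a term that depends on the parity.
  sumOver-merge : ∀ {I : Set} {P : Pred I a} {Q : Pred I b} (P? : Decidable P) (Q? : Decidable Q)
    {f h e : I → Carrier} (is : List I) → (∀ i → ⟦ P? i ⟧ + ⟦ Q? i ⟧ ≡ 1) →
    All (λ i → P i → f i ≈ e i) is → All (λ i → Q i → h i ≈ e i) is →
    Sum.sumOver A (List.filter P? is) f ⊹ Sum.sumOver A (List.filter Q? is) h ≈ Sum.sumOver A is e
  sumOver-merge P? Q? [] _ _ _ = A.+-identityˡ 0#
  sumOver-merge P? Q? (i ∷ is) one (f≈ ∷ fs≈) (h≈ ∷ hs≈) with P? i | Q? i | one i
  ... | yes Pi | no _   | _ = A.trans (A.+-assoc _ _ _) (A.+-cong (f≈ Pi) (sumOver-merge P? Q? is one fs≈ hs≈))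
  ... | no _   | yes Qi | _ = A.trans (CommutativeSemigroupProperties.x∙yz≈y∙xz A.+-commutativeSemigroup _ _ _)
                                (A.+-cong (h≈ Qi) (sumOver-merge P? Q? is one fs≈ hs≈))
  ... | yes _  | yes _  | ()
  ... | no _   | no _   | ()

  sumOver-cong : ∀ {I : Set} {f h : I → Carrier} {is : List I} → All (λ i → f i ≈ h i) is →
                 Sum.sumOver A is f ≈ Sum.sumOver A is h
  sumOver-cong []         = A.refl
  sumOver-cong (e ∷ es)   = A.+-cong e (sumOver-cong es)

-- Coprimality of the moduli and of the two orders of l

pos-^ : ∀ m k → + (m ^ k) ≡ (+ m) ℤ.^ k
pos-^ m zero    = refl
pos-^ m (suc k) = ≡.trans (ℤ.pos-* m (m ^ k)) (≡.cong (+ m ℤ.*_) (pos-^ m k))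

prime∤prime : ∀ {p q} → Prime p → Prime q → p ≢ q → ¬ (p ∣ q)
prime∤prime {p} {q} pr qr p≢q p∣q with ℕ.prime⇒irreducible qr p∣q
... | inj₁ p≡1 = ℕ.<⇒≢ (1<p pr) (≡.sym p≡1)
... | inj₂ p≡q = p≢q p≡q

prime-powers-coprime : ∀ {p q} → Prime p → Prime q → p ≢ q → ∀ s t → ℕ.Coprime (p ^ s) (q ^ t)
prime-powers-coprime {p} {q} pr qr p≢q s t = coprime-^ qr t q∤pˢ
  where
  q∤pˢ : ¬ (q ∣ p ^ s)
  q∤pˢ q∣pˢ = ℕ.<⇒≢ (1<p qr) (≡.sym (coprime-^ pr s (prime∤prime pr qr p≢q) (ℕ.∣-refl , q∣pˢ)))

-- A common divisor of d and b divides gcd (2 d) b = 2, and 2 does not divide the odd d. This is how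
-- gcd(φ(p^s), φ(q^t)) = 2 makes the orders of l coprime.
odd∣⇒coprime : ∀ {d a b} → Odd d → a ≡ 2 * d → gcd a b ≡ 2 → ℕ.Coprime d b
odd∣⇒coprime {d} {a} {b} odd-d a≡2d gcd≡2 {e} (e∣d , e∣b) with ℕ.prime⇒irreducible ℕ.prime[2] e∣2
  where
  e∣2 : e ∣ 2
  e∣2 = ≡.subst (e ∣_) gcd≡2 (gcd-greatest (≡.subst (e ∣_) (≡.sym a≡2d) (ℕ.∣n⇒∣m*n 2 e∣d)) e∣b)
... | inj₁ e≡1 = e≡1
... | inj₂ refl = contradiction e∣d (odd⇒2∤ odd-d)

*-distribˡ-listSum : ∀ {I : Set} k (f : I → ℕ) is → k * ListAction.sum (List.map f is) ≡ ListAction.sum (List.map (λ i → k * f i) is)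
*-distribˡ-listSum k f []       = ℕ.*-zeroʳ k
*-distribˡ-listSum k f (i ∷ is) = ≡.trans (ℕ.*-distribˡ-+ k (f i) _) (≡.cong (_+_ (k * f i)) (*-distribˡ-listSum k f is))

-- The convolution modulo p^s q^t

module Count {p q} (p-prime : Prime p) (q-prime : Prime q) (p≢q : p ≢ q) (odd-p : Odd p) {d} (odd-d : Odd d)
    {M N} .{{_ : NonZero M}} .{{_ : NonZero N}} .{{_ : NonZero (M * N)}} {s t} (k k′ l : ℕ)
    (s≡1+k : s ≡ suc k) (t≡1+k′ : t ≡ suc k′) (M≡p^s : M ≡ p ^ s) (N≡q^t : N ≡ q ^ t)
    (order-M : HasOrder M (+ l) d) (root-N : PrimitiveRoot N (+ l)) (d⊥φN : ℕ.Coprime d (φ N))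
    (unit-dichotomy₁ : ∀ {x} → ¬ (+ p ℤ.∣ x) → InCoset l M (+ 1) x ⊎ InCoset l M (+ 1) (ℤ.- x))
    where
  private
    M≡ : M ≡ p ^ suc k
    M≡ = ≡.trans M≡p^s (≡.cong (p ^_) s≡1+k)
    N≡ : N ≡ q ^ suc k′
    N≡ = ≡.trans N≡q^t (≡.cong (q ^_) t≡1+k′)
    M⊥N : ℕ.Coprime M N
    M⊥N = ≡.subst₂ ℕ.Coprime (≡.sym M≡p^s) (≡.sym N≡q^t) (prime-powers-coprime p-prime q-prime p≢q s t)
    p∤ : ∀ m → ¬ (+ p ℤ.∣ + (q ^ m))
    p∤ m p∣q^m = ∤-^ p-prime m (λ p∣q → prime∤prime p-prime q-prime p≢q (ℤ.∣⇒∣ᵤ p∣q)) (≡.subst (+ p ℤ.∣_) (pos-^ q m) p∣q^m)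
    q∤ : ∀ i → ¬ (+ q ℤ.∣ + (p ^ i))
    q∤ i q∣p^i = ∤-^ q-prime i (λ q∣p → prime∤prime q-prime p-prime (p≢q ∘ ≡.sym) (ℤ.∣⇒∣ᵤ q∣p)) (≡.subst (+ q ℤ.∣_) (pos-^ p i) q∣p^i)

  p-form : ∀ i m u → + (p ^ i * q ^ m) ℤ.* u ≡ + (p ^ i) ℤ.* (+ (q ^ m) ℤ.* u)
  p-form i m u = ≡.trans (≡.cong (ℤ._* u) (ℤ.pos-* (p ^ i) (q ^ m))) (ℤ.*-assoc (+ (p ^ i)) (+ (q ^ m)) u)

  q-form : ∀ i m u → + (p ^ i * q ^ m) ℤ.* u ≡ + (q ^ m) ℤ.* (+ (p ^ i) ℤ.* u)
  q-form i m u = ≡.trans (p-form i m u) (identity (+ (p ^ i)) (+ (q ^ m)) u)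
    where
    identity : ∀ x y u → x ℤ.* (y ℤ.* u) ≡ y ℤ.* (x ℤ.* u)
    identity = solve-∀

  -- `u m` selects the coset that represents q^m on the right-hand side. Modulo `N` any unit will
  -- do; modulo `M` the condition `class` gives p^i q^m u m the same coset as `γ`, so that one
  -- indicator modulo `M` is common to all terms.
  module _ {i i′ j g} (i<i′ : i < i′) (i′≤k : i′ ≤ k) (j≤k′ : j ≤ k′) (p∤g : ¬ (+ p ℤ.∣ g)) (q∤g : ¬ (+ q ℤ.∣ g))
           (u : ℕ → ℤ) (q∤u : ∀ m → ¬ (+ q ℤ.∣ u m))
           (class : ∀ {m} → j < m → InCoset l M (+ (q ^ j) ℤ.* g) (+ (q ^ m) ℤ.* u m))
           {γ δ : ℤ} {ε : ℕ → ℤ} (γ≡ : γ ≡ + (p ^ i * q ^ j) ℤ.* g) (δ≡ : δ ≡ + (p ^ i′ * q ^ j))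
           (ε≡ : ∀ m → ε m ≡ + (p ^ i * q ^ m) ℤ.* u m)
           {D K₁ K₂ : ℕ} (D≡ : φ (p ^ (suc k ∸ i′)) / 2 ≡ D) (K₁≡ : q ^ (k′ ∸ j) ≡ K₁) (K₂≡ : φ (q ^ (suc k′ ∸ j)) ≡ K₂)
           where
    private
      Σ-N : ℤ → ℕ
      Σ-N c = ListAction.sum (List.map (λ m → cosetIndicator l N (ε m) c) ⦅ j , t ⟧)

    count-M : ∀ c → convolution l M γ δ c ≡ D * cosetIndicator l M γ c
    count-M = Index2.convolution-scaledCosets p-prime odd-p odd-d k l M≡ order-M unit-dichotomy₁
      i<i′ i′≤k (∤-* p-prime (p∤ j) p∤g) (p∤ j)
      (≡.trans γ≡ (p-form i j g)) (≡.trans δ≡ (ℤ.pos-* (p ^ i′) (q ^ j))) D≡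

    count-N : ∀ c → convolution l N γ δ c ≡ (q ∸ 2) * K₁ * cosetIndicator l N γ c + K₂ * Σ-N c
    count-N = Primitive.convolution-scaledCosets q-prime k′ l N≡ root-N j≤k′
      (∤-* q-prime (q∤ i) q∤g) (q∤ i′) (λ m → ∤-* q-prime (q∤ i) (q∤u m))
      (≡.trans γ≡ (q-form i j g))
      (≡.trans δ≡ (≡.trans (ℤ.pos-* (p ^ i′) (q ^ j)) (ℤ.*-comm (+ (p ^ i′)) (+ (q ^ j)))))
      (λ m → ≡.trans (ε≡ m) (q-form i m (u m))) t≡1+k′ K₁≡ K₂≡

    M-class : ∀ {m} → j < m → ∀ c → cosetIndicator l M γ c ≡ cosetIndicator l M (ε m) c
    M-class {m} j<m = inCoset?-cong order-M (≡.subst₂ (InCoset l M) (≡.sym (≡.trans γ≡ (p-form i j g))) (≡.sym (≡.trans (ε≡ m) (p-form i m (u m))))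
      (inCoset-*ˡ (+ (p ^ i)) (class j<m)))

    member-* : ∀ {m} → j < m → ∀ c → cosetIndicator l M γ c * cosetIndicator l N (ε m) c ≡ cosetIndicator l (M * N) (ε m) c
    member-* {m} j<m c = ≡.trans (≡.cong (_* cosetIndicator l N (ε m) c) (M-class j<m c))
      (≡.sym (inCoset-*⇔ (ε m) order-M root-N d⊥φN M⊥N c))

    private
      Σ-MN : ℤ → ℕ
      Σ-MN c = ListAction.sum (List.map (λ m → cosetIndicator l (M * N) (ε m) c) ⦅ j , t ⟧)

    Σ≡ : ∀ c → cosetIndicator l M γ c * Σ-N c ≡ Σ-MN c
    Σ≡ c = ≡.trans (*-distribˡ-listSum (cosetIndicator l M γ c) (λ m → (cosetIndicator l N (ε m) c)) ⦅ j , t ⟧)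
      -- The classes are known to agree only for j < m, so the terms are compared on the list
      -- itself, whose defining filter supplies that inequality.
      (≡.cong ListAction.sum (List.map-cong-local (All.map (λ j<m → member-* j<m c)
        (All.all-filter (j ℕ.<?_) (List.upTo (suc t))))))

    count : ∀ c → convolution l (M * N) γ δ c ≡
      D * (q ∸ 2) * K₁ * cosetIndicator l (M * N) γ c +
      D * K₂ * Σ-MN c
    count c = assemble D (q ∸ 2) K₁ K₂ (cosetIndicator l M γ c) (cosetIndicator l N γ c) (Σ-N c)
      (cosetIndicator l (M * N) γ c) (Σ-MN c)
      (convolution-* order-M root-N d⊥φN M⊥N γ δ c) (count-M c) (count-N c)
      (≡.sym (inCoset-*⇔ γ order-M root-N d⊥φN M⊥N c)) (Σ≡ c)
      where
      identity : ∀ D r z y A B S → D * A * (r * z * B + y * S) ≡ D * r * z * (A * B) + D * y * (A * S)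
      identity = ℕSolver.solve-∀
      assemble : ∀ D r z y A B S AB AS {conv conv-M conv-N} → conv ≡ conv-M * conv-N →
        conv-M ≡ D * A → conv-N ≡ r * z * B + y * S → A * B ≡ AB → A * S ≡ AS → conv ≡ D * r * z * AB + D * y * AS
      assemble D r z y A B S _ _ refl refl refl refl refl = identity D r z y A B S

-- The polynomial ring modulo X^n - 1 as a group ring

module CyclicQuotient (R : CommutativeRing c ℓ) (n : ℕ) .{{_ : NonZero n}} where
  open Polynomial R
  private
    module R = CommutativeRing R
    module P = CommutativeRing (R [X])

  modulus : Poly
  modulus = X^ n P.- P.1#

  A : CommutativeRing _ _
  A = R [X] /⟨ modulus ⟩
  private module A = CommutativeRing A
  open PrincipalQuotient (R [X]) modulus using (≈⇒≈ₘ)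

  X^-+ₚ : ∀ i j → X^ i *ₚ X^ j ≈ₚ X^ (i + j)
  X^-+ₚ zero    j = *ₚ-identityˡ (X^ j)
  X^-+ₚ (suc i) j = ≈ₚ-trans (0∷-*ₚ (X^ i) (X^ j)) (∷-cong R.refl (X^-+ₚ i j))

  X^-+ : ∀ i j → X^ i A.* X^ j A.≈ X^ (i + j)
  X^-+ i j = ≈⇒≈ₘ (X^-+ₚ i j)

  X^n≈1 : X^ n A.≈ A.1#
  X^n≈1 = P.1# , (begin
    X^ n                              ≈⟨ P.+-identityʳ (X^ n) ⟨
    X^ n P.+ P.0#                     ≈⟨ P.+-congˡ {X^ n} (P.-‿inverseˡ P.1#) ⟨
    X^ n P.+ (P.- P.1# P.+ P.1#)      ≈⟨ P.+-assoc (X^ n) (P.- P.1#) P.1# ⟨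
    modulus P.+ P.1#                  ≈⟨ P.+-comm modulus P.1# ⟩
    P.1# P.+ modulus                  ≈⟨ P.+-congˡ {P.1#} (P.*-identityˡ modulus) ⟨
    P.1# P.+ P.1# P.* modulus         ∎)
    where open SetoidReasoning P.setoid

  X^[k*n]≈1 : ∀ k → X^ (k * n) A.≈ A.1#
  X^[k*n]≈1 zero    = A.refl {A.1#}
  X^[k*n]≈1 (suc k) = begin
    X^ (n + k * n)            ≈⟨ X^-+ n (k * n) ⟨
    X^ n A.* X^ (k * n)       ≈⟨ A.*-cong {X^ n} {A.1#} {X^ (k * n)} {A.1#} X^n≈1 (X^[k*n]≈1 k) ⟩
    A.1# A.* A.1#             ≈⟨ A.*-identityˡ A.1# ⟩
    A.1#                      ∎
    where open SetoidReasoning A.setoid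

  X^-% : ∀ i → X^ i A.≈ X^ (i % n)
  X^-% i = begin
    X^ i                              ≡⟨ ≡.cong X^_ (ℕ.m≡m%n+[m/n]*n i n) ⟩
    X^ (i % n + i / n * n)            ≈⟨ X^-+ (i % n) (i / n * n) ⟨
    X^ (i % n) A.* X^ (i / n * n)     ≈⟨ A.*-congˡ {X^ (i % n)} (X^[k*n]≈1 (i / n)) ⟩
    X^ (i % n) A.* A.1#               ≈⟨ A.*-identityʳ (X^ (i % n)) ⟩
    X^ (i % n)                        ∎
    where open SetoidReasoning A.setoid

  X : ℤ → Poly
  X x = X^ toℕ (residue n x)

  X-periodic : ∀ {x y} → x ≅ y mod n → X x A.≈ X y
  X-periodic {x} {y} x≅y = A.reflexive (≡.cong (λ k → X^ toℕ k)
    (toℕ-≅-injective (≅-trans (residue-≅ n x) (≅-trans x≅y (≅-sym (residue-≅ n y))))))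

  X-toℕ : ∀ (k : Fin n) → X^ toℕ k ≡ X (+ toℕ k)
  X-toℕ k = ≡.cong (λ k → X^ toℕ k) (toℕ-≅-injective (≅-sym (residue-≅ n (+ toℕ k))))

  X-% : ∀ i → X^ (i % n) ≡ X (+ i)
  X-% i = ≡.cong X^_ (≡.sym (Fin.toℕ-fromℕ< _))

  X-+ : ∀ x y → X x A.* X y A.≈ X (x ℤ.+ y)
  X-+ x y = begin
    X x A.* X y                  ≈⟨ X^-+ i j ⟩
    X^ (i + j)                   ≈⟨ X^-% (i + j) ⟩
    X^ ((i + j) % n)             ≡⟨ X-% (i + j) ⟩
    X (+ i ℤ.+ + j)              ≈⟨ X-periodic (+-≅ (residue-≅ n x) (residue-≅ n y)) ⟩
    X (x ℤ.+ y)                  ∎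
    where
    open SetoidReasoning A.setoid
    i j : ℕ
    i = toℕ (residue n x)
    j = toℕ (residue n y)

  open CyclicGroupRing A n X X-periodic X-+ public

  sumOver-filter-allFin : ∀ {P : Pred (Fin n) a} (P? : Decidable P) (f : ℤ → ℕ) → (∀ k → ⟦ P? k ⟧ ≡ f (+ toℕ k)) →
                          Sum.sumOver A (List.filter P? (List.allFin n)) (λ k → X^ toℕ k) A.≈ element f
  sumOver-filter-allFin P? f P?≡f = A.trans (sumOver-filter-tabulate P? (λ k → X^ toℕ k) id)
    (PeriodicSum.sum-cong-≋ A.+-commutativeMonoid {n} λ k →
      A.reflexive (≡.cong₂ (λ i x → ⌈ i ⌉ A.* x) (P?≡f k) (X-toℕ k)))

module _ (l n : ℕ) .{{_ : NonZero n}} where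
  open CyclicQuotient (𝔽 l) n
  private module A = CommutativeRing A

  const≈⌈⌉ : ∀ k → Polynomial.const (𝔽 l) (+ k) A.≈ ⌈ k ⌉
  const≈⌈⌉ zero    = PrincipalQuotient.≈⇒≈ₘ (𝔽 l [X]) modulus (Polynomial.0∷[] (𝔽 l))
  -- The sum of `A.1#` and the constant polynomial `+ k` computes to the constant polynomial
  -- `+ suc k`.
  const≈⌈⌉ (suc k) = A.+-congˡ {A.1#} (const≈⌈⌉ k)

  ⟦coset?⟧ : ∀ γ (k : Fin n) → ⟦ coset? l n γ k ⟧ ≡ cosetIndicator l n γ (+ toℕ k)
  ⟦coset?⟧ γ k = ⟦⟧-cong (coset? l n γ k) (inCoset? l n γ (+ toℕ k))
    (λ (r , e) → inCoset r (congruent e)) (λ (inCoset r e) → r , congruence e)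

  sumOver-coset : ∀ γ → Sum.sumOver A (List.filter (coset? l n γ) (List.allFin n)) (λ α → Polynomial.X^_ (𝔽 l) (toℕ α))
                        A.≈ element (cosetIndicator l n γ)
  sumOver-coset γ = sumOver-filter-allFin (coset? l n γ) (cosetIndicator l n γ) (⟦coset?⟧ γ)

-- The two products

module Product (p q l s t : ℕ) (g : ℤ) .{{_ : NonZero (p ^ s)}} .{{_ : NonZero (q ^ t)}} .{{_ : NonZero (p ^ s * q ^ t)}}
    (k k′ : ℕ) (s≡1+k : s ≡ suc k) (t≡1+k′ : t ≡ suc k′)
    (p-prime : Prime p) (q-prime : Prime q) (p≢q : p ≢ q) (odd-p : Odd p)
    {d} (odd-d : Odd d) (φ≡2d : φ (p ^ s) ≡ 2 * d) (order-p : HasOrder (p ^ s) (+ l) d)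
    (root-q : PrimitiveRoot (q ^ t) (+ l)) (d⊥φ : ℕ.Coprime d (φ (q ^ t)))
    (root-g-p : PrimitiveRoot (p ^ s) g) (root-g-q : PrimitiveRoot (q ^ t) g) where
  open Cyclotomic p q l s t g
  open CyclicQuotient (𝔽 l) n using (element; product-formula; sumOver-merge; sumOver-cong)

  unit-dichotomy₁ : ∀ {x} → ¬ (+ p ℤ.∣ x) → InCoset l (p ^ s) (+ 1) x ⊎ InCoset l (p ^ s) (+ 1) (ℤ.- x)
  unit-dichotomy₁ = ≡.subst (λ s → φ (p ^ s) ≡ 2 * d → HasOrder (p ^ s) (+ l) d →
      ∀ {x} → ¬ (+ p ℤ.∣ x) → InCoset l (p ^ s) (+ 1) x ⊎ InCoset l (p ^ s) (+ 1) (ℤ.- x)) (≡.sym s≡1+k)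
    (λ φ≡2d order-l → OddOrder.unit-dichotomy₁ p-prime odd-p odd-d k l order-l φ≡2d) φ≡2d order-p

  open Classes p-prime odd-p odd-d k l (≡.cong (p ^_) s≡1+k) order-p unit-dichotomy₁

  d<φ : d < φ (p ^ s)
  d<φ = ≡.subst (d <_) (≡.sym φ≡2d) (ℕ.m<m+n d (≡.subst (0 <_) (≡.sym (ℕ.+-identityʳ d)) (HasOrder.positive order-p)))

  -g∈ : InCoset l (p ^ s) (+ 1) (ℤ.- g)
  -g∈ = primitiveRoot⇒neg-inCoset1 root-g-p d<φ

  p∤g : ¬ (+ p ℤ.∣ g)
  p∤g = hasOrder⇒∤ p-prime k (≡.subst (λ s → HasOrder (p ^ s) g (φ (p ^ s))) s≡1+k root-g-p)

  q∤g : ¬ (+ q ℤ.∣ g)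
  q∤g = hasOrder⇒∤ q-prime k′ (≡.subst (λ t → HasOrder (q ^ t) g (φ (q ^ t))) t≡1+k′ root-g-q)

  cosetElement : ℤ → Carrier
  cosetElement γ = element (cosetIndicator l n γ)

  cosetSum≋ : ∀ γ → cosetSum γ ≋ cosetElement γ
  cosetSum≋ = sumOver-coset l n

  -- The common form of both parts. They differ only in `u`, which is constantly g for a residue q
  -- and is g or 1 according to the parity of m - j for a nonresidue, and in how `w` writes the
  -- resulting sum.
  coset-product : ∀ {i i′ j} → i < i′ → i′ ≤ k → j ≤ k′ → (u : ℕ → ℤ) → (∀ m → ¬ (+ q ℤ.∣ u m)) →
    (∀ {m} → j < m → InCoset l (p ^ s) (+ (q ^ j) ℤ.* g) (+ (q ^ m) ℤ.* u m)) →
    ∀ {w} → w ≋ sumOver ⦅ j , t ⟧ (λ m → cosetElement (+ (p ^ i * q ^ m) ℤ.* u m)) →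
    χ* i j ⊗ χ i′ j ≋
      ⌜ φ (p ^ (s ∸ i′)) / 2 * (q ∸ 2) * q ^ (t ∸ j ∸ 1) ⌝ ⊗ χ* i j
      ⊕ ⌜ φ (p ^ (s ∸ i′)) / 2 * φ (q ^ (t ∸ j)) ⌝ ⊗ w
  coset-product {i} {i′} {j} i<i′ i′≤k j≤k′ u q∤u class w≋ =
    product-formula {f = cosetIndicator l n γ} {h = cosetIndicator l n δ} {is = ⦅ j , t ⟧} {e = λ m → cosetIndicator l n (ε m)}
      {K₁ = D * (q ∸ 2) * K₁} {K₂ = D * K₂}
      (inCoset?-periodic γ) counted
      (cosetSum≋ γ) (cosetSum≋ δ) (const≈⌈⌉ l n (D * (q ∸ 2) * K₁)) (const≈⌈⌉ l n (D * K₂)) w≋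
    where
    γ δ : ℤ
    γ = + (p ^ i * q ^ j) ℤ.* g
    δ = + (p ^ i′ * q ^ j)
    ε : ℕ → ℤ
    ε m = + (p ^ i * q ^ m) ℤ.* u m
    D K₁ K₂ : ℕ
    D  = φ (p ^ (s ∸ i′)) / 2
    K₁ = q ^ (t ∸ j ∸ 1)
    K₂ = φ (q ^ (t ∸ j))
    D≡ : φ (p ^ (suc k ∸ i′)) / 2 ≡ D
    D≡ = ≡.cong (λ s → φ (p ^ (s ∸ i′)) / 2) (≡.sym s≡1+k)
    K₁≡ : q ^ (k′ ∸ j) ≡ K₁
    K₁≡ = ≡.cong (q ^_) (≡.trans (≡.cong (suc k′ ∸_) (ℕ.+-comm 1 j))
      (≡.trans (≡.sym (ℕ.∸-+-assoc (suc k′) j 1)) (≡.cong (λ t → t ∸ j ∸ 1) (≡.sym t≡1+k′))))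
    K₂≡ : φ (q ^ (suc k′ ∸ j)) ≡ K₂
    K₂≡ = ≡.cong (λ t → φ (q ^ (t ∸ j))) (≡.sym t≡1+k′)
    counted : ∀ c → convolution l n γ δ c ≡
      D * (q ∸ 2) * K₁ * cosetIndicator l n γ c +
      D * K₂ * ListAction.sum (List.map (λ m → cosetIndicator l n (ε m) c) ⦅ j , t ⟧)
    counted = Count.count p-prime q-prime p≢q odd-p odd-d k k′ l s≡1+k t≡1+k′ refl refl order-p root-q d⊥φ unit-dichotomy₁
      {i} {i′} {j} {g} i<i′ i′≤k j≤k′ p∤g q∤g u q∤u class {γ} {δ} {ε} refl refl (λ _ → refl) {D} {K₁} {K₂} D≡ K₁≡ K₂≡

  shift-class : ∀ {j m u v} → j < m → InCoset l (p ^ s) u ((+ q) ℤ.^ (m ∸ j) ℤ.* v) →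
                InCoset l (p ^ s) (+ (q ^ j) ℤ.* u) (+ (q ^ m) ℤ.* v)
  shift-class {j} {m} {u} {v} j<m class = ≡.subst (InCoset l (p ^ s) (+ (q ^ j) ℤ.* u)) eq (inCoset-*ˡ (+ (q ^ j)) class)
    where
    open ≡.≡-Reasoning
    eq : + (q ^ j) ℤ.* ((+ q) ℤ.^ (m ∸ j) ℤ.* v) ≡ + (q ^ m) ℤ.* v
    eq = begin
      + (q ^ j) ℤ.* ((+ q) ℤ.^ (m ∸ j) ℤ.* v)    ≡⟨ ℤ.*-assoc (+ (q ^ j)) ((+ q) ℤ.^ (m ∸ j)) v ⟨
      + (q ^ j) ℤ.* (+ q) ℤ.^ (m ∸ j) ℤ.* v      ≡⟨ ≡.cong (λ z → + (q ^ j) ℤ.* z ℤ.* v) (pos-^ q (m ∸ j)) ⟨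
      + (q ^ j) ℤ.* + (q ^ (m ∸ j)) ℤ.* v        ≡⟨ ≡.cong (ℤ._* v) (ℤ.pos-* (q ^ j) (q ^ (m ∸ j))) ⟨
      + (q ^ j * q ^ (m ∸ j)) ℤ.* v              ≡⟨ ≡.cong (λ z → + z ℤ.* v) (ℕ.^-distribˡ-+-* q j (m ∸ j)) ⟨
      + (q ^ (j + (m ∸ j))) ℤ.* v                ≡⟨ ≡.cong (λ e → + (q ^ e) ℤ.* v) (ℕ.m+[n∸m]≡n (ℕ.<⇒≤ j<m)) ⟩
      + (q ^ m) ℤ.* v                            ∎

  residue-product : QuadraticResidue p q → ∀ {i i′ j} → i < i′ → i′ ≤ k → j ≤ k′ →
    χ* i j ⊗ χ i′ j ≋
      ⌜ φ (p ^ (s ∸ i′)) / 2 * (q ∸ 2) * q ^ (t ∸ j ∸ 1) ⌝ ⊗ χ* i j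
      ⊕ ⌜ φ (p ^ (s ∸ i′)) / 2 * φ (q ^ (t ∸ j)) ⌝ ⊗ (∑[ m ∈ ⦅ j , t ⟧ ] χ* i m)
  residue-product q-residue {i} {i′} {j} i<i′ i′≤k j≤k′ =
    coset-product i<i′ i′≤k j≤k′ (λ _ → g) (λ _ → q∤g)
      (λ {m} j<m → shift-class j<m (residue-class -g∈ (residue⇒inCoset1 q-residue) (m ∸ j)))
      (sumOver-cong {is = ⦅ j , t ⟧} (All.universal (λ m → cosetSum≋ (+ (p ^ i * q ^ m) ℤ.* g)) ⦅ j , t ⟧))

  module _ (j : ℕ) where
    -- The factor that puts q^(m-j) into -⟨l⟩ when q is a nonresidue: g if m - j is even, 1 if it is
    -- odd. It takes the decision as an argument so that the facts about it follow by cases on that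
    -- decision.
    twist : {P : Set} → Dec P → ℤ
    twist (yes _) = g
    twist (no _)  = + 1

    q∤twist : {P : Set} (e : Dec P) → ¬ (+ q ℤ.∣ twist e)
    q∤twist (yes _) = q∤g
    q∤twist (no _)  = p∤1 q-prime

    twist-class : QuadraticNonresidue p q → ∀ m (e : Dec (2 ∣ m ∸ j)) →
                  InCoset l (p ^ s) g ((+ q) ℤ.^ (m ∸ j) ℤ.* twist e)
    twist-class q-nonresidue m (yes (ℕ.divides c eq)) =
      nonresidue-class-even -g∈ (nonresidue⇒neg-inCoset1 q-nonresidue) (c , ≡.trans eq (ℕ.*-comm c 2))
    twist-class q-nonresidue m (no 2∤m-j) = ≡.subst (InCoset l (p ^ s) g) (≡.sym (ℤ.*-identityʳ ((+ q) ℤ.^ (m ∸ j))))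
      (nonresidue-class-odd -g∈ (nonresidue⇒neg-inCoset1 q-nonresidue) (odd (parity (m ∸ j))))
      where
      odd : (∃ λ c → m ∸ j ≡ 2 * c) ⊎ Odd (m ∸ j) → Odd (m ∸ j)
      odd (inj₁ (c , eq)) = contradiction (ℕ.divides c (≡.trans eq (ℕ.*-comm 2 c))) 2∤m-j
      odd (inj₂ o)        = o

    χ≋twist : ∀ i m (e : Dec (2 ∣ m ∸ j)) → ¬ (2 ∣ m ∸ j) → χ i m ≋ cosetElement (+ (p ^ i * q ^ m) ℤ.* twist e)
    χ≋twist i m (yes 2∣m-j) 2∤m-j = contradiction 2∣m-j 2∤m-j
    χ≋twist i m (no _)      _     = ≡.subst (λ γ → χ i m ≋ cosetElement γ)
      (≡.sym (ℤ.*-identityʳ (+ (p ^ i * q ^ m)))) (cosetSum≋ (+ (p ^ i * q ^ m)))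

    χ*≋twist : ∀ i m (e : Dec (2 ∣ m ∸ j)) → 2 ∣ m ∸ j → χ* i m ≋ cosetElement (+ (p ^ i * q ^ m) ℤ.* twist e)
    χ*≋twist i m (yes _)    _     = cosetSum≋ (+ (p ^ i * q ^ m) ℤ.* g)
    χ*≋twist i m (no 2∤m-j) 2∣m-j = contradiction 2∣m-j 2∤m-j

  nonresidue-product : QuadraticNonresidue p q → ∀ {i i′ j} → i < i′ → i′ ≤ k → j ≤ k′ →
    χ* i j ⊗ χ i′ j ≋
      ⌜ φ (p ^ (s ∸ i′)) / 2 * (q ∸ 2) * q ^ (t ∸ j ∸ 1) ⌝ ⊗ χ* i j
      ⊕ ⌜ φ (p ^ (s ∸ i′)) / 2 * φ (q ^ (t ∸ j)) ⌝ ⊗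
          ((∑[ m ∈ ⦅ j , t ⟧-odd ] χ i m) ⊕ (∑[ m ∈ ⦅ j , t ⟧-even ] χ* i m))
  nonresidue-product q-nonresidue {i} {i′} {j} i<i′ i′≤k j≤k′ =
    coset-product i<i′ i′≤k j≤k′ (λ m → twist j (even? m)) (λ m → q∤twist j (even? m))
      (λ {m} j<m → shift-class j<m (twist-class j q-nonresidue m (even? m)))
      (sumOver-merge (λ m → ¬? (even? m)) even? ⦅ j , t ⟧ (λ m → ⟦⟧-¬ (even? m))
        (All.universal (λ m → χ≋twist j i m (even? m)) ⦅ j , t ⟧)
        (All.universal (λ m → χ*≋twist j i m (even? m)) ⦅ j , t ⟧))
    where
    even? : ∀ m → Dec (2 ∣ m ∸ j)
    even? m = 2 ℕ.∣? (m ∸ j)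

theorem4p16 : (p q l s t : ℕ) (g : ℤ) →
    1 ≤ s → 1 ≤ t →
    Prime p → Prime q → Prime l →
    p ≢ q → p ≢ l → q ≢ l →
    ¬ (2 ∣ p) → ¬ (2 ∣ q) →
    p % 4 ≡ 3 →
    HasOrder (p ^ s) (+ l) (φ (p ^ s) / 2) →
    HasOrder (q ^ t) (+ l) (φ (q ^ t)) →
    gcd (φ (p ^ s)) (φ (q ^ t)) ≡ 2 →
    PrimitiveRoot (p ^ s) g →
    PrimitiveRoot (q ^ t) g →
    let open Cyclotomic p q l s t g in
    (i i' j : ℕ) → i < i' → i' ≤ s ∸ 1 → j ≤ t ∸ 1 →
    (QuadraticResidue p q →
    χ* i j ⊗ χ i' j ≋
    ⌜ φ (p ^ (s ∸ i')) / 2 * (q ∸ 2) * q ^ (t ∸ j ∸ 1) ⌝ ⊗ χ* i j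
    ⊕ ⌜ φ (p ^ (s ∸ i')) / 2 * φ (q ^ (t ∸ j)) ⌝ ⊗ (∑[ m ∈ ⦅ j , t ⟧ ] χ* i m))
    ×
    (QuadraticNonresidue p q →
    χ* i j ⊗ χ i' j ≋
    ⌜ φ (p ^ (s ∸ i')) / 2 * (q ∸ 2) * q ^ (t ∸ j ∸ 1) ⌝ ⊗ χ* i j
    ⊕ ⌜ φ (p ^ (s ∸ i')) / 2 * φ (q ^ (t ∸ j)) ⌝ ⊗
    ((∑[ m ∈ ⦅ j , t ⟧-odd ] χ i m) ⊕ (∑[ m ∈ ⦅ j , t ⟧-even ] χ* i m)))
theorem4p16 p q l s t g 1≤s 1≤t p-prime q-prime _ p≢q _ _ _ _ p%4≡3 order-p root-q gcd≡2 root-g-p root-g-q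
  i i' j i<i' i'≤s-1 j≤t-1 =
  (λ q-residue → residue-product q-residue i<i' i'≤s-1 j≤t-1) ,
  (λ q-nonresidue → nonresidue-product q-nonresidue i<i' i'≤s-1 j≤t-1)
  where
  s≡ : s ≡ suc (s ∸ 1)
  s≡ = ≡.sym (ℕ.m+[n∸m]≡n 1≤s)
  t≡ : t ≡ suc (t ∸ 1)
  t≡ = ≡.sym (ℕ.m+[n∸m]≡n 1≤t)
  p^s≢0 : NonZero (p ^ s)
  p^s≢0 = ℕ.m^n≢0 p s {{ℕ.prime⇒nonZero p-prime}}
  q^t≢0 : NonZero (q ^ t)
  q^t≢0 = ℕ.m^n≢0 q t {{ℕ.prime⇒nonZero q-prime}}
  φ/2 : Odd (φ (p ^ s) / 2) × φ (p ^ s) ≡ 2 * (φ (p ^ s) / 2)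
  φ/2 = ≡.subst (λ s → Odd (φ (p ^ s) / 2) × φ (p ^ s) ≡ 2 * (φ (p ^ s) / 2)) (≡.sym s≡) (φ/2-odd p-prime p%4≡3 (s ∸ 1))
  -- With k = s - 1 and k′ = t - 1 the bounds on i′ and j in the theorem are literally those of the
  -- two products.
  open Product p q l s t g {{p^s≢0}} {{q^t≢0}} {{ℕ.m*n≢0 (p ^ s) (q ^ t) {{p^s≢0}} {{q^t≢0}}}} (s ∸ 1) (t ∸ 1) s≡ t≡
    p-prime q-prime p≢q (p-odd p-prime p%4≡3) (proj₁ φ/2) (proj₂ φ/2) order-p root-q
    (odd∣⇒coprime (proj₁ φ/2) (proj₂ φ/2) gcd≡2) root-g-p root-g-q
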